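{- Let $\mathrm S$ be a dependent type theory admitting all the rules of two-dimensional type theory $\mathrm{ML}_2$, and let $\mathfrak C_{\mathrm S}$ be its $2$-category of contexts. For every context $\Gamma$ and type $\Gamma\vdash A\ \mathsf{type}$ in $\mathrm S$, the context $\Gamma.A.A.\mathrm{Id}_A$, together with the projections $\pi_1\pi_{\mathrm{Id}_A},\ \pi_2\pi_{\mathrm{Id}_A}\colon\Gamma.A.A.\mathrm{Id}_A\to\Gamma.A$, can be made into an arrow object for $\Gamma.A$ in the slice $2$-category $\mathfrak C_{\mathrm S}/\Gamma$.
   Context: **Type theory.** $\mathrm S$ has judgement forms $A\ \mathsf{type}$, $a:A$, $A=B\ \mathsf{type}$, $a=b:A$ (definitional equality), relative to contexts $\Gamma=(x_1:A_1,\dots,x_n:A_n)$ with $A_i$ a type in context $(x_1:A_1,\dots,x_{i-1}:A_{i-1})$; equality rules (definitional equality is a congruence) and structural rules (weakening, contraction, exchange, substitution). All rules are relative to an arbitrary ambient context, and all operations are stable under substitution in it. Rules of $\mathrm{ML}_2$: - $\Sigma$: from $A$ and $x:A\vdash B(x)$ form $\Sigma(A,B)$; from $a:A$, $b:B(a)$ get $\langle a,b\rangle:\Sigma(A,B)$; from $z:\Sigma(A,B)\vdash C(z)\ \mathsf{type}$ and $x:A,y:B(x)\vdash d(x,y):C(\langle x,y\rangle)$ get $z:\Sigma(A,B)\vdash \mathrm E_d(z):C(z)$ with $\mathrm E_d(\langle x,y\rangle)=d(x,y)$. - Unit: $\mathbf 1\ \mathsf{type}$; $\star:\mathbf 1$;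 from $z:\mathbf 1\vdash C(z)\ \mathsf{type}$ and $d:C(\star)$ get $z:\mathbf 1\vdash\mathrm U_d(z):C(z)$ with $\mathrm U_d(\star)=d$. - Identity: from $a,b:A$ form $\mathrm{Id}_A(a,b)$; $\mathrm r(a):\mathrm{Id}_A(a,a)$; from $x,y:A,p:\mathrm{Id}_A(x,y)\vdash C(x,y,p)\ \mathsf{type}$ and $x:A\vdash d(x):C(x,x,\mathrm r(x))$ get $x,y:A,p:\mathrm{Id}_A(x,y)\vdash\mathrm J_d(x,y,p):C(x,y,p)$ with $\mathrm J_d(x,x,\mathrm r(x))=d(x)$. - $\Pi$: form $\Pi(A,B)$; from $x:A\vdash f(x):B(x)$ get $\lambda f:\Pi(A,B)$; from $m:\Pi(A,B)$ get $y:A\vdash m\cdot y:B(y)$; $(\lambda f)\cdot y=f(y)$. - Discrete identity types: if $p,q:\mathrm{Id}_A(a,b)$ and $\alpha:\mathrm{Id}(p,q)$ then $p=q$ and $\alpha=\mathrm r(p)$. - Function extensionality: from $m,n:\Pi(A,B)$ and $x:A\vdash p(x):\mathrm{Id}(m\cdot x,n\cdot x)$ get $\mathsf{ext}(m,n,p):\mathrm{Id}(m,n)$; $\mathsf{ext}(m,m,[x]\mathrm r(m\cdot x))=\mathrm r(m)$; $\mathsf{ext}(m,n,p)\ast x=p(x)$, where $p\ast a:=\mathrm J_{[x]\mathrm r(x\cdot a)}(m,n,p)$. By $\Pi$-abstracting over a telescope $\Delta$ one derives extended identity elimination/computation, in which $C$ and the conclusion live in context $x,y:A,p:\mathrm{Id}_A(x,y),\Delta$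 and $d$ in context $x:A,\Delta[x,x,\mathrm r(x)/x,y,p]$. Vector notation is used: an element $a:\Gamma$ of a context is a list of terms. **Identity contexts.** The identity rules extend to contexts by induction on length. For a single type, elimination into a context $\Theta=(u:\Lambda,v:D(u))$ is componentwise: from $d=(d_1,d_2)$ form $\mathrm J_{d_1}$, then $\mathrm J_{d_2}$ into $D(x,y,p,\mathrm J_{d_1}(x,y,p))$. $\mathrm{Id}_{()}=()$, with $\mathrm J_d=d$. For $\Phi=(x:\Lambda,y:D(x))$: transport $p^*(z):\Upsilon(x)$ for $p:\mathrm{Id}_\Lambda(x,x')$, $z:\Upsilon(x')$ is defined by $\mathrm{Id}_\Lambda$-elimination from $\mathrm r(x)^*(z)=z$; $\mathrm{Id}_\Phi((x,y),(x',y')):=(p:\mathrm{Id}_\Lambda(x,x'),\,q:\mathrm{Id}_{D(x)}(y,p^*y'))$; $\mathrm r(x,y):=(\mathrm r(x),\mathrm r(y))$; elimination for $\mathrm{Id}_\Phi$: first apply elimination for $\mathrm{Id}_{D(x)}$ to $d$, giving $d'(x,y,y',q)$, then $\mathrm{Id}_\Lambda$-elimination with post-context $(y,y',q)$ to $d'$. **The 2-category $\mathfrak C_{\mathrm S}$.** (Modulo $\alpha$-conversion and definitional equality.) Objects: contexts. 1-cells $\Gamma\to\Delta$: judgements $x:\Gamma\vdash f(x):\Delta$, composed by substitution. 2-cells $f\Rightarrow g$: judgements $x:\Gamma\vdash\alpha(x):\mathrm{Id}_\Delta(fx,gx)$. Here $q\circ p$ is defined by elimination on $q$ with $\mathrm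 r(y)\circ p=p$, and $h^\bullet(p):\mathrm{Id}_\Delta(hx,hy)$ by elimination on $p$ with $h^\bullet(\mathrm r(x))=\mathrm r(hx)$; vertical composition is $\beta(x)\circ\alpha(x)$, identities are $\mathrm r(fx)$, whiskerings are $(\alpha k)(x)=\alpha(kx)$, $(h\alpha)(x)=h^\bullet(\alpha(x))$. It is locally groupoidal. For a type $A$ in context $\Gamma$: $\Gamma.A=(x:\Gamma,y:A(x))$ with projection $\pi_A\colon\Gamma.A\to\Gamma$; $\Gamma.A.A=(x:\Gamma,y:A(x),z:A(x))$ with $\pi_1,\pi_2\colon\Gamma.A.A\to\Gamma.A$ the projections onto the first and second copy of $A$; $\Gamma.A.A.\mathrm{Id}_A=(x:\Gamma,y:A(x),z:A(x),p:\mathrm{Id}_{A(x)}(y,z))$ with $\pi_{\mathrm{Id}_A}$ its projection to $\Gamma.A.A$. These are regarded as objects of $\mathfrak C_{\mathrm S}/\Gamma$ via the projections to $\Gamma$. The slice $\mathfrak C_{\mathrm S}/\Gamma$ has strictly commuting triangles as 1-cells and, as 2-cells, those whose composite with the structure map to $\Gamma$ is an identity. **Arrow objects.** An arrow object for $X$ in a 2-category $\mathbf K$ is an object $Y$ with a 2-cell $\kappa\colon s\Rightarrow t\colon Y\to X$ such that composition with $\kappa$ gives isomorphisms of categories $\mathbf K(A,Y)\cong\mathbf K(A,X)^{\mathbf 2}$, 2-natural in $A$. "$Y$ together with $s,t$ can be made into an arrow object" means that there is such a $\kappa\colon s\Rightarrow t$. -}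

module Defs where

open import Level using (Level; _⊔_) renaming (suc to lsuc)
open import Data.Nat.Base using (ℕ; zero; suc; _+_)
open import Data.Fin.Base using (Fin; zero; suc; _↑ˡ_; _↑ʳ_)
open import Data.Vec.Base using (Vec; []; _∷_; _++_; map; lookup; tabulate; head; tail)
open import Data.Vec.Properties
  using (map-++; lookup∘tabulate; tabulate∘lookup; tabulate-cong; lookup-++ˡ; lookup-++ʳ)
open import Data.Product using (Σ; _×_; _,_; proj₁; proj₂)
open import Relation.Binary.Core using (Rel)
open import Relation.Binary.Structures using (IsEquivalence)
open import Relation.Binary.PropositionalEquality
  using (_≡_; refl; sym; trans; cong; cong₂; subst; subst₂)

-- Strict categories in a setting without quotients: the objects carry an
-- equality ≈ too, ≋ compares arrows whose endpoints need only be ≈, and cast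
-- moves an arrow along equalities of its endpoints.

record Category (o e a q : Level) : Set (lsuc (o ⊔ e ⊔ a ⊔ q)) where
  infix  4 _≈_ _≋_ _⇒_
  infixr 9 _∘_
  field
    Obj  : Set o
    _≈_  : Rel Obj e
    _⇒_  : Rel Obj a
    _≋_  : ∀ {x y x′ y′} → x ⇒ y → x′ ⇒ y′ → Set q

    ≈-isEquivalence : IsEquivalence _≈_
    ≋-refl  : ∀ {x y} {f : x ⇒ y} → f ≋ f
    ≋-sym   : ∀ {x y x′ y′} {f : x ⇒ y} {g : x′ ⇒ y′} → f ≋ g → g ≋ f
    ≋-trans : ∀ {x y x′ y′ x″ y″} {f : x ⇒ y} {g : x′ ⇒ y′} {h : x″ ⇒ y″} →
              f ≋ g → g ≋ h → f ≋ h
    ≋-dom   : ∀ {x y x′ y′} {f : x ⇒ y} {g : x′ ⇒ y′} → f ≋ g → x ≈ x′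
    ≋-cod   : ∀ {x y x′ y′} {f : x ⇒ y} {g : x′ ⇒ y′} → f ≋ g → y ≈ y′
    cast    : ∀ {x y x′ y′} → x ≈ x′ → y ≈ y′ → x ⇒ y → x′ ⇒ y′
    cast-≋  : ∀ {x y x′ y′} {p : x ≈ x′} {q : y ≈ y′} {f : x ⇒ y} → cast p q f ≋ f

    id      : ∀ {x} → x ⇒ x
    _∘_     : ∀ {x y z} → y ⇒ z → x ⇒ y → x ⇒ z
    id-cong : ∀ {x y} → x ≈ y → id {x} ≋ id {y}
    ∘-cong  : ∀ {x y z x′ y′ z′} {g : y ⇒ z} {f : x ⇒ y} {g′ : y′ ⇒ z′} {f′ : x′ ⇒ y′} →
              g ≋ g′ → f ≋ f′ → g ∘ f ≋ g′ ∘ f′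
    identityˡ : ∀ {x y} {f : x ⇒ y} → id ∘ f ≋ f
    identityʳ : ∀ {x y} {f : x ⇒ y} → f ∘ id ≋ f
    assoc     : ∀ {w x y z} {h : y ⇒ z} {g : x ⇒ y} {f : w ⇒ x} →
                (h ∘ g) ∘ f ≋ h ∘ (g ∘ f)

  module ≈ = IsEquivalence ≈-isEquivalence

record Functor {o e a q o′ e′ a′ q′ : Level}
               (C : Category o e a q) (D : Category o′ e′ a′ q′) :
               Set (o ⊔ e ⊔ a ⊔ q ⊔ o′ ⊔ e′ ⊔ a′ ⊔ q′) where
  private
    module C = Category C
    module D = Category D
  field
    F₀      : C.Obj → D.Obj
    F₁      : ∀ {x y} → x C.⇒ y → F₀ x D.⇒ F₀ y
    F₀-cong : ∀ {x y} → x C.≈ y → F₀ x D.≈ F₀ y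
    F₁-cong : ∀ {x y x′ y′} {f : x C.⇒ y} {g : x′ C.⇒ y′} → f C.≋ g → F₁ f D.≋ F₁ g
    F-id    : ∀ {x} → F₁ (C.id {x}) D.≋ D.id {F₀ x}
    F-∘     : ∀ {x y z} {g : y C.⇒ z} {f : x C.⇒ y} → F₁ (g C.∘ f) D.≋ F₁ g D.∘ F₁ f

record IsIsomorphism {o e a q o′ e′ a′ q′ : Level}
                     {C : Category o e a q} {D : Category o′ e′ a′ q′} (F : Functor C D) :
                     Set (o ⊔ e ⊔ a ⊔ q ⊔ o′ ⊔ e′ ⊔ a′ ⊔ q′) where
  private
    module C = Category C
    module D = Category D
    module F = Functor F
  field
    inverse : Functor D C
  private
    module G = Functor inverse
  field
    GF₀ : ∀ x → G.F₀ (F.F₀ x) C.≈ x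
    GF₁ : ∀ {x y} (f : x C.⇒ y) → G.F₁ (F.F₁ f) C.≋ f
    FG₀ : ∀ x → F.F₀ (G.F₀ x) D.≈ x
    FG₁ : ∀ {x y} (f : x D.⇒ y) → F.F₁ (G.F₁ f) D.≋ f

module _ {o e a q : Level} (C : Category o e a q) where
  open Category C

  record Arrow : Set (o ⊔ a) where
    constructor arrow
    field
      {dom cod} : Obj
      arr       : dom ⇒ cod
  open Arrow

  record Square (f g : Arrow) : Set (a ⊔ q) where
    constructor square
    field
      top      : dom f ⇒ dom g
      bottom   : cod f ⇒ cod g
      commutes : bottom ∘ arr f ≋ arr g ∘ top
  open Square

  record SquareEq {f g f′ g′ : Arrow} (s : Square f g) (t : Square f′ g′) : Set q where
    constructor square≋
    field
      dom≋    : arr f ≋ arr f′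
      cod≋    : arr g ≋ arr g′
      top≋    : top s ≋ top t
      bottom≋ : bottom s ≋ bottom t
  open SquareEq

  Arrows : Category (o ⊔ a) q (a ⊔ q) q
  Arrows = record
    { Obj = Arrow
    ; _≈_ = λ f g → arr f ≋ arr g
    ; _⇒_ = Square
    ; _≋_ = SquareEq
    ; ≈-isEquivalence = record { refl = ≋-refl ; sym = ≋-sym ; trans = ≋-trans }
    ; ≋-refl = square≋ ≋-refl ≋-refl ≋-refl ≋-refl
    ; ≋-sym = λ p → square≋ (≋-sym (dom≋ p)) (≋-sym (cod≋ p)) (≋-sym (top≋ p)) (≋-sym (bottom≋ p))
    ; ≋-trans = λ p r → square≋ (≋-trans (dom≋ p) (dom≋ r)) (≋-trans (cod≋ p) (cod≋ r))
                                  (≋-trans (top≋ p) (top≋ r)) (≋-trans (bottom≋ p) (bottom≋ r))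
    ; ≋-dom = dom≋
    ; ≋-cod = cod≋
    ; cast = λ p r s → square
        (cast (≋-dom p) (≋-dom r) (top s))
        (cast (≋-cod p) (≋-cod r) (bottom s))
        (≋-trans (∘-cong cast-≋ (≋-sym p))
          (≋-trans (commutes s) (∘-cong r (≋-sym cast-≋))))
    ; cast-≋ = λ {_} {_} {_} {_} {p} {r} → square≋ (≋-sym p) (≋-sym r) cast-≋ cast-≋
    ; id = square id id (≋-trans identityˡ (≋-sym identityʳ))
    ; _∘_ = λ t s → square (top t ∘ top s) (bottom t ∘ bottom s)
        (≋-trans assoc (≋-trans (∘-cong ≋-refl (commutes s))
          (≋-trans (≋-sym assoc) (≋-trans (∘-cong (commutes t) ≋-refl) assoc))))
    ; id-cong = λ p → square≋ p p (id-cong (≋-dom p)) (id-cong (≋-cod p))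
    ; ∘-cong = λ p r → square≋ (dom≋ r) (cod≋ p) 
        (∘-cong (top≋ p) (top≋ r)) (∘-cong (bottom≋ p) (bottom≋ r))
    ; identityˡ = square≋ ≋-refl ≋-refl identityˡ identityˡ
    ; identityʳ = square≋ ≋-refl ≋-refl identityʳ identityʳ
    ; assoc = square≋ ≋-refl ≋-refl assoc assoc
    }

-- A strict 2-category, with horizontal composition given by whiskering.

record TwoCategory (c o e a q : Level) : Set (lsuc (c ⊔ o ⊔ e ⊔ a ⊔ q)) where
  infixr 9 _∙_
  infixr 8 _▹_
  infixl 8 _◃_
  field
    Cell₀ : Set c
    Hom   : Cell₀ → Cell₀ → Category o e a q

  module Hom {A B : Cell₀} = Category (Hom A B)

  Cell₁ : Cell₀ → Cell₀ → Set o
  Cell₁ A B = Category.Obj (Hom A B)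

  open Hom public using (_≈_; _⇒_; _≋_)

  field
    1₁    : ∀ {A} → Cell₁ A A
    _∙_   : ∀ {A B C} → Cell₁ B C → Cell₁ A B → Cell₁ A C
    _▹_   : ∀ {A B C} (h : Cell₁ B C) {f g : Cell₁ A B} → f ⇒ g → h ∙ f ⇒ h ∙ g
    _◃_   : ∀ {A B C} {f g : Cell₁ B C} → f ⇒ g → (k : Cell₁ A B) → f ∙ k ⇒ g ∙ k

    ∙-cong : ∀ {A B C} {f f′ : Cell₁ B C} {g g′ : Cell₁ A B} →
             f ≈ f′ → g ≈ g′ → f ∙ g ≈ f′ ∙ g′
    ▹-cong : ∀ {A B C} {h h′ : Cell₁ B C} {f g f′ g′ : Cell₁ A B} {α : f ⇒ g} {β : f′ ⇒ g′} →
             h ≈ h′ → α ≋ β → h ▹ α ≋ h′ ▹ β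
    ◃-cong : ∀ {A B C} {k k′ : Cell₁ A B} {f g f′ g′ : Cell₁ B C} {α : f ⇒ g} {β : f′ ⇒ g′} →
             α ≋ β → k ≈ k′ → α ◃ k ≋ β ◃ k′

    ∙-identityˡ : ∀ {A B} {f : Cell₁ A B} → 1₁ ∙ f ≈ f
    ∙-identityʳ : ∀ {A B} {f : Cell₁ A B} → f ∙ 1₁ ≈ f
    ∙-assoc     : ∀ {A B C D} {h : Cell₁ C D} {g : Cell₁ B C} {f : Cell₁ A B} →
                  (h ∙ g) ∙ f ≈ h ∙ (g ∙ f)

    ▹-id : ∀ {A B C} {h : Cell₁ B C} {f : Cell₁ A B} → h ▹ Hom.id {x = f} ≋ Hom.id {x = h ∙ f}
    ▹-∘  : ∀ {A B C} {h : Cell₁ B C} {f g k : Cell₁ A B} {β : g ⇒ k} {α : f ⇒ g} →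
           h ▹ (β Hom.∘ α) ≋ (h ▹ β) Hom.∘ (h ▹ α)
    ◃-id : ∀ {A B C} {k : Cell₁ A B} {f : Cell₁ B C} → Hom.id {x = f} ◃ k ≋ Hom.id {x = f ∙ k}
    ◃-∘  : ∀ {A B C} {k : Cell₁ A B} {f g h : Cell₁ B C} {β : g ⇒ h} {α : f ⇒ g} →
           (β Hom.∘ α) ◃ k ≋ (β ◃ k) Hom.∘ (α ◃ k)

    1▹  : ∀ {A B} {f g : Cell₁ A B} {α : f ⇒ g} → 1₁ ▹ α ≋ α
    ∙▹  : ∀ {A B C D} {h : Cell₁ C D} {k : Cell₁ B C} {f g : Cell₁ A B} {α : f ⇒ g} →
          (h ∙ k) ▹ α ≋ h ▹ (k ▹ α)
    ◃1  : ∀ {A B} {f g : Cell₁ A B} {α : f ⇒ g} → α ◃ 1₁ ≋ α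
    ◃∙  : ∀ {A B C D} {f g : Cell₁ C D} {α : f ⇒ g} {h : Cell₁ B C} {k : Cell₁ A B} →
          α ◃ (h ∙ k) ≋ (α ◃ h) ◃ k
    ▹◃  : ∀ {A B C D} {h : Cell₁ C D} {f g : Cell₁ B C} {α : f ⇒ g} {k : Cell₁ A B} →
          (h ▹ α) ◃ k ≋ h ▹ (α ◃ k)

    interchange : ∀ {A B C} {f g : Cell₁ A B} {h k : Cell₁ B C} {α : f ⇒ g} {β : h ⇒ k} →
                  (k ▹ α) Hom.∘ (β ◃ f) ≋ (β ◃ g) Hom.∘ (h ▹ α)

module _ {c o e a q : Level} (K : TwoCategory c o e a q) where
  open TwoCategory K
  open Arrow
  open Square

  module _ {X A B : Cell₀} where

    restrict₀ : Cell₁ B A → Arrow (Hom A X) → Arrow (Hom B X)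
    restrict₀ f x = arrow (arr x ◃ f)

    restrict₁ : (f : Cell₁ B A) {x y : Arrow (Hom A X)} → Square (Hom A X) x y →
                Square (Hom B X) (restrict₀ f x) (restrict₀ f y)
    restrict₁ f σ = square (top σ ◃ f) (bottom σ ◃ f)
      (Hom.≋-trans (Hom.≋-sym ◃-∘)
        (Hom.≋-trans (◃-cong (commutes σ) Hom.≈.refl) ◃-∘))

    restrict₂ : {f f′ : Cell₁ B A} → f ⇒ f′ → (x : Arrow (Hom A X)) →
                Square (Hom B X) (restrict₀ f x) (restrict₀ f′ x)
    restrict₂ φ x = square (dom x ▹ φ) (cod x ▹ φ) interchange

  record IsTwoNatural {X Y : Cell₀} (F : ∀ A → Functor (Hom A Y) (Arrows (Hom A X))) :
                      Set (c ⊔ o ⊔ a ⊔ q) where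
    private
      module F A = Functor (F A)
      module X² A = Category (Arrows (Hom A X))
    field
      natural₀ : ∀ {A B} (f : Cell₁ B A) (y : Cell₁ A Y) →
                 X²._≈_ B (F.F₀ B (y ∙ f)) (restrict₀ f (F.F₀ A y))
      natural₁ : ∀ {A B} (f : Cell₁ B A) {y z : Cell₁ A Y} (μ : y ⇒ z) →
                 X²._≋_ B (F.F₁ B (μ ◃ f)) (restrict₁ f (F.F₁ A μ))
      natural₂ : ∀ {A B} {f f′ : Cell₁ B A} (φ : f ⇒ f′) (y : Cell₁ A Y) →
                 X²._≋_ B (F.F₁ B (y ▹ φ)) (restrict₂ φ (F.F₀ A y))

  module _ {X Y : Cell₀} {s t : Cell₁ Y X} (κ : s ⇒ t) where

    composeWith : ∀ A → Functor (Hom A Y) (Arrows (Hom A X))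
    composeWith A = record
      { F₀ = λ y → arrow (κ ◃ y)
      ; F₁ = λ μ → square (s ▹ μ) (t ▹ μ) interchange
      ; F₀-cong = ◃-cong Hom.≋-refl
      ; F₁-cong = λ p → record
          { dom≋ = ◃-cong Hom.≋-refl (Hom.≋-dom p) ; cod≋ = ◃-cong Hom.≋-refl (Hom.≋-cod p)
          ; top≋ = ▹-cong Hom.≈.refl p ; bottom≋ = ▹-cong Hom.≈.refl p }
      ; F-id = record { dom≋ = Hom.≋-refl ; cod≋ = Hom.≋-refl ; top≋ = ▹-id ; bottom≋ = ▹-id }
      ; F-∘ = record { dom≋ = Hom.≋-refl ; cod≋ = Hom.≋-refl ; top≋ = ▹-∘ ; bottom≋ = ▹-∘ }
      }

    -- Naturality holds for every κ, by the laws of a 2-category.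
    record IsArrowObject : Set (c ⊔ o ⊔ e ⊔ a ⊔ q) where
      field
        isomorphism : ∀ A → IsIsomorphism (composeWith A)
        natural     : IsTwoNatural composeWith

  CanBeMadeArrowObject : {X : Cell₀} (Y : Cell₀) (s t : Cell₁ Y X) → Set (c ⊔ o ⊔ e ⊔ a ⊔ q)
  CanBeMadeArrowObject Y s t = Σ (s ⇒ t) IsArrowObject

  module _ (Γ : Cell₀) where

    record Over : Set (c ⊔ o) where
      constructor over
      field
        {total} : Cell₀
        proj    : Cell₁ total Γ
    open Over

    record Over₁ (X Y : Over) : Set (o ⊔ e) where
      constructor over₁
      field
        cell₁    : Cell₁ (total X) (total Y)
        triangle : proj Y ∙ cell₁ ≈ proj X
    open Over₁

    record Over₂ {X Y : Over} (h k : Over₁ X Y) : Set (a ⊔ q) where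
      constructor over₂
      field
        cell₂    : cell₁ h ⇒ cell₁ k
        identity : proj Y ▹ cell₂ ≋ Hom.id {x = proj Y ∙ cell₁ h}
    open Over₂

    OverHom : Over → Over → Category (o ⊔ e) e (a ⊔ q) q
    OverHom X Y = record
      { Obj = Over₁ X Y
      ; _≈_ = λ h k → cell₁ h ≈ cell₁ k
      ; _⇒_ = Over₂
      ; _≋_ = λ α β → cell₂ α ≋ cell₂ β
      ; ≈-isEquivalence = record { refl = Hom.≈.refl ; sym = Hom.≈.sym ; trans = Hom.≈.trans }
      ; ≋-refl = Hom.≋-refl
      ; ≋-sym = Hom.≋-sym
      ; ≋-trans = Hom.≋-trans
      ; ≋-dom = Hom.≋-dom
      ; ≋-cod = Hom.≋-cod
      ; cast = λ p r α → over₂ (Hom.cast p r (cell₂ α))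
          (Hom.≋-trans (▹-cong Hom.≈.refl Hom.cast-≋)
            (Hom.≋-trans (identity α) (Hom.id-cong (∙-cong Hom.≈.refl p))))
      ; cast-≋ = Hom.cast-≋
      ; id = over₂ Hom.id ▹-id
      ; _∘_ = λ {h} {k} {l} β α → over₂ (cell₂ β Hom.∘ cell₂ α)
          (Hom.≋-trans ▹-∘ (Hom.≋-trans (Hom.∘-cong (identity β) Hom.≋-refl)
            (Hom.≋-trans (Hom.∘-cong
              (Hom.id-cong (Hom.≈.trans (triangle k) (Hom.≈.sym (triangle h)))) (identity α))
              Hom.identityˡ)))
      ; id-cong = Hom.id-cong
      ; ∘-cong = Hom.∘-cong
      ; identityˡ = Hom.identityˡ
      ; identityʳ = Hom.identityʳ
      ; assoc = Hom.assoc
      }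

    Slice : TwoCategory (c ⊔ o) (o ⊔ e) e (a ⊔ q) q
    Slice = record
      { Cell₀ = Over
      ; Hom = OverHom
      ; 1₁ = over₁ 1₁ ∙-identityʳ
      ; _∙_ = λ h k → over₁ (cell₁ h ∙ cell₁ k)
          (Hom.≈.trans (Hom.≈.sym ∙-assoc)
            (Hom.≈.trans (∙-cong (triangle h) Hom.≈.refl) (triangle k)))
      ; _▹_ = λ {_} {_} {_} h {f} {g} α → over₂ (cell₁ h ▹ cell₂ α)
          (Hom.≋-trans (Hom.≋-sym ∙▹) (Hom.≋-trans (▹-cong (triangle h) Hom.≋-refl)
            (Hom.≋-trans (identity α)
              (Hom.id-cong (Hom.≈.trans (∙-cong (Hom.≈.sym (triangle h)) Hom.≈.refl) ∙-assoc)))))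
      ; _◃_ = λ α k → over₂ (cell₂ α ◃ cell₁ k)
          (Hom.≋-trans (Hom.≋-sym ▹◃) (Hom.≋-trans (◃-cong (identity α) Hom.≈.refl)
            (Hom.≋-trans ◃-id (Hom.id-cong ∙-assoc))))
      ; ∙-cong = ∙-cong
      ; ▹-cong = ▹-cong
      ; ◃-cong = ◃-cong
      ; ∙-identityˡ = ∙-identityˡ
      ; ∙-identityʳ = ∙-identityʳ
      ; ∙-assoc = ∙-assoc
      ; ▹-id = ▹-id
      ; ▹-∘ = ▹-∘
      ; ◃-id = ◃-id
      ; ◃-∘ = ◃-∘
      ; 1▹ = 1▹
      ; ∙▹ = ∙▹
      ; ◃1 = ◃1
      ; ◃∙ = ◃∙
      ; ▹◃ = ▹◃
      ; interchange = interchange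
      }

-- Well-scoped raw expressions modulo α-conversion.  The expression formers
-- are left open, since S may have more of them than ML₂ requires; only the
-- judgements below know about definitional equality.

record Expressions (r : Level) : Set (lsuc r) where
  infixl 20 _[_]ᵀ _[_]
  field
    Ty Tm : ℕ → Set r
    var   : ∀ {n} → Fin n → Tm n
    _[_]ᵀ : ∀ {m n} → Ty n → Vec (Tm m) n → Ty m
    _[_]  : ∀ {m n} → Tm n → Vec (Tm m) n → Tm m

    var-[]  : ∀ {m n} (i : Fin n) (σ : Vec (Tm m) n) → var i [ σ ] ≡ lookup σ i
    []-idᵀ  : ∀ {n} (A : Ty n) → A [ tabulate var ]ᵀ ≡ A
    []-id   : ∀ {n} (t : Tm n) → t [ tabulate var ] ≡ t
    []-[]ᵀ  : ∀ {l m n} (A : Ty n) (σ : Vec (Tm m) n) (τ : Vec (Tm l) m) →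
              A [ σ ]ᵀ [ τ ]ᵀ ≡ A [ map (_[ τ ]) σ ]ᵀ
    []-[]   : ∀ {l m n} (t : Tm n) (σ : Vec (Tm m) n) (τ : Vec (Tm l) m) →
              t [ σ ] [ τ ] ≡ t [ map (_[ τ ]) σ ]

module Raw {r : Level} (E : Expressions r) where
  open Expressions E public
  infixl 20 _⟨_⟩
  infixl 5 _▷_ _⧺_

  -- Sub m n is the set of lists of n expressions in m variables; the most
  -- recent variable comes first.
  Sub : ℕ → ℕ → Set r
  Sub m n = Vec (Tm m) n

  _⟨_⟩ : ∀ {l m n} → Sub m n → Sub l m → Sub l n
  σ ⟨ τ ⟩ = map (_[ τ ]) σ

  ids : ∀ {n} → Sub n n
  ids = tabulate var

  wks : ∀ {n} → Sub (suc n) n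
  wks = tabulate (λ i → var (suc i))

  lift : ∀ {m n} → Sub m n → Sub (suc m) (suc n)
  lift σ = var zero ∷ σ ⟨ wks ⟩

  vars : ∀ {n} l → Sub (l + n) l
  vars {n} l = tabulate (λ i → var (i ↑ˡ n))

  wksBy : ∀ {n} l → Sub (l + n) n
  wksBy l = tabulate (λ i → var (l ↑ʳ i))

  data Ctx : ℕ → Set r where
    []  : Ctx zero
    _▷_ : ∀ {n} → Ctx n → Ty n → Ctx (suc n)

  lookupCtx : ∀ {n} → Ctx n → Fin n → Ty n
  lookupCtx (Γ ▷ A) zero    = A [ wks ]ᵀ
  lookupCtx (Γ ▷ A) (suc i) = lookupCtx Γ i [ wks ]ᵀ

  -- Telescopes, that is, contexts relative to n variables.
  data Tel (n : ℕ) : ℕ → Set r where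
    []  : Tel n zero
    _▷_ : ∀ {l} → Tel n l → Ty (l + n) → Tel n (suc l)

  _⧺_ : ∀ {n l} → Ctx n → Tel n l → Ctx (l + n)
  Γ ⧺ []      = Γ
  Γ ⧺ (T ▷ A) = (Γ ⧺ T) ▷ A

record JudgementForms {r : Level} (j : Level) (E : Expressions r) : Set (r ⊔ lsuc j) where
  open Raw E
  infix 4 _⊢_type _⊢_∶_ _⊢_≐_type _⊢_≐_∶_
  field
    _⊢_type   : ∀ {n} → Ctx n → Ty n → Set j
    _⊢_∶_     : ∀ {n} → Ctx n → Tm n → Ty n → Set j
    _⊢_≐_type : ∀ {n} → Ctx n → Ty n → Ty n → Set j
    _⊢_≐_∶_   : ∀ {n} → Ctx n → Tm n → Tm n → Ty n → Set j

module Judgements {r j : Level} {E : Expressions r} (J : JudgementForms j E) where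
  open Raw E public
  open JudgementForms J public
  infix 4 ⊢_ _⊢_∶ˢ_ _⊢_≐_∶ˢ_ _⊢_∶ᵗ_ _⊢_≐_∶ᵗ_

  data ⊢_ : ∀ {n} → Ctx n → Set (r ⊔ j) where
    []  : ⊢ []
    _▷_ : ∀ {n} {Γ : Ctx n} {A} → ⊢ Γ → Γ ⊢ A type → ⊢ Γ ▷ A

  data _⊢_∶ˢ_ {m} (Γ : Ctx m) : ∀ {n} → Sub m n → Ctx n → Set (r ⊔ j) where
    []  : ⊢ Γ → Γ ⊢ [] ∶ˢ []
    _∷_ : ∀ {n} {Δ : Ctx n} {A σ t} → Γ ⊢ σ ∶ˢ Δ → Δ ⊢ A type × Γ ⊢ t ∶ A [ σ ]ᵀ →
          Γ ⊢ t ∷ σ ∶ˢ Δ ▷ A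

  data _⊢_≐_∶ˢ_ {m} (Γ : Ctx m) : ∀ {n} → Sub m n → Sub m n → Ctx n → Set (r ⊔ j) where
    []  : ⊢ Γ → Γ ⊢ [] ≐ [] ∶ˢ []
    _∷_ : ∀ {n} {Δ : Ctx n} {A σ τ t u} → Γ ⊢ σ ≐ τ ∶ˢ Δ →
          Δ ⊢ A type × Γ ⊢ t ≐ u ∶ A [ σ ]ᵀ → Γ ⊢ t ∷ σ ≐ u ∷ τ ∶ˢ Δ ▷ A

  data _⊢_∶ᵗ_ {n} (Γ : Ctx n) : ∀ {l} → Sub n l → Tel n l → Set (r ⊔ j) where
    []  : ⊢ Γ → Γ ⊢ [] ∶ᵗ []
    _∷_ : ∀ {l} {T : Tel n l} {A δ t} → Γ ⊢ δ ∶ᵗ T → Γ ⊢ t ∶ A [ δ ++ ids ]ᵀ →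
          Γ ⊢ t ∷ δ ∶ᵗ T ▷ A

  data _⊢_≐_∶ᵗ_ {n} (Γ : Ctx n) : ∀ {l} → Sub n l → Sub n l → Tel n l → Set (r ⊔ j) where
    []  : ⊢ Γ → Γ ⊢ [] ≐ [] ∶ᵗ []
    _∷_ : ∀ {l} {T : Tel n l} {A δ ε t u} → Γ ⊢ δ ≐ ε ∶ᵗ T → Γ ⊢ t ≐ u ∶ A [ δ ++ ids ]ᵀ →
          Γ ⊢ t ∷ δ ≐ u ∷ ε ∶ᵗ T ▷ A

record TypeTheory (r j : Level) : Set (lsuc (r ⊔ j)) where
  field
    expressions : Expressions r
    judgements  : JudgementForms j expressions
  open Judgements judgements public

  field
    type-ctx   : ∀ {n} {Γ : Ctx n} {A} → Γ ⊢ A type → ⊢ Γ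
    term-type  : ∀ {n} {Γ : Ctx n} {A t} → Γ ⊢ t ∶ A → Γ ⊢ A type
    ≐type-type : ∀ {n} {Γ : Ctx n} {A B} → Γ ⊢ A ≐ B type → Γ ⊢ A type × Γ ⊢ B type
    ≐term-term : ∀ {n} {Γ : Ctx n} {A t u} → Γ ⊢ t ≐ u ∶ A → Γ ⊢ t ∶ A × Γ ⊢ u ∶ A

    ≐type-refl  : ∀ {n} {Γ : Ctx n} {A} → Γ ⊢ A type → Γ ⊢ A ≐ A type
    ≐type-sym   : ∀ {n} {Γ : Ctx n} {A B} → Γ ⊢ A ≐ B type → Γ ⊢ B ≐ A type
    ≐type-trans : ∀ {n} {Γ : Ctx n} {A B C} →
                  Γ ⊢ A ≐ B type → Γ ⊢ B ≐ C type → Γ ⊢ A ≐ C type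
    ≐-refl      : ∀ {n} {Γ : Ctx n} {A t} → Γ ⊢ t ∶ A → Γ ⊢ t ≐ t ∶ A
    ≐-sym       : ∀ {n} {Γ : Ctx n} {A t u} → Γ ⊢ t ≐ u ∶ A → Γ ⊢ u ≐ t ∶ A
    ≐-trans     : ∀ {n} {Γ : Ctx n} {A t u v} →
                  Γ ⊢ t ≐ u ∶ A → Γ ⊢ u ≐ v ∶ A → Γ ⊢ t ≐ v ∶ A
    conv        : ∀ {n} {Γ : Ctx n} {A B t} → Γ ⊢ A ≐ B type → Γ ⊢ t ∶ A → Γ ⊢ t ∶ B
    ≐-conv      : ∀ {n} {Γ : Ctx n} {A B t u} →
                  Γ ⊢ A ≐ B type → Γ ⊢ t ≐ u ∶ A → Γ ⊢ t ≐ u ∶ B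

    -- Variables and simultaneous substitution; weakening, contraction and
    -- exchange are substitutions of variables.
    var-type      : ∀ {n} {Γ : Ctx n} → ⊢ Γ → ∀ i → Γ ⊢ var i ∶ lookupCtx Γ i
    subst-type    : ∀ {m n} {Γ : Ctx m} {Δ : Ctx n} {σ A} →
                    Γ ⊢ σ ∶ˢ Δ → Δ ⊢ A type → Γ ⊢ A [ σ ]ᵀ type
    subst-term    : ∀ {m n} {Γ : Ctx m} {Δ : Ctx n} {σ A t} →
                    Γ ⊢ σ ∶ˢ Δ → Δ ⊢ t ∶ A → Γ ⊢ t [ σ ] ∶ A [ σ ]ᵀ
    subst-≐type   : ∀ {m n} {Γ : Ctx m} {Δ : Ctx n} {σ A B} →
                    Γ ⊢ σ ∶ˢ Δ → Δ ⊢ A ≐ B type → Γ ⊢ A [ σ ]ᵀ ≐ B [ σ ]ᵀ type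
    subst-≐       : ∀ {m n} {Γ : Ctx m} {Δ : Ctx n} {σ A t u} →
                    Γ ⊢ σ ∶ˢ Δ → Δ ⊢ t ≐ u ∶ A → Γ ⊢ t [ σ ] ≐ u [ σ ] ∶ A [ σ ]ᵀ
    type-subst-≐  : ∀ {m n} {Γ : Ctx m} {Δ : Ctx n} {σ τ A} →
                    Γ ⊢ σ ≐ τ ∶ˢ Δ → Δ ⊢ A type → Γ ⊢ A [ σ ]ᵀ ≐ A [ τ ]ᵀ type
    term-subst-≐  : ∀ {m n} {Γ : Ctx m} {Δ : Ctx n} {σ τ A t} →
                    Γ ⊢ σ ≐ τ ∶ˢ Δ → Δ ⊢ t ∶ A → Γ ⊢ t [ σ ] ≐ t [ τ ] ∶ A [ σ ]ᵀ

-- As in E_d(z), U_d(z), J_d(x,y,p), m · y, λf and ext(m,n,p), term formers do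
-- not record types.  Eliminators are applied to arbitrary elements, which by
-- substitution is the same as applying them to a fresh variable.

record ML₂ {r j : Level} (S : TypeTheory r j) : Set (r ⊔ j) where
  open TypeTheory S
  field
    Σ′    : ∀ {n} → Ty n → Ty (suc n) → Ty n
    pair  : ∀ {n} → Tm n → Tm n → Tm n
    E     : ∀ {n} → Tm (suc (suc n)) → Tm n → Tm n
    𝟏     : ∀ {n} → Ty n
    ⋆     : ∀ {n} → Tm n
    U     : ∀ {n} → Tm n → Tm n → Tm n
    Id    : ∀ {n} → Ty n → Tm n → Tm n → Ty n
    rfl   : ∀ {n} → Tm n → Tm n
    J     : ∀ {n} → Tm (suc n) → Tm n → Tm n → Tm n → Tm n
    Π     : ∀ {n} → Ty n → Ty (suc n) → Ty n
    lam   : ∀ {n} → Tm (suc n) → Tm n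
    app   : ∀ {n} → Tm n → Tm n → Tm n
    ext   : ∀ {n} → Tm n → Tm n → Tm (suc n) → Tm n

    Σ′-[]   : ∀ {m n} A B (σ : Sub m n) → Σ′ A B [ σ ]ᵀ ≡ Σ′ (A [ σ ]ᵀ) (B [ lift σ ]ᵀ)
    pair-[] : ∀ {m n} a b (σ : Sub m n) → pair a b [ σ ] ≡ pair (a [ σ ]) (b [ σ ])
    E-[]    : ∀ {m n} d c (σ : Sub m n) → E d c [ σ ] ≡ E (d [ lift (lift σ) ]) (c [ σ ])
    𝟏-[]    : ∀ {m n} (σ : Sub m n) → 𝟏 [ σ ]ᵀ ≡ 𝟏
    ⋆-[]    : ∀ {m n} (σ : Sub m n) → ⋆ [ σ ] ≡ ⋆
    U-[]    : ∀ {m n} d c (σ : Sub m n) → U d c [ σ ] ≡ U (d [ σ ]) (c [ σ ])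
    Id-[]   : ∀ {m n} A a b (σ : Sub m n) →
              Id A a b [ σ ]ᵀ ≡ Id (A [ σ ]ᵀ) (a [ σ ]) (b [ σ ])
    rfl-[]  : ∀ {m n} a (σ : Sub m n) → rfl a [ σ ] ≡ rfl (a [ σ ])
    J-[]    : ∀ {m n} d a b p (σ : Sub m n) →
              J d a b p [ σ ] ≡ J (d [ lift σ ]) (a [ σ ]) (b [ σ ]) (p [ σ ])
    Π-[]    : ∀ {m n} A B (σ : Sub m n) → Π A B [ σ ]ᵀ ≡ Π (A [ σ ]ᵀ) (B [ lift σ ]ᵀ)
    lam-[]  : ∀ {m n} f (σ : Sub m n) → lam f [ σ ] ≡ lam (f [ lift σ ])
    app-[]  : ∀ {m n} f a (σ : Sub m n) → app f a [ σ ] ≡ app (f [ σ ]) (a [ σ ])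
    ext-[]  : ∀ {m n} f g p (σ : Sub m n) →
              ext f g p [ σ ] ≡ ext (f [ σ ]) (g [ σ ]) (p [ lift σ ])

  Id-ctx : ∀ {n} → Ctx n → Ty n → Ctx (suc (suc (suc n)))
  Id-ctx Γ A = Γ ▷ A ▷ A [ wks ]ᵀ ▷
               Id (A [ wks ]ᵀ [ wks ]ᵀ) (var (suc zero)) (var zero)

  -- p ∗ a = J_{[x] r(x · a)}(f , g , p)
  happly : ∀ {n} → Tm n → Tm n → Tm n → Tm n → Tm n
  happly f g p a = J (rfl (app (var zero) (a [ wks ]))) f g p

  field
    Σ-form  : ∀ {n} {Γ : Ctx n} {A B} → Γ ⊢ A type → Γ ▷ A ⊢ B type → Γ ⊢ Σ′ A B type
    Σ-intro : ∀ {n} {Γ : Ctx n} {A B a b} → Γ ▷ A ⊢ B type →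
              Γ ⊢ a ∶ A → Γ ⊢ b ∶ B [ a ∷ ids ]ᵀ → Γ ⊢ pair a b ∶ Σ′ A B
    Σ-elim  : ∀ {n} {Γ : Ctx n} {A B C d c} → Γ ▷ A ⊢ B type → Γ ▷ Σ′ A B ⊢ C type →
              Γ ▷ A ▷ B ⊢ d ∶ C [ pair (var (suc zero)) (var zero) ∷ wks ⟨ wks ⟩ ]ᵀ →
              Γ ⊢ c ∶ Σ′ A B → Γ ⊢ E d c ∶ C [ c ∷ ids ]ᵀ
    Σ-β     : ∀ {n} {Γ : Ctx n} {A B C d a b} → Γ ▷ A ⊢ B type → Γ ▷ Σ′ A B ⊢ C type →
              Γ ▷ A ▷ B ⊢ d ∶ C [ pair (var (suc zero)) (var zero) ∷ wks ⟨ wks ⟩ ]ᵀ →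
              Γ ⊢ a ∶ A → Γ ⊢ b ∶ B [ a ∷ ids ]ᵀ →
              Γ ⊢ E d (pair a b) ≐ d [ b ∷ a ∷ ids ] ∶ C [ pair a b ∷ ids ]ᵀ

    𝟏-form  : ∀ {n} {Γ : Ctx n} → ⊢ Γ → Γ ⊢ 𝟏 type
    𝟏-intro : ∀ {n} {Γ : Ctx n} → ⊢ Γ → Γ ⊢ ⋆ ∶ 𝟏
    𝟏-elim  : ∀ {n} {Γ : Ctx n} {C d c} → Γ ▷ 𝟏 ⊢ C type →
              Γ ⊢ d ∶ C [ ⋆ ∷ ids ]ᵀ → Γ ⊢ c ∶ 𝟏 → Γ ⊢ U d c ∶ C [ c ∷ ids ]ᵀ
    𝟏-β     : ∀ {n} {Γ : Ctx n} {C d} → Γ ▷ 𝟏 ⊢ C type →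
              Γ ⊢ d ∶ C [ ⋆ ∷ ids ]ᵀ → Γ ⊢ U d ⋆ ≐ d ∶ C [ ⋆ ∷ ids ]ᵀ

    Id-form  : ∀ {n} {Γ : Ctx n} {A a b} → Γ ⊢ a ∶ A → Γ ⊢ b ∶ A → Γ ⊢ Id A a b type
    Id-intro : ∀ {n} {Γ : Ctx n} {A a} → Γ ⊢ a ∶ A → Γ ⊢ rfl a ∶ Id A a a
    Id-elim  : ∀ {n} {Γ : Ctx n} {A C d a b p} → Id-ctx Γ A ⊢ C type →
               Γ ▷ A ⊢ d ∶ C [ rfl (var zero) ∷ var zero ∷ var zero ∷ wks ]ᵀ →
               Γ ⊢ a ∶ A → Γ ⊢ b ∶ A → Γ ⊢ p ∶ Id A a b →
               Γ ⊢ J d a b p ∶ C [ p ∷ b ∷ a ∷ ids ]ᵀ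
    Id-β     : ∀ {n} {Γ : Ctx n} {A C d a} → Id-ctx Γ A ⊢ C type →
               Γ ▷ A ⊢ d ∶ C [ rfl (var zero) ∷ var zero ∷ var zero ∷ wks ]ᵀ →
               Γ ⊢ a ∶ A →
               Γ ⊢ J d a a (rfl a) ≐ d [ a ∷ ids ] ∶ C [ rfl a ∷ a ∷ a ∷ ids ]ᵀ

    Π-form  : ∀ {n} {Γ : Ctx n} {A B} → Γ ⊢ A type → Γ ▷ A ⊢ B type → Γ ⊢ Π A B type
    Π-intro : ∀ {n} {Γ : Ctx n} {A B f} → Γ ▷ A ⊢ f ∶ B → Γ ⊢ lam f ∶ Π A B
    Π-elim  : ∀ {n} {Γ : Ctx n} {A B f a} → Γ ▷ A ⊢ B type →
              Γ ⊢ f ∶ Π A B → Γ ⊢ a ∶ A → Γ ⊢ app f a ∶ B [ a ∷ ids ]ᵀ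
    Π-β     : ∀ {n} {Γ : Ctx n} {A B f a} →
              Γ ▷ A ⊢ f ∶ B → Γ ⊢ a ∶ A → Γ ⊢ app (lam f) a ≐ f [ a ∷ ids ] ∶ B [ a ∷ ids ]ᵀ

    discrete     : ∀ {n} {Γ : Ctx n} {A a b p q α} → Γ ⊢ p ∶ Id A a b → Γ ⊢ q ∶ Id A a b →
                   Γ ⊢ α ∶ Id (Id A a b) p q → Γ ⊢ p ≐ q ∶ Id A a b
    discrete-rfl : ∀ {n} {Γ : Ctx n} {A a b p q α} → Γ ⊢ p ∶ Id A a b → Γ ⊢ q ∶ Id A a b →
                   Γ ⊢ α ∶ Id (Id A a b) p q → Γ ⊢ α ≐ rfl p ∶ Id (Id A a b) p q

    ext-intro : ∀ {n} {Γ : Ctx n} {A B f g p} → Γ ▷ A ⊢ B type →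
                Γ ⊢ f ∶ Π A B → Γ ⊢ g ∶ Π A B →
                Γ ▷ A ⊢ p ∶ Id B (app (f [ wks ]) (var zero)) (app (g [ wks ]) (var zero)) →
                Γ ⊢ ext f g p ∶ Id (Π A B) f g
    ext-rfl   : ∀ {n} {Γ : Ctx n} {A B f} → Γ ▷ A ⊢ B type → Γ ⊢ f ∶ Π A B →
                Γ ⊢ ext f f (rfl (app (f [ wks ]) (var zero))) ≐ rfl f ∶ Id (Π A B) f f
    ext-β     : ∀ {n} {Γ : Ctx n} {A B f g p a} → Γ ▷ A ⊢ B type →
                Γ ⊢ f ∶ Π A B → Γ ⊢ g ∶ Π A B →
                Γ ▷ A ⊢ p ∶ Id B (app (f [ wks ]) (var zero)) (app (g [ wks ]) (var zero)) →
                Γ ⊢ a ∶ A →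
                Γ ⊢ happly f g (ext f g p) a ≐ p [ a ∷ ids ] ∶
                    Id (B [ a ∷ ids ]ᵀ) (app f a) (app g a)

    Σ-cong    : ∀ {n} {Γ : Ctx n} {A A′ B B′} →
                Γ ⊢ A ≐ A′ type → Γ ▷ A ⊢ B ≐ B′ type → Γ ⊢ Σ′ A B ≐ Σ′ A′ B′ type
    pair-cong : ∀ {n} {Γ : Ctx n} {A B a a′ b b′} → Γ ▷ A ⊢ B type →
                Γ ⊢ a ≐ a′ ∶ A → Γ ⊢ b ≐ b′ ∶ B [ a ∷ ids ]ᵀ →
                Γ ⊢ pair a b ≐ pair a′ b′ ∶ Σ′ A B
    E-cong    : ∀ {n} {Γ : Ctx n} {A B C d d′ c c′} → Γ ▷ A ⊢ B type → Γ ▷ Σ′ A B ⊢ C type →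
                Γ ▷ A ▷ B ⊢ d ≐ d′ ∶ C [ pair (var (suc zero)) (var zero) ∷ wks ⟨ wks ⟩ ]ᵀ →
                Γ ⊢ c ≐ c′ ∶ Σ′ A B → Γ ⊢ E d c ≐ E d′ c′ ∶ C [ c ∷ ids ]ᵀ
    U-cong    : ∀ {n} {Γ : Ctx n} {C d d′ c c′} → Γ ▷ 𝟏 ⊢ C type →
                Γ ⊢ d ≐ d′ ∶ C [ ⋆ ∷ ids ]ᵀ → Γ ⊢ c ≐ c′ ∶ 𝟏 →
                Γ ⊢ U d c ≐ U d′ c′ ∶ C [ c ∷ ids ]ᵀ
    Id-cong   : ∀ {n} {Γ : Ctx n} {A A′ a a′ b b′} → Γ ⊢ A ≐ A′ type →
                Γ ⊢ a ≐ a′ ∶ A → Γ ⊢ b ≐ b′ ∶ A → Γ ⊢ Id A a b ≐ Id A′ a′ b′ type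
    rfl-cong  : ∀ {n} {Γ : Ctx n} {A a a′} → Γ ⊢ a ≐ a′ ∶ A → Γ ⊢ rfl a ≐ rfl a′ ∶ Id A a a
    J-cong    : ∀ {n} {Γ : Ctx n} {A C d d′ a a′ b b′ p p′} → Id-ctx Γ A ⊢ C type →
                Γ ▷ A ⊢ d ≐ d′ ∶ C [ rfl (var zero) ∷ var zero ∷ var zero ∷ wks ]ᵀ →
                Γ ⊢ a ≐ a′ ∶ A → Γ ⊢ b ≐ b′ ∶ A → Γ ⊢ p ≐ p′ ∶ Id A a b →
                Γ ⊢ J d a b p ≐ J d′ a′ b′ p′ ∶ C [ p ∷ b ∷ a ∷ ids ]ᵀ
    Π-cong    : ∀ {n} {Γ : Ctx n} {A A′ B B′} →
                Γ ⊢ A ≐ A′ type → Γ ▷ A ⊢ B ≐ B′ type → Γ ⊢ Π A B ≐ Π A′ B′ type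
    lam-cong  : ∀ {n} {Γ : Ctx n} {A B f f′} → Γ ▷ A ⊢ f ≐ f′ ∶ B → Γ ⊢ lam f ≐ lam f′ ∶ Π A B
    app-cong  : ∀ {n} {Γ : Ctx n} {A B f f′ a a′} → Γ ▷ A ⊢ B type →
                Γ ⊢ f ≐ f′ ∶ Π A B → Γ ⊢ a ≐ a′ ∶ A → Γ ⊢ app f a ≐ app f′ a′ ∶ B [ a ∷ ids ]ᵀ
    ext-cong  : ∀ {n} {Γ : Ctx n} {A B f f′ g g′ p p′} → Γ ▷ A ⊢ B type →
                Γ ⊢ f ≐ f′ ∶ Π A B → Γ ⊢ g ≐ g′ ∶ Π A B →
                Γ ▷ A ⊢ p ≐ p′ ∶ Id B (app (f [ wks ]) (var zero)) (app (g [ wks ]) (var zero)) →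
                Γ ⊢ ext f g p ≐ ext f′ g′ p′ ∶ Id (Π A B) f g

module RawLemmas {r : Level} (E : Expressions r) where
  open Raw E

  ⟨⟩-⟨⟩ : ∀ {k l m n} (σ : Sub m n) (τ : Sub l m) (υ : Sub k l) → σ ⟨ τ ⟩ ⟨ υ ⟩ ≡ σ ⟨ τ ⟨ υ ⟩ ⟩
  ⟨⟩-⟨⟩ []      τ υ = refl
  ⟨⟩-⟨⟩ (t ∷ σ) τ υ = cong₂ _∷_ ([]-[] t τ υ) (⟨⟩-⟨⟩ σ τ υ)

  ⟨ids⟩ : ∀ {m n} (σ : Sub m n) → σ ⟨ ids ⟩ ≡ σ
  ⟨ids⟩ []      = refl
  ⟨ids⟩ (t ∷ σ) = cong₂ _∷_ ([]-id t) (⟨ids⟩ σ)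

  vars-⟨⟩ : ∀ {l m n} (ρ : Fin n → Fin m) (σ : Sub l m) →
            tabulate (λ i → var (ρ i)) ⟨ σ ⟩ ≡ tabulate (λ i → lookup σ (ρ i))
  vars-⟨⟩ {n = zero}  ρ σ = refl
  vars-⟨⟩ {n = suc n} ρ σ = cong₂ _∷_ (var-[] (ρ zero) σ) (vars-⟨⟩ (λ i → ρ (suc i)) σ)

  ids-⟨⟩ : ∀ {m n} (σ : Sub m n) → ids ⟨ σ ⟩ ≡ σ
  ids-⟨⟩ σ = trans (vars-⟨⟩ (λ i → i) σ) (tabulate∘lookup σ)

  wks-⟨∷⟩ : ∀ {m n} (t : Tm m) (σ : Sub m n) → wks ⟨ t ∷ σ ⟩ ≡ σ
  wks-⟨∷⟩ t σ = trans (vars-⟨⟩ suc (t ∷ σ)) (tabulate∘lookup σ)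

  vars-⟨++⟩ : ∀ {m n l} (δ : Sub m l) (σ : Sub m n) → vars l ⟨ δ ++ σ ⟩ ≡ δ
  vars-⟨++⟩ {n = n} {l} δ σ = trans (vars-⟨⟩ (_↑ˡ n) (δ ++ σ))
    (trans (tabulate-cong (λ i → lookup-++ˡ δ σ i)) (tabulate∘lookup δ))

  wksBy-⟨++⟩ : ∀ {m n l} (δ : Sub m l) (σ : Sub m n) → wksBy l ⟨ δ ++ σ ⟩ ≡ σ
  wksBy-⟨++⟩ {l = l} δ σ = trans (vars-⟨⟩ (l ↑ʳ_) (δ ++ σ))
    (trans (tabulate-cong (λ i → lookup-++ʳ δ σ i)) (tabulate∘lookup σ))

  wks-suc : ∀ {m n} (ρ : Fin n → Fin m) →
            tabulate (λ i → var (ρ i)) ⟨ wks ⟩ ≡ tabulate (λ i → var (suc (ρ i)))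
  wks-suc {n = zero}  ρ = refl
  wks-suc {m} {suc n} ρ = cong₂ _∷_ (trans (var-[] (ρ zero) wks) (lookup-wks (ρ zero)))
                                (wks-suc (λ i → ρ (suc i)))
    where
    lookup-wks : ∀ {m} (i : Fin m) → lookup wks i ≡ var (suc i)
    lookup-wks i = lookup∘tabulate _ i

  vars++wksBy : ∀ {n} l → vars {n} l ++ wksBy l ≡ ids
  vars++wksBy zero    = refl
  vars++wksBy {n} (suc l) = cong (var zero ∷_) (trans
    (cong₂ _++_ (sym (wks-suc (_↑ˡ n))) (sym (wks-suc (l ↑ʳ_))))
    (trans (sym (map-++ (_[ wks ]) (vars l) (wksBy l)))
      (trans (cong (_⟨ wks ⟩) (vars++wksBy l)) (wks-suc (λ i → i)))))

  lift-⟨∷⟩ : ∀ {l m n} (σ : Sub m n) (t : Tm l) (τ : Sub l m) → lift σ ⟨ t ∷ τ ⟩ ≡ t ∷ σ ⟨ τ ⟩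
  lift-⟨∷⟩ σ t τ = cong₂ _∷_ (var-[] zero (t ∷ τ))
    (trans (⟨⟩-⟨⟩ σ wks (t ∷ τ)) (cong (σ ⟨_⟩) (wks-⟨∷⟩ t τ)))

  lifts : ∀ {m n} l → Sub m n → Sub (l + m) (l + n)
  lifts zero    σ = σ
  lifts (suc l) σ = lift (lifts l σ)

  lifts-⟨++⟩ : ∀ {l m n k} (σ : Sub m n) (δ : Sub k l) (τ : Sub k m) →
      lifts l σ ⟨ δ ++ τ ⟩ ≡ δ ++ σ ⟨ τ ⟩
  lifts-⟨++⟩ σ []      τ = refl
  lifts-⟨++⟩ {suc l} σ (t ∷ δ) τ = trans (lift-⟨∷⟩ (lifts l σ) t (δ ++ τ))
      (cong (t ∷_) (lifts-⟨++⟩ σ δ τ))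

  lifts≡ : ∀ {m n} l (σ : Sub m n) → lifts l σ ≡ vars l ++ σ ⟨ wksBy l ⟩
  lifts≡ l σ = trans (sym (⟨ids⟩ (lifts l σ))) (trans (cong (lifts l σ ⟨_⟩) (sym (vars++wksBy l)))
    (lifts-⟨++⟩ σ (vars l) (wksBy l)))

  wk : ∀ {m n} → Sub m n → Sub (suc m) n
  wk σ = σ ⟨ wks ⟩

  wk-⟨∷⟩ : ∀ {l m n} (σ : Sub m n) (t : Tm l) (τ : Sub l m) → σ ⟨ wks ⟩ ⟨ t ∷ τ ⟩ ≡ σ ⟨ τ ⟩
  wk-⟨∷⟩ σ t τ = trans (⟨⟩-⟨⟩ σ wks (t ∷ τ)) (cong (σ ⟨_⟩) (wks-⟨∷⟩ t τ))

  wk-lift : ∀ {l m n} (σ : Sub m n) (τ : Sub l m) → σ ⟨ wks ⟩ ⟨ lift τ ⟩ ≡ σ ⟨ τ ⟩ ⟨ wks ⟩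
  wk-lift σ τ = trans (wk-⟨∷⟩ σ _ _) (sym (⟨⟩-⟨⟩ σ τ wks))

  wk-inst : ∀ {m n} (σ : Sub m n) (t : Tm m) → σ ⟨ wks ⟩ ⟨ t ∷ ids ⟩ ≡ σ
  wk-inst σ t = trans (wk-⟨∷⟩ σ t ids) (⟨ids⟩ σ)

  wk-[∷] : ∀ {l m} (s : Tm m) (t : Tm l) (τ : Sub l m) → s [ wks ] [ t ∷ τ ] ≡ s [ τ ]
  wk-[∷] s t τ = trans ([]-[] s wks (t ∷ τ)) (cong (s [_]) (wks-⟨∷⟩ t τ))

  wk-[lift] : ∀ {l m} (s : Tm m) (τ : Sub l m) → s [ wks ] [ lift τ ] ≡ s [ τ ] [ wks ]
  wk-[lift] s τ = trans (wk-[∷] s _ _) (sym ([]-[] s τ wks))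

  wk-[inst] : ∀ {m} (s : Tm m) (t : Tm m) → s [ wks ] [ t ∷ ids ] ≡ s
  wk-[inst] s t = trans (wk-[∷] s t ids) ([]-id s)

  wk-[∷]ᵀ : ∀ {l m} (A : Ty m) (t : Tm l) (τ : Sub l m) → A [ wks ]ᵀ [ t ∷ τ ]ᵀ ≡ A [ τ ]ᵀ
  wk-[∷]ᵀ A t τ = trans ([]-[]ᵀ A wks (t ∷ τ)) (cong (A [_]ᵀ) (wks-⟨∷⟩ t τ))

  wk-[lift]ᵀ : ∀ {l m} (A : Ty m) (τ : Sub l m) → A [ wks ]ᵀ [ lift τ ]ᵀ ≡ A [ τ ]ᵀ [ wks ]ᵀ
  wk-[lift]ᵀ A τ = trans (wk-[∷]ᵀ A _ _) (sym ([]-[]ᵀ A τ wks))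

  wksBy-lifts : ∀ {m n k} l (σ : Sub m n) (τ : Sub k m) →
      σ ⟨ wksBy l ⟩ ⟨ lifts l τ ⟩ ≡ σ ⟨ τ ⟩ ⟨ wksBy l ⟩
  wksBy-lifts l σ τ = trans (⟨⟩-⟨⟩ σ (wksBy l) (lifts l τ))
    (trans (cong (λ υ → σ ⟨ wksBy l ⟨ υ ⟩ ⟩) (lifts≡ l τ))
    (trans (cong (σ ⟨_⟩) (wksBy-⟨++⟩ (vars l) (τ ⟨ wksBy l ⟩))) (sym (⟨⟩-⟨⟩ σ τ (wksBy l)))))

  vars-lifts : ∀ {m n} l (τ : Sub m n) → vars l ⟨ lifts l τ ⟩ ≡ vars l
  vars-lifts l τ = trans (cong (vars l ⟨_⟩) (lifts≡ l τ)) (vars-⟨++⟩ (vars l) _)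

  wksBy-inst : ∀ {m n k} l (σ : Sub m n) (δ : Sub k l) (τ : Sub k m) →
      σ ⟨ wksBy l ⟩ ⟨ δ ++ τ ⟩ ≡ σ ⟨ τ ⟩
  wksBy-inst l σ δ τ = trans (⟨⟩-⟨⟩ σ (wksBy l) (δ ++ τ)) (cong (σ ⟨_⟩) (wksBy-⟨++⟩ δ τ))

  lookup-⟨⟩ : ∀ {l m n} (σ : Sub m n) (τ : Sub l m) i → lookup (σ ⟨ τ ⟩) i ≡ lookup σ i [ τ ]
  lookup-⟨⟩ (t ∷ σ) τ zero    = refl
  lookup-⟨⟩ (t ∷ σ) τ (suc i) = lookup-⟨⟩ σ τ i

module Substitution {r j : Level} (S : TypeTheory r j) where
  open TypeTheory S
  open RawLemmas expressions public

  infixl 5 _∶≡_ _type≡_ _≐≡_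

  _∶≡_ : ∀ {n} {Γ : Ctx n} {t A B} → Γ ⊢ t ∶ A → A ≡ B → Γ ⊢ t ∶ B
  d ∶≡ refl = d

  _type≡_ : ∀ {n} {Γ : Ctx n} {A B} → Γ ⊢ A type → A ≡ B → Γ ⊢ B type
  d type≡ refl = d

  _≐≡_ : ∀ {n} {Γ : Ctx n} {t u A B} → Γ ⊢ t ≐ u ∶ A → A ≡ B → Γ ⊢ t ≐ u ∶ B
  d ≐≡ refl = d

  _▷≐_ : ∀ {n} {Γ : Ctx n} {t u v A} → Γ ⊢ t ≐ u ∶ A → u ≡ v → Γ ⊢ t ≐ v ∶ A
  d ▷≐ refl = d

  _◁≐_ : ∀ {n} {Γ : Ctx n} {t u v A} → t ≡ u → Γ ⊢ u ≐ v ∶ A → Γ ⊢ t ≐ v ∶ A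
  refl ◁≐ d = d

  term-ctx : ∀ {n} {Γ : Ctx n} {A t} → Γ ⊢ t ∶ A → ⊢ Γ
  term-ctx d = type-ctx (term-type d)

  ∶ˢ-ctx : ∀ {m n} {Γ : Ctx m} {Δ : Ctx n} {σ} → Γ ⊢ σ ∶ˢ Δ → ⊢ Γ
  ∶ˢ-ctx ([] d)  = d
  ∶ˢ-ctx (d ∷ _) = ∶ˢ-ctx d

  ∶ˢ-cod : ∀ {m n} {Γ : Ctx m} {Δ : Ctx n} {σ} → Γ ⊢ σ ∶ˢ Δ → ⊢ Δ
  ∶ˢ-cod ([] _)        = []
  ∶ˢ-cod (d ∷ (A , _)) = ∶ˢ-cod d ▷ A

  vars-∶ˢ : ∀ {m n} {Γ : Ctx m} {Δ : Ctx n} (ρ : Fin n → Fin m) → ⊢ Γ → ⊢ Δ →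
            (∀ i → lookupCtx Γ (ρ i) ≡ lookupCtx Δ i [ tabulate (λ i → var (ρ i)) ]ᵀ) →
            Γ ⊢ tabulate (λ i → var (ρ i)) ∶ˢ Δ
  vars-∶ˢ ρ g []      e = [] g
  vars-∶ˢ {Δ = Δ ▷ A} ρ g (d ▷ a) e =
    vars-∶ˢ (λ i → ρ (suc i)) g d (λ i → trans (e (suc i)) (wk-[∷]ᵀ (lookupCtx Δ i) _ _)) ∷
    (a , (var-type g (ρ zero) ∶≡ trans (e zero) (wk-[∷]ᵀ A _ _)))

  ids-∶ˢ : ∀ {n} {Γ : Ctx n} → ⊢ Γ → Γ ⊢ ids ∶ˢ Γ
  ids-∶ˢ {Γ = Γ} g = vars-∶ˢ (λ i → i) g g (λ i → sym ([]-idᵀ (lookupCtx Γ i)))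

  wks-∶ˢ : ∀ {n} {Γ : Ctx n} {A} → Γ ⊢ A type → (Γ ▷ A) ⊢ wks ∶ˢ Γ
  wks-∶ˢ a = vars-∶ˢ suc (type-ctx a ▷ a) (type-ctx a) (λ i → refl)

  ⧺-ctx : ∀ {n l} {Γ : Ctx n} (T : Tel n l) → ⊢ Γ ⧺ T → ⊢ Γ
  ⧺-ctx []      g       = g
  ⧺-ctx (T ▷ A) (g ▷ _) = ⧺-ctx T g

  ⟨⟩-∶ˢ : ∀ {k m n} {Θ : Ctx k} {Γ : Ctx m} {Δ : Ctx n} {σ τ} →
          Γ ⊢ σ ∶ˢ Δ → Θ ⊢ τ ∶ˢ Γ → Θ ⊢ σ ⟨ τ ⟩ ∶ˢ Δ
  ⟨⟩-∶ˢ ([] _) t = [] (∶ˢ-ctx t)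
  ⟨⟩-∶ˢ {τ = τ} (_∷_ {A = A} {σ} s (a , x)) t = ⟨⟩-∶ˢ s t ∷ (a , (subst-term t x ∶≡ []-[]ᵀ A σ τ))

  wk-∶ˢ : ∀ {m n} {Γ : Ctx m} {Δ : Ctx n} {A σ} → Γ ⊢ A type → Γ ⊢ σ ∶ˢ Δ → (Γ ▷ A) ⊢ σ ⟨ wks ⟩ ∶ˢ Δ
  wk-∶ˢ a s = ⟨⟩-∶ˢ s (wks-∶ˢ a)

  wksBy-∶ˢ : ∀ {n l} {Γ : Ctx n} (T : Tel n l) → ⊢ Γ ⧺ T → (Γ ⧺ T) ⊢ wksBy l ∶ˢ Γ
  wksBy-∶ˢ []      g       = ids-∶ˢ g
  wksBy-∶ˢ {l = suc l} {Γ} (T ▷ A) (g ▷ a) =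
    subst (λ σ → ((Γ ⧺ T) ▷ A) ⊢ σ ∶ˢ Γ) (wks-suc (l ↑ʳ_)) (wk-∶ˢ a (wksBy-∶ˢ T g))

  subst-type′ : ∀ {k m n} {Θ : Ctx k} {Δ : Ctx n} {σ : Sub m n} {τ : Sub k m} {A} →
                Θ ⊢ σ ⟨ τ ⟩ ∶ˢ Δ → Δ ⊢ A type → Θ ⊢ A [ σ ]ᵀ [ τ ]ᵀ type
  subst-type′ {σ = σ} {τ} {A} s a = subst-type s a type≡ sym ([]-[]ᵀ A σ τ)

  var₀ : ∀ {m n} {Γ : Ctx m} {Δ : Ctx n} {A σ} → Δ ⊢ A type → Γ ⊢ σ ∶ˢ Δ →
         (Γ ▷ A [ σ ]ᵀ) ⊢ var zero ∶ A [ σ ⟨ wks ⟩ ]ᵀ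
  var₀ {A = A} {σ} a s = var-type (∶ˢ-ctx s ▷ subst-type s a) zero ∶≡ []-[]ᵀ A σ wks

  var-zero : ∀ {n} {Γ : Ctx n} {A} → Γ ⊢ A type → (Γ ▷ A) ⊢ var zero ∶ A [ wks ]ᵀ
  var-zero a = var-type (type-ctx a ▷ a) zero

  wk-∶ : ∀ {n} {Γ : Ctx n} {A B t} → Γ ⊢ A type → Γ ⊢ t ∶ B → (Γ ▷ A) ⊢ t [ wks ] ∶ B [ wks ]ᵀ
  wk-∶ a t = subst-term (wks-∶ˢ a) t

  wk-∶′ : ∀ {m n} {Γ : Ctx m} {A t} {B : Ty n} {σ} → Γ ⊢ A type → Γ ⊢ t ∶ B [ σ ]ᵀ →
          (Γ ▷ A) ⊢ t [ wks ] ∶ B [ σ ⟨ wks ⟩ ]ᵀ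
  wk-∶′ {B = B} {σ} a t = wk-∶ a t ∶≡ []-[]ᵀ B σ wks

  ≐ˢ-left : ∀ {m n} {Γ : Ctx m} {Δ : Ctx n} {σ τ} → Γ ⊢ σ ≐ τ ∶ˢ Δ → Γ ⊢ σ ∶ˢ Δ
  ≐ˢ-left ([] g)        = [] g
  ≐ˢ-left (e ∷ (a , x)) = ≐ˢ-left e ∷ (a , proj₁ (≐term-term x))

  ≐ˢ-right : ∀ {m n} {Γ : Ctx m} {Δ : Ctx n} {σ τ} → Γ ⊢ σ ≐ τ ∶ˢ Δ → Γ ⊢ τ ∶ˢ Δ
  ≐ˢ-right ([] g)        = [] g
  ≐ˢ-right (e ∷ (a , x)) = ≐ˢ-right e ∷ (a , conv (type-subst-≐ e a) (proj₂ (≐term-term x)))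

  ≐ˢ-refl : ∀ {m n} {Γ : Ctx m} {Δ : Ctx n} {σ} → Γ ⊢ σ ∶ˢ Δ → Γ ⊢ σ ≐ σ ∶ˢ Δ
  ≐ˢ-refl ([] g)        = [] g
  ≐ˢ-refl (e ∷ (a , x)) = ≐ˢ-refl e ∷ (a , ≐-refl x)

  ≐ˢ-sym : ∀ {m n} {Γ : Ctx m} {Δ : Ctx n} {σ τ} → Γ ⊢ σ ≐ τ ∶ˢ Δ → Γ ⊢ τ ≐ σ ∶ˢ Δ
  ≐ˢ-sym ([] g)        = [] g
  ≐ˢ-sym (e ∷ (a , x)) = ≐ˢ-sym e ∷ (a , ≐-conv (type-subst-≐ e a) (≐-sym x))

  ≐ˢ-trans : ∀ {m n} {Γ : Ctx m} {Δ : Ctx n} {σ τ υ} →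
             Γ ⊢ σ ≐ τ ∶ˢ Δ → Γ ⊢ τ ≐ υ ∶ˢ Δ → Γ ⊢ σ ≐ υ ∶ˢ Δ
  ≐ˢ-trans ([] g)        ([] _)        = [] g
  ≐ˢ-trans (e ∷ (a , x)) (f ∷ (_ , y)) =
    ≐ˢ-trans e f ∷ (a , ≐-trans x (≐-conv (≐type-sym (type-subst-≐ e a)) y))

  ⟨⟩-≐ˢ : ∀ {k m n} {Θ : Ctx k} {Γ : Ctx m} {Δ : Ctx n} {σ τ τ′} →
          Γ ⊢ σ ∶ˢ Δ → Θ ⊢ τ ≐ τ′ ∶ˢ Γ → Θ ⊢ σ ⟨ τ ⟩ ≐ σ ⟨ τ′ ⟩ ∶ˢ Δ
  ⟨⟩-≐ˢ ([] _) t = [] (∶ˢ-ctx (≐ˢ-left t))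
  ⟨⟩-≐ˢ {τ = τ} (_∷_ {A = A} {σ} s (a , x)) t = ⟨⟩-≐ˢ s t ∷ (a , (term-subst-≐ t x ≐≡ []-[]ᵀ A σ τ))

  ≐ˢ-⟨⟩ : ∀ {k m n} {Θ : Ctx k} {Γ : Ctx m} {Δ : Ctx n} {σ σ′ τ} →
          Γ ⊢ σ ≐ σ′ ∶ˢ Δ → Θ ⊢ τ ∶ˢ Γ → Θ ⊢ σ ⟨ τ ⟩ ≐ σ′ ⟨ τ ⟩ ∶ˢ Δ
  ≐ˢ-⟨⟩ ([] _) t = [] (∶ˢ-ctx t)
  ≐ˢ-⟨⟩ {τ = τ} (_∷_ {A = A} {σ} s (a , x)) t = ≐ˢ-⟨⟩ s t ∷ (a , (subst-≐ t x ≐≡ []-[]ᵀ A σ τ))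

  ⟨⟩-cong : ∀ {k m n} {Θ : Ctx k} {Γ : Ctx m} {Δ : Ctx n} {σ σ′ τ τ′} →
            Γ ⊢ σ ≐ σ′ ∶ˢ Δ → Θ ⊢ τ ≐ τ′ ∶ˢ Γ → Θ ⊢ σ ⟨ τ ⟩ ≐ σ′ ⟨ τ′ ⟩ ∶ˢ Δ
  ⟨⟩-cong s t = ≐ˢ-trans (≐ˢ-⟨⟩ s (≐ˢ-left t)) (⟨⟩-≐ˢ (≐ˢ-right s) t)

module Identity {r j : Level} {S : TypeTheory r j} (M : ML₂ S) where
  open TypeTheory S
  open ML₂ M
  open Substitution S

  cong₃ : ∀ {a b c d} {A : Set a} {B : Set b} {C : Set c} {D : Set d}
          (f : A → B → C → D) {x x′ y y′ z z′} →
          x ≡ x′ → y ≡ y′ → z ≡ z′ → f x y z ≡ f x′ y′ z′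
  cong₃ f refl refl refl = refl

  cong₄ : ∀ {a b c d e} {A : Set a} {B : Set b} {C : Set c} {D : Set d} {E : Set e}
          (f : A → B → C → D → E) {x x′ y y′ z z′ w w′} →
          x ≡ x′ → y ≡ y′ → z ≡ z′ → w ≡ w′ → f x y z w ≡ f x′ y′ z′ w′
  cong₄ f refl refl refl refl = refl

  cong₅ : ∀ {a b c d e g} {A : Set a} {B : Set b} {C : Set c} {D : Set d} {E : Set e} {G : Set g}
          (f : A → B → C → D → E → G) {x x′ y y′ z z′ w w′ v v′} →
          x ≡ x′ → y ≡ y′ → z ≡ z′ → w ≡ w′ → v ≡ v′ → f x y z w v ≡ f x′ y′ z′ w′ v′
  cong₅ f refl refl refl refl refl = refl

  -- step d x = λ y y′ q . J_{[y] d(x,y)}(y , y′ , q).  It is the first half of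
  -- the elimination for Id_Φ when Φ = (x : Λ , y : D(x)); the second half, in
  -- Jᶜ, is elimination for Id_Λ with the post-context (y , y′ , q) abstracted.
  step₂ : ∀ {k m} → Tm (suc k) → Sub m k → Tm m → Tm m → Tm m
  step₂ d x y y′ = lam (J (d [ var zero ∷ x ⟨ wks ⟩ ⟨ wks ⟩ ]) (y [ wks ]) (y′ [ wks ]) (var zero))

  step₁ : ∀ {k m} → Tm (suc k) → Sub m k → Tm m → Tm m
  step₁ d x y = lam (step₂ d (x ⟨ wks ⟩) (y [ wks ]) (var zero))

  step : ∀ {k m} → Tm (suc k) → Sub m k → Tm m
  step d x = lam (step₁ d (x ⟨ wks ⟩) (var zero))

  Jᶜ : ∀ k {m} → Tm k → Sub m k → Sub m k → Sub m k → Tm m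
  Jᶜ zero    d []      []       []      = d [ [] ]
  Jᶜ (suc k) d (y ∷ x) (y′ ∷ x′) (q ∷ p) =
    app (app (app (Jᶜ k (step d ids) x x′ p) y) y′) q

  -- p*(z) = J_{λ z . z}(a , b , p) · z, an element of D(a) for z : D(b)
  tr : ∀ {k m} → Sub m k → Sub m k → Sub m k → Tm m → Tm m
  tr {k} a b p z = app (Jᶜ k (lam (var zero)) a b p) z

  -- Id_Φ(a , b) as a context relative to the ambient one; its last entry is
  -- Id_{D(x)}(y , p*(y′)) with p the variables before it.
  IdTel : ∀ {k} → Ctx k → ∀ {m} → Sub m k → Sub m k → Tel m k
  IdTel []              []      []       = []
  IdTel {suc k} (Φ ▷ D) (y ∷ x) (y′ ∷ x′) =
    IdTel Φ x x′ ▷ Id (D [ x ⟨ wksBy k ⟩ ]ᵀ) (y [ wksBy k ])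
                      (tr (x ⟨ wksBy k ⟩) (x′ ⟨ wksBy k ⟩) (vars k) (y′ [ wksBy k ]))

  rfls : ∀ {k m} → Sub m k → Sub m k
  rfls = map rfl

  step₂-[] : ∀ {k m l} (d : Tm (suc k)) (x : Sub m k) y y′ (σ : Sub l m) →
      step₂ d x y y′ [ σ ] ≡ step₂ d (x ⟨ σ ⟩) (y [ σ ]) (y′ [ σ ])
  step₂-[] d x y y′ σ = trans (lam-[] _ σ) (cong lam (trans (J-[] _ _ _ _ (lift σ))
    (cong₄ J (trans ([]-[] d _ _) (cong (λ z → d [ z ]) (cong₂ _∷_ (var-[] _ _)
        (trans (wk-lift (x ⟨ wks ⟩) (lift σ)) (cong (_⟨ wks ⟩) (wk-lift x σ))))))
      (wk-[lift] y σ) (wk-[lift] y′ σ) (var-[] _ _))))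

  step₁-[] : ∀ {k m l} (d : Tm (suc k)) (x : Sub m k) y (σ : Sub l m) →
      step₁ d x y [ σ ] ≡ step₁ d (x ⟨ σ ⟩) (y [ σ ])
  step₁-[] d x y σ = trans (lam-[] _ σ) (cong lam (trans (step₂-[] d _ _ _ (lift σ))
    (cong₃ (step₂ d) (wk-lift x σ) (wk-[lift] y σ) (var-[] _ _))))

  step-[] : ∀ {k m l} (d : Tm (suc k)) (x : Sub m k) (σ : Sub l m) →
      step d x [ σ ] ≡ step d (x ⟨ σ ⟩)
  step-[] d x σ = trans (lam-[] _ σ) (cong lam (trans (step₁-[] d _ _ (lift σ))
    (cong₂ (step₁ d) (wk-lift x σ) (var-[] _ _))))

  step-ids : ∀ {k m} (d : Tm (suc k)) (x : Sub m k) → step d ids [ x ] ≡ step d x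
  step-ids d x = trans (step-[] d ids x) (cong (step d) (ids-⟨⟩ x))

  Jᶜ-[] : ∀ k {m l} (d : Tm k) (a b p : Sub m k) (σ : Sub l m) →
      Jᶜ k d a b p [ σ ] ≡ Jᶜ k d (a ⟨ σ ⟩) (b ⟨ σ ⟩) (p ⟨ σ ⟩)
  Jᶜ-[] zero    d [] [] [] σ = []-[] d [] σ
  Jᶜ-[] (suc k) d (y ∷ x) (y′ ∷ x′) (q ∷ p) σ = trans (app-[] _ _ σ)
     (cong₂ app (trans (app-[] _ _ σ) (cong₂ app (trans (app-[] _ _ σ)
     (cong₂ app (Jᶜ-[] k (step d ids) x x′ p σ) refl)) refl)) refl)

  tr-[] : ∀ {k m l} (a b p : Sub m k) z (σ : Sub l m) →
      tr a b p z [ σ ] ≡ tr (a ⟨ σ ⟩) (b ⟨ σ ⟩) (p ⟨ σ ⟩) (z [ σ ])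
  tr-[] {k} a b p z σ = trans (app-[] _ _ σ) (cong₂ app (Jᶜ-[] k _ a b p σ) refl)

  rfls-⟨⟩ : ∀ {k m l} (a : Sub m k) (σ : Sub l m) → rfls a ⟨ σ ⟩ ≡ rfls (a ⟨ σ ⟩)
  rfls-⟨⟩ []      σ = refl
  rfls-⟨⟩ (t ∷ a) σ = cong₂ _∷_ (rfl-[] t σ) (rfls-⟨⟩ a σ)

  IdTel-last : ∀ {k m l} (D : Ty k) (x x′ : Sub m k) y y′ (p : Sub l k) (σ : Sub l m) →
    Id (D [ x ⟨ wksBy k ⟩ ]ᵀ) (y [ wksBy k ])
        (tr (x ⟨ wksBy k ⟩) (x′ ⟨ wksBy k ⟩) (vars k) (y′ [ wksBy k ])) [ p ++ σ ]ᵀ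
    ≡ Id (D [ x ⟨ σ ⟩ ]ᵀ) (y [ σ ]) (tr (x ⟨ σ ⟩) (x′ ⟨ σ ⟩) p (y′ [ σ ]))
  IdTel-last {k} D x x′ y y′ p σ = trans (Id-[] _ _ _ _) (cong₃ Id
    (trans ([]-[]ᵀ D _ _) (cong (D [_]ᵀ) (wksBy-inst k x p σ)))
    (inst y)
    (trans (tr-[] (x ⟨ wksBy k ⟩) (x′ ⟨ wksBy k ⟩) (vars k) (y′ [ wksBy k ]) (p ++ σ))
        (cong₄ tr (wksBy-inst k x p σ) (wksBy-inst k x′ p σ) (vars-⟨++⟩ p σ) (inst y′))))
    where
    inst : ∀ y → y [ wksBy k ] [ p ++ σ ] ≡ y [ σ ]
    inst y = trans ([]-[] y _ _) (cong (y [_]) (wksBy-⟨++⟩ p σ))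

  -- Γ ⊢ p ∶ᵗ IdTel Φ a b by recursion on Φ, with the substitutions carried out
  -- (toId and fromId below).

  infix 4 _⊢_∶Id_⦅_,_⦆ _⊢_≐_∶Id_⦅_,_⦆

  data _⊢_∶Id_⦅_,_⦆ {m} (Γ : Ctx m) : ∀ {k} → Sub m k → Ctx k → Sub m k → Sub m k → Set (r ⊔ j) where
    []  : ⊢ Γ → Γ ⊢ [] ∶Id [] ⦅ [] , [] ⦆
    _∷_ : ∀ {k} {Φ : Ctx k} {D : Ty k} {p x x′ q y y′} → Γ ⊢ p ∶Id Φ ⦅ x , x′ ⦆ →
          Γ ⊢ q ∶ Id (D [ x ]ᵀ) y (tr x x′ p y′) → Γ ⊢ q ∷ p ∶Id Φ ▷ D ⦅ y ∷ x , y′ ∷ x′ ⦆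

  data _⊢_≐_∶Id_⦅_,_⦆ {m} (Γ : Ctx m) : ∀ {k} → Sub m k → Sub m k → Ctx k → Sub m k → Sub m k → Set (r ⊔ j) where
    []  : ⊢ Γ → Γ ⊢ [] ≐ [] ∶Id [] ⦅ [] , [] ⦆
    _∷_ : ∀ {k} {Φ : Ctx k} {D : Ty k} {p p′ x x′ q q′ y y′} → Γ ⊢ p ≐ p′ ∶Id Φ ⦅ x , x′ ⦆ →
          Γ ⊢ q ≐ q′ ∶ Id (D [ x ]ᵀ) y (tr x x′ p y′) →
              Γ ⊢ q ∷ p ≐ q′ ∷ p′ ∶Id Φ ▷ D ⦅ y ∷ x , y′ ∷ x′ ⦆

  private
    last-ids : ∀ {k m} (D : Ty k) (x x′ : Sub m k) y y′ (p : Sub m k) →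
      Id (D [ x ⟨ wksBy k ⟩ ]ᵀ) (y [ wksBy k ])
          (tr (x ⟨ wksBy k ⟩) (x′ ⟨ wksBy k ⟩) (vars k) (y′ [ wksBy k ])) [ p ++ ids ]ᵀ
      ≡ Id (D [ x ]ᵀ) y (tr x x′ p y′)
    last-ids D x x′ y y′ p = trans (IdTel-last D x x′ y y′ p ids)
      (cong₃ Id (cong (D [_]ᵀ) (⟨ids⟩ x)) ([]-id y) (cong₄ tr (⟨ids⟩ x) (⟨ids⟩ x′) refl ([]-id y′)))

  toId : ∀ {m k} {Γ : Ctx m} {Φ : Ctx k} {p x x′} → Γ ⊢ p ∶ᵗ IdTel Φ x x′ → Γ ⊢ p ∶Id Φ ⦅ x , x′ ⦆
  toId {Φ = []}    {x = []}    {[]}      ([] g)  = [] g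
  toId {Φ = Φ ▷ D} {x = y ∷ x} {y′ ∷ x′} (p ∷ q) = toId p ∷ (q ∶≡ last-ids D x x′ y y′ _)

  fromId : ∀ {m k} {Γ : Ctx m} {Φ : Ctx k} {p x x′} → Γ ⊢ p ∶Id Φ ⦅ x , x′ ⦆ → Γ ⊢ p ∶ᵗ IdTel Φ x x′
  fromId ([] g) = [] g
  fromId {Φ = Φ ▷ D} (_∷_ {x = x} {x′} {y = y} {y′} p q) = fromId p ∷
      (q ∶≡ sym (last-ids D x x′ y y′ _))

  toId≐ : ∀ {m k} {Γ : Ctx m} {Φ : Ctx k} {p q x x′} → Γ ⊢ p ≐ q ∶ᵗ IdTel Φ x x′ →
      Γ ⊢ p ≐ q ∶Id Φ ⦅ x , x′ ⦆
  toId≐ {Φ = []}    {x = []}    {[]}      ([] g)  = [] g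
  toId≐ {Φ = Φ ▷ D} {x = y ∷ x} {y′ ∷ x′} (p ∷ q) = toId≐ p ∷ (q ≐≡ last-ids D x x′ y y′ _)

  fromId≐ : ∀ {m k} {Γ : Ctx m} {Φ : Ctx k} {p q x x′} → Γ ⊢ p ≐ q ∶Id Φ ⦅ x , x′ ⦆ →
      Γ ⊢ p ≐ q ∶ᵗ IdTel Φ x x′
  fromId≐ ([] g) = [] g
  fromId≐ {Φ = Φ ▷ D} (_∷_ {x = x} {x′} {y = y} {y′} p q) = fromId≐ p ∷
      (q ≐≡ sym (last-ids D x x′ y y′ _))

  Id-ctxt : ∀ {m k} {Γ : Ctx m} {Φ : Ctx k} {p x x′} → Γ ⊢ p ∶Id Φ ⦅ x , x′ ⦆ → ⊢ Γ
  Id-ctxt ([] g)  = g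
  Id-ctxt (p ∷ _) = Id-ctxt p

  Id-subst : ∀ {m l k} {Γ : Ctx m} {Δ : Ctx l} {Φ : Ctx k} {p x x′ σ} → Γ ⊢ p ∶Id Φ ⦅ x , x′ ⦆ →
             Δ ⊢ σ ∶ˢ Γ →
             Δ ⊢ p ⟨ σ ⟩ ∶Id Φ ⦅ x ⟨ σ ⟩ , x′ ⟨ σ ⟩ ⦆
  Id-subst ([] g)  s = [] (∶ˢ-ctx s)
  Id-subst {Φ = Φ ▷ D} {σ = σ} (_∷_ {p = p} {x} {x′} {y′ = y′} P q) s = Id-subst P s ∷
    (subst-term s q ∶≡ trans (Id-[] _ _ _ _) (cong₃ Id ([]-[]ᵀ D x σ) refl (tr-[] x x′ p y′ σ)))

  Id-subst≐ : ∀ {m l k} {Γ : Ctx m} {Δ : Ctx l} {Φ : Ctx k} {p q x x′ σ} →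
             Γ ⊢ p ≐ q ∶Id Φ ⦅ x , x′ ⦆ → Δ ⊢ σ ∶ˢ Γ →
             Δ ⊢ p ⟨ σ ⟩ ≐ q ⟨ σ ⟩ ∶Id Φ ⦅ x ⟨ σ ⟩ , x′ ⟨ σ ⟩ ⦆
  Id-subst≐ ([] g)  s = [] (∶ˢ-ctx s)
  Id-subst≐ {Φ = Φ ▷ D} {σ = σ} (_∷_ {p = p} {x = x} {x′} {y′ = y′} P q) s = Id-subst≐ P s ∷
    (subst-≐ s q ≐≡ trans (Id-[] _ _ _ _) (cong₃ Id ([]-[]ᵀ D x σ) refl (tr-[] x x′ p y′ σ)))

  -- Motives are given by their values on arbitrary elements, naturally in the
  -- ambient context.
  record Motive {k} (Φ : Ctx k) : Set (r ⊔ j) where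
    field
      fam : ∀ {m} → Sub m k → Sub m k → Sub m k → Ty m
      nat : ∀ {m l} (a b p : Sub m k) (σ : Sub l m) →
          fam a b p [ σ ]ᵀ ≡ fam (a ⟨ σ ⟩) (b ⟨ σ ⟩) (p ⟨ σ ⟩)
      typ : ∀ {m} {Γ : Ctx m} {a b p} → Γ ⊢ a ∶ˢ Φ → Γ ⊢ b ∶ˢ Φ → Γ ⊢ p ∶Id Φ ⦅ a , b ⦆ →
          Γ ⊢ fam a b p type
  open Motive

  Premise : ∀ {k} {Φ : Ctx k} → Motive Φ → Tm k → Set (r ⊔ j)
  Premise {k} {Φ} C d = ∀ {m} {Γ : Ctx m} {x} → Γ ⊢ x ∶ˢ Φ → Γ ⊢ d [ x ] ∶ fam C x x (rfls x)

  record Elim {k} (Φ : Ctx k) : Set (r ⊔ j) where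
    field
      rfls-type : ∀ {m} {Γ : Ctx m} {x} → Γ ⊢ x ∶ˢ Φ → Γ ⊢ rfls x ∶Id Φ ⦅ x , x ⦆
      J-type : (C : Motive Φ) (d : Tm k) → Premise C d → ∀ {m} {Γ : Ctx m} {a b p} →
               Γ ⊢ a ∶ˢ Φ → Γ ⊢ b ∶ˢ Φ → Γ ⊢ p ∶Id Φ ⦅ a , b ⦆ → Γ ⊢ Jᶜ k d a b p ∶ fam C a b p
      J-β    : (C : Motive Φ) (d : Tm k) → Premise C d → ∀ {m} {Γ : Ctx m} {x} →
               Γ ⊢ x ∶ˢ Φ → Γ ⊢ Jᶜ k d x x (rfls x) ≐ d [ x ] ∶ fam C x x (rfls x)
  open Elim

  module Transport {k} {Φ : Ctx k} (e : Elim Φ) {D : Ty k} (D-type : Φ ⊢ D type) where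

    trM : Motive Φ
    trM = record
      { fam = λ a b p → Π (D [ b ]ᵀ) (D [ a ⟨ wks ⟩ ]ᵀ)
      ; nat = λ a b p σ → trans (Π-[] _ _ σ)
          (cong₂ Π ([]-[]ᵀ D b σ) (trans ([]-[]ᵀ D _ _) (cong (D [_]ᵀ) (wk-lift a σ))))
      ; typ = λ A B P → Π-form (subst-type B D-type)
          (subst-type (wk-∶ˢ (subst-type B D-type) A) D-type)
      }

    private
      lam0 : ∀ {m l} (σ : Sub l m) → lam (var zero) [ σ ] ≡ lam (var zero)
      lam0 σ = trans (lam-[] _ σ) (cong lam (var-[] _ _))

      inst : ∀ {m} (x : Sub m k) z → D [ x ⟨ wks ⟩ ]ᵀ [ z ∷ ids ]ᵀ ≡ D [ x ]ᵀ
      inst x z = trans ([]-[]ᵀ D _ _) (cong (D [_]ᵀ) (wk-inst x z))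

      prem : Premise trM (lam (var zero))
      prem {x = x} X = subst (λ t → _ ⊢ t ∶ _) (sym (lam0 x)) (Π-intro (var₀ D-type X))

    tr-type : ∀ {m} {Γ : Ctx m} {a b p z} → Γ ⊢ a ∶ˢ Φ → Γ ⊢ b ∶ˢ Φ → Γ ⊢ p ∶Id Φ ⦅ a , b ⦆ →
              Γ ⊢ z ∶ D [ b ]ᵀ →
              Γ ⊢ tr a b p z ∶ D [ a ]ᵀ
    tr-type {a = a} {z = z} A B P Z = Π-elim (subst-type (wk-∶ˢ (subst-type B D-type) A) D-type)
      (J-type e trM _ prem A B P) Z ∶≡ inst a z

    tr-β : ∀ {m} {Γ : Ctx m} {x z} → Γ ⊢ x ∶ˢ Φ → Γ ⊢ z ∶ D [ x ]ᵀ →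
        Γ ⊢ tr x x (rfls x) z ≐ z ∶ D [ x ]ᵀ
    tr-β {x = x} {z} X Z =
      (≐-trans (app-cong T (J-β e trM _ prem X ▷≐ lam0 x) (≐-refl Z))
        (Π-β (var₀ D-type X) Z ▷≐ var-[] _ _)) ≐≡ inst x z
      where T = subst-type (wk-∶ˢ (subst-type X D-type) X) D-type

    Id-tr : ∀ {m} {Γ : Ctx m} {x y y′} → Γ ⊢ x ∶ˢ Φ → Γ ⊢ y ∶ D [ x ]ᵀ → Γ ⊢ y′ ∶ D [ x ]ᵀ →
            Γ ⊢ Id (D [ x ]ᵀ) y (tr x x (rfls x) y′) ≐ Id (D [ x ]ᵀ) y y′ type
    Id-tr X Y Y′ = Id-cong (≐type-refl (subst-type X D-type)) (≐-refl Y) (tr-β X Y′)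

  module Step {k} {Φ : Ctx k} (e : Elim Φ) {D : Ty k} (D-type : Φ ⊢ D type) where
    open Transport e D-type

    rfls-type′ : ∀ {m} {Γ : Ctx m} {x} → Γ ⊢ x ∶ˢ Φ ▷ D → Γ ⊢ rfls x ∶Id Φ ▷ D ⦅ x , x ⦆
    rfls-type′ (X ∷ (_ , y)) = rfls-type e X ∷ conv (≐type-sym (Id-tr X y y)) (Id-intro y)

    module _ (C : Motive (Φ ▷ D)) (d : Tm (suc k)) (prem : Premise C d) where

      C₂ : ∀ {m} → Sub m k → Sub m k → Sub m k → Tm m → Tm m → Ty m
      C₂ x x′ p y y′ = Π (Id (D [ x ]ᵀ) y (tr x x′ p y′))
        (fam C (y [ wks ] ∷ x ⟨ wks ⟩) (y′ [ wks ] ∷ x′ ⟨ wks ⟩) (var zero ∷ p ⟨ wks ⟩))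

      C₁ : ∀ {m} → Sub m k → Sub m k → Sub m k → Tm m → Ty m
      C₁ x x′ p y = Π (D [ x′ ]ᵀ) (C₂ (x ⟨ wks ⟩) (x′ ⟨ wks ⟩) (p ⟨ wks ⟩) (y [ wks ]) (var zero))

      C₀ : ∀ {m} → Sub m k → Sub m k → Sub m k → Ty m
      C₀ x x′ p = Π (D [ x ]ᵀ) (C₁ (x ⟨ wks ⟩) (x′ ⟨ wks ⟩) (p ⟨ wks ⟩) (var zero))

      C₂-[] : ∀ {m l} x x′ p y y′ (σ : Sub l m) →
          C₂ x x′ p y y′ [ σ ]ᵀ ≡ C₂ (x ⟨ σ ⟩) (x′ ⟨ σ ⟩) (p ⟨ σ ⟩) (y [ σ ]) (y′ [ σ ])
      C₂-[] x x′ p y y′ σ = trans (Π-[] _ _ σ) (cong₂ Π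
        (trans (Id-[] _ _ _ σ) (cong₃ Id ([]-[]ᵀ D x σ) refl (tr-[] x x′ p y′ σ)))
        (trans (nat C _ _ _ _) (cong₃ (fam C) (cong₂ _∷_ (wk-[lift] y σ) (wk-lift x σ))
          (cong₂ _∷_ (wk-[lift] y′ σ) (wk-lift x′ σ)) (cong₂ _∷_ (var-[] _ _) (wk-lift p σ)))))

      C₁-[] : ∀ {m l} x x′ p y (σ : Sub l m) →
          C₁ x x′ p y [ σ ]ᵀ ≡ C₁ (x ⟨ σ ⟩) (x′ ⟨ σ ⟩) (p ⟨ σ ⟩) (y [ σ ])
      C₁-[] x x′ p y σ = trans (Π-[] _ _ σ) (cong₂ Π ([]-[]ᵀ D x′ σ)
        (trans (C₂-[] _ _ _ _ _ _)
            (cong₅ C₂ (wk-lift x σ) (wk-lift x′ σ) (wk-lift p σ) (wk-[lift] y σ) (var-[] _ _))))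

      C₀-[] : ∀ {m l} x x′ p (σ : Sub l m) → C₀ x x′ p [ σ ]ᵀ ≡ C₀ (x ⟨ σ ⟩) (x′ ⟨ σ ⟩) (p ⟨ σ ⟩)
      C₀-[] x x′ p σ = trans (Π-[] _ _ σ) (cong₂ Π ([]-[]ᵀ D x σ)
        (trans (C₁-[] _ _ _ _ _) (cong₄ C₁ (wk-lift x σ) (wk-lift x′ σ) (wk-lift p σ)
            (var-[] _ _))))

      C₃-inst : ∀ {m} (x x′ p : Sub m k) y y′ q →
        fam C (y [ wks ] ∷ x ⟨ wks ⟩) (y′ [ wks ] ∷ x′ ⟨ wks ⟩)
            (var zero ∷ p ⟨ wks ⟩) [ q ∷ ids ]ᵀ ≡ fam C (y ∷ x) (y′ ∷ x′) (q ∷ p)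
      C₃-inst x x′ p y y′ q = trans (nat C _ _ _ _)
        (cong₃ (fam C) (cong₂ _∷_ (wk-[inst] y q) (wk-inst x q))
        (cong₂ _∷_ (wk-[inst] y′ q) (wk-inst x′ q)) (cong₂ _∷_ (var-[] _ _) (wk-inst p q)))

      C₂-inst : ∀ {m} (x x′ p : Sub m k) y y′ →
        C₂ (x ⟨ wks ⟩) (x′ ⟨ wks ⟩) (p ⟨ wks ⟩) (y [ wks ])
            (var zero) [ y′ ∷ ids ]ᵀ ≡ C₂ x x′ p y y′
      C₂-inst x x′ p y y′ = trans (C₂-[] _ _ _ _ _ _)
        (cong₅ C₂ (wk-inst x y′) (wk-inst x′ y′) (wk-inst p y′) (wk-[inst] y y′) (var-[] _ _))

      C₁-inst : ∀ {m} (x x′ p : Sub m k) y →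
        C₁ (x ⟨ wks ⟩) (x′ ⟨ wks ⟩) (p ⟨ wks ⟩) (var zero) [ y ∷ ids ]ᵀ ≡ C₁ x x′ p y
      C₁-inst x x′ p y = trans (C₁-[] _ _ _ _ _)
        (cong₄ C₁ (wk-inst x y) (wk-inst x′ y) (wk-inst p y) (var-[] _ _))

      module _ {m} {Γ : Ctx m} {x x′ p} (X : Γ ⊢ x ∶ˢ Φ) (X′ : Γ ⊢ x′ ∶ˢ Φ)
          (P : Γ ⊢ p ∶Id Φ ⦅ x , x′ ⦆) where

        module _ {y y′} (Y : Γ ⊢ y ∶ D [ x ]ᵀ) (Y′ : Γ ⊢ y′ ∶ D [ x′ ]ᵀ) where
          I-type : Γ ⊢ Id (D [ x ]ᵀ) y (tr x x′ p y′) type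
          I-type = Id-form Y (tr-type X X′ P Y′)

          C₃-type : (Γ ▷ Id (D [ x ]ᵀ) y (tr x x′ p y′)) ⊢
            fam C (y [ wks ] ∷ x ⟨ wks ⟩) (y′ [ wks ] ∷ x′ ⟨ wks ⟩) (var zero ∷ p ⟨ wks ⟩) type
          C₃-type = typ C (wk-∶ˢ I-type X ∷ (D-type , wk-∶′ I-type Y))
            (wk-∶ˢ I-type X′ ∷ (D-type , wk-∶′ I-type Y′))
            (Id-subst P (wks-∶ˢ I-type) ∷
                (var-zero I-type ∶≡ trans (Id-[] _ _ _ _)
                (cong₃ Id ([]-[]ᵀ D x wks) refl (tr-[] x x′ p y′ wks))))

          C₂-type : Γ ⊢ C₂ x x′ p y y′ type
          C₂-type = Π-form I-type C₃-type

      module _ {m} {Γ : Ctx m} {x x′ p} (X : Γ ⊢ x ∶ˢ Φ) (X′ : Γ ⊢ x′ ∶ˢ Φ)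
          (P : Γ ⊢ p ∶Id Φ ⦅ x , x′ ⦆) where

        C₂-type′ : ∀ {y} (Y : Γ ⊢ y ∶ D [ x ]ᵀ) →
          (Γ ▷ D [ x′ ]ᵀ) ⊢ C₂ (x ⟨ wks ⟩) (x′ ⟨ wks ⟩) (p ⟨ wks ⟩) (y [ wks ]) (var zero) type
        C₂-type′ Y = C₂-type (wk-∶ˢ D′ X) (wk-∶ˢ D′ X′) (Id-subst P (wks-∶ˢ D′)) (wk-∶′ D′ Y)
            (var₀ D-type X′)
          where D′ = subst-type X′ D-type

        C₁-type : ∀ {y} (Y : Γ ⊢ y ∶ D [ x ]ᵀ) → Γ ⊢ C₁ x x′ p y type
        C₁-type Y = Π-form (subst-type X′ D-type) (C₂-type′ Y)

      module _ {m} {Γ : Ctx m} {x x′ p} (X : Γ ⊢ x ∶ˢ Φ) (X′ : Γ ⊢ x′ ∶ˢ Φ)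
          (P : Γ ⊢ p ∶Id Φ ⦅ x , x′ ⦆) where

        C₁-type′ : (Γ ▷ D [ x ]ᵀ) ⊢ C₁ (x ⟨ wks ⟩) (x′ ⟨ wks ⟩) (p ⟨ wks ⟩) (var zero) type
        C₁-type′ = C₁-type (wk-∶ˢ D′ X) (wk-∶ˢ D′ X′) (Id-subst P (wks-∶ˢ D′)) (var₀ D-type X)
          where D′ = subst-type X D-type

        C₀-type : Γ ⊢ C₀ x x′ p type
        C₀-type = Π-form (subst-type X D-type) C₁-type′

      M₀ : Motive Φ
      M₀ = record { fam = C₀ ; nat = C₀-[] ; typ = C₀-type }

      d₁ : ∀ {m} → Sub m k → Tm (suc m)
      d₁ x = d [ var zero ∷ x ⟨ wks ⟩ ]

      module _ {m} {Γ : Ctx m} {x} (X : Γ ⊢ x ∶ˢ Φ) where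
        private
          D₀ = subst-type X D-type

          G : Ctx (suc (suc (suc m)))
          G = Id-ctx Γ (D [ x ]ᵀ)

          w3 : ∀ {n} → Sub m n → Sub (suc (suc (suc m))) n
          w3 σ = σ ⟨ wks ⟩ ⟨ wks ⟩ ⟨ wks ⟩

          N : Ty (suc (suc (suc m)))
          N = fam C (var (suc (suc zero)) ∷ w3 x) (var (suc zero) ∷ w3 x) (var zero ∷ w3 (rfls x))

          w3-inst : ∀ {l n} (σ : Sub m n) (τ : Sub l m) q y′ y → w3 σ ⟨ q ∷ y′ ∷ y ∷ τ ⟩ ≡ σ ⟨ τ ⟩
          w3-inst σ τ q y′ y = trans (wk-⟨∷⟩ _ _ _) (trans (wk-⟨∷⟩ _ _ _) (wk-⟨∷⟩ _ _ _))

          N-inst : ∀ {l} (τ : Sub l m) q y′ y →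
            N [ q ∷ y′ ∷ y ∷ τ ]ᵀ ≡ fam C (y ∷ x ⟨ τ ⟩) (y′ ∷ x ⟨ τ ⟩) (q ∷ rfls x ⟨ τ ⟩)
          N-inst τ q y′ y = trans (nat C _ _ _ _) (cong₃ (fam C)
            (cong₂ _∷_ (var-[] _ _) (w3-inst x τ q y′ y))
                (cong₂ _∷_ (var-[] _ _) (w3-inst x τ q y′ y))
            (cong₂ _∷_ (var-[] _ _) (w3-inst (rfls x) τ q y′ y)))

          Dw : (Γ ▷ D [ x ]ᵀ) ⊢ D [ x ]ᵀ [ wks ]ᵀ type
          Dw = subst-type (wks-∶ˢ D₀) D₀

          eqD : ∀ {n} (z : Sub n k) → D [ z ]ᵀ [ wks ]ᵀ ≡ D [ z ⟨ wks ⟩ ]ᵀ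
          eqD z = []-[]ᵀ D z wks

          X1 = wk-∶ˢ D₀ X
          X2 = wk-∶ˢ Dw X1

          v1 : (Γ ▷ D [ x ]ᵀ ▷ D [ x ]ᵀ [ wks ]ᵀ) ⊢ var (suc zero) ∶ D [ x ]ᵀ [ wks ]ᵀ [ wks ]ᵀ
          v1 = var-type (type-ctx Dw ▷ Dw) (suc zero)
          v0 : (Γ ▷ D [ x ]ᵀ ▷ D [ x ]ᵀ [ wks ]ᵀ) ⊢ var zero ∶ D [ x ]ᵀ [ wks ]ᵀ [ wks ]ᵀ
          v0 = var-type (type-ctx Dw ▷ Dw) zero

          I : (Γ ▷ D [ x ]ᵀ ▷ D [ x ]ᵀ [ wks ]ᵀ) ⊢ Id (D [ x ]ᵀ [ wks ]ᵀ [ wks ]ᵀ) (var (suc zero))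
              (var zero) type
          I = Id-form v1 v0

          eq3 : D [ x ]ᵀ [ wks ]ᵀ [ wks ]ᵀ [ wks ]ᵀ ≡ D [ w3 x ]ᵀ
          eq3 = trans (cong (λ z → z [ wks ]ᵀ [ wks ]ᵀ) (eqD x))
              (trans (cong (_[ wks ]ᵀ) (eqD (x ⟨ wks ⟩))) (eqD _))

          lookup-wks : ∀ {n} (i : Fin n) → var i [ wks ] ≡ var (suc i)
          lookup-wks i = trans (var-[] i wks) (lookup∘tabulate _ i)

          X3 : G ⊢ w3 x ∶ˢ Φ
          X3 = wk-∶ˢ I X2

          rfls-w3 : w3 (rfls x) ≡ rfls (w3 x)
          rfls-w3 = trans (cong (λ z → z ⟨ wks ⟩ ⟨ wks ⟩) (rfls-⟨⟩ x wks))
              (trans (cong (_⟨ wks ⟩) (rfls-⟨⟩ _ wks)) (rfls-⟨⟩ _ wks))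

          N-type : G ⊢ N type
          N-type = subst (λ z → G ⊢ fam C (var (suc (suc zero)) ∷ w3 x) (var (suc zero) ∷ w3 x)
            (var zero ∷ z) type) (sym rfls-w3)
            (typ C (X3 ∷ (D-type , V2)) (X3 ∷ (D-type , V1))
                (rfls-type e X3 ∷ conv (≐type-sym (Id-tr X3 V2 V1)) V0))
            where
            gc : ⊢ G
            gc = type-ctx I ▷ I
            V2 : G ⊢ var (suc (suc zero)) ∶ D [ w3 x ]ᵀ
            V2 = var-type gc (suc (suc zero)) ∶≡ eq3
            V1 : G ⊢ var (suc zero) ∶ D [ w3 x ]ᵀ
            V1 = var-type gc (suc zero) ∶≡ eq3
            V0 : G ⊢ var zero ∶ Id (D [ w3 x ]ᵀ) (var (suc (suc zero))) (var (suc zero))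
            V0 = var-type gc zero ∶≡ trans (Id-[] _ _ _ _)
                (cong₃ Id eq3 (lookup-wks _) (lookup-wks _))

          d₁-type : (Γ ▷ D [ x ]ᵀ) ⊢ d₁ x ∶ N [ rfl (var zero) ∷ var zero ∷ var zero ∷ wks ]ᵀ
          d₁-type = prem (X1 ∷ (D-type , var₀ D-type X)) ∶≡
            sym (trans (N-inst wks _ _ _) (cong (fam C _ _) (cong (_ ∷_) (rfls-⟨⟩ x wks))))

          N-ids : ∀ q y′ y → N [ q ∷ y′ ∷ y ∷ ids ]ᵀ ≡ fam C (y ∷ x) (y′ ∷ x) (q ∷ rfls x)
          N-ids q y′ y = trans (N-inst ids q y′ y)
              (cong₃ (fam C) (cong (_ ∷_) (⟨ids⟩ x)) (cong (_ ∷_) (⟨ids⟩ x))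
              (cong (_ ∷_) (⟨ids⟩ (rfls x))))

        inner : ∀ {y y′ q} → Γ ⊢ y ∶ D [ x ]ᵀ → Γ ⊢ y′ ∶ D [ x ]ᵀ →
                Γ ⊢ q ∶ Id (D [ x ]ᵀ) y (tr x x (rfls x) y′) →
                Γ ⊢ J (d₁ x) y y′ q ∶ fam C (y ∷ x) (y′ ∷ x) (q ∷ rfls x)
        inner {y} {y′} {q} Y Y′ Q = Id-elim N-type d₁-type Y Y′
            (conv (Id-tr X Y Y′) Q) ∶≡ N-ids q y′ y

        inner-β : ∀ {y} → Γ ⊢ y ∶ D [ x ]ᵀ →
            Γ ⊢ J (d₁ x) y y (rfl y) ≐ d [ y ∷ x ] ∶ fam C (y ∷ x) (y ∷ x) (rfls (y ∷ x))
        inner-β {y} Y = (Id-β N-type d₁-type Y ▷≐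
          trans ([]-[] d _ _) (cong (d [_]) (cong₂ _∷_ (var-[] _ _) (wk-inst x y)))) ≐≡ N-ids _ _ _

      s₂-type : ∀ {m} {Γ : Ctx m} {x y y′} → Γ ⊢ x ∶ˢ Φ → Γ ⊢ y ∶ D [ x ]ᵀ → Γ ⊢ y′ ∶ D [ x ]ᵀ →
                (Γ ▷ Id (D [ x ]ᵀ) y (tr x x (rfls x) y′)) ⊢
                J (d [ var zero ∷ x ⟨ wks ⟩ ⟨ wks ⟩ ]) (y [ wks ]) (y′ [ wks ]) (var zero) ∶
                fam C (y [ wks ] ∷ x ⟨ wks ⟩) (y′ [ wks ] ∷ x ⟨ wks ⟩) (var zero ∷ rfls x ⟨ wks ⟩)
      s₂-type {x = x} {y} {y′} X Y Y′ = inner (wk-∶ˢ I X) (wk-∶′ I Y) (wk-∶′ I Y′)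
        (var-zero I ∶≡ trans (Id-[] _ _ _ _) (cong₃ Id ([]-[]ᵀ D x wks) refl
          (trans (tr-[] x x (rfls x) y′ wks)
              (cong (λ z → tr (x ⟨ wks ⟩) (x ⟨ wks ⟩) z (y′ [ wks ])) (rfls-⟨⟩ x wks)))))
        ∶≡ cong (fam C _ _) (cong (_ ∷_) (sym (rfls-⟨⟩ x wks)))
        where I = I-type X X (rfls-type e X) Y Y′

      s₁-type : ∀ {m} {Γ : Ctx m} {x y} → Γ ⊢ x ∶ˢ Φ → Γ ⊢ y ∶ D [ x ]ᵀ →
                (Γ ▷ D [ x ]ᵀ) ⊢ step₂ d (x ⟨ wks ⟩) (y [ wks ]) (var zero) ∶
                C₂ (x ⟨ wks ⟩) (x ⟨ wks ⟩) (rfls x ⟨ wks ⟩) (y [ wks ]) (var zero)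
      s₁-type {x = x} X Y = Π-intro (s₂-type (wk-∶ˢ D₀ X) (wk-∶′ D₀ Y) (var₀ D-type X))
        ∶≡ cong (λ z → C₂ _ _ z _ _) (sym (rfls-⟨⟩ x wks))
        where D₀ = subst-type X D-type

      s₀-type : ∀ {m} {Γ : Ctx m} {x} → Γ ⊢ x ∶ˢ Φ →
                (Γ ▷ D [ x ]ᵀ) ⊢ step₁ d (x ⟨ wks ⟩) (var zero) ∶
                C₁ (x ⟨ wks ⟩) (x ⟨ wks ⟩) (rfls x ⟨ wks ⟩) (var zero)
      s₀-type {x = x} X = Π-intro (s₁-type (wk-∶ˢ D₀ X) (var₀ D-type X))
        ∶≡ cong (λ z → C₁ _ _ z _) (sym (rfls-⟨⟩ x wks))
        where D₀ = subst-type X D-type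

      step-prem : Premise M₀ (step d ids)
      step-prem {Γ = Γ} {x} X = subst (λ t → Γ ⊢ t ∶ C₀ x x (rfls x)) (sym (step-ids d x))
          (Π-intro (s₀-type X))

      J-type′ : ∀ {m} {Γ : Ctx m} {a b p} → Γ ⊢ a ∶ˢ Φ ▷ D → Γ ⊢ b ∶ˢ Φ ▷ D →
                Γ ⊢ p ∶Id Φ ▷ D ⦅ a , b ⦆ →
                Γ ⊢ Jᶜ (suc k) d a b p ∶ fam C a b p
      J-type′ (_∷_ {σ = x} {y} X (_ , Y)) (_∷_ {σ = x′} {y′} X′ (_ , Y′))
        (_∷_ {p = p} {q = q} P Q) =
        Π-elim (C₃-type X X′ P Y Y′)
          (Π-elim (C₂-type′ X X′ P Y)
            (Π-elim (C₁-type′ X X′ P)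
              (J-type e M₀ _ step-prem X X′ P) Y ∶≡ C₁-inst x x′ p y)
            Y′ ∶≡ C₂-inst x x′ p y y′)
          Q ∶≡ C₃-inst x x′ p y y′ q

      J-β′ : ∀ {m} {Γ : Ctx m} {x} → Γ ⊢ x ∶ˢ Φ ▷ D →
          Γ ⊢ Jᶜ (suc k) d x x (rfls x) ≐ d [ x ] ∶ fam C x x (rfls x)
      J-β′ {Γ = Γ} (_∷_ {σ = x} {y} X (_ , Y)) = ≐-trans e₃ (inner-β X Y)
        where
        P = rfls-type e X
        Q : Γ ⊢ rfl y ∶ Id (D [ x ]ᵀ) y (tr x x (rfls x) y)
        Q = conv (≐type-sym (Id-tr X Y Y)) (Id-intro Y)
        e₀ : Γ ⊢ Jᶜ k (step d ids) x x (rfls x) ≐ step d x ∶ C₀ x x (rfls x)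
        e₀ = J-β e M₀ _ step-prem X ▷≐ step-ids d x
        e₁ : Γ ⊢ app (Jᶜ k (step d ids) x x (rfls x)) y ≐ step₁ d x y ∶ C₁ x x (rfls x) y
        e₁ = (≐-trans (app-cong (C₁-type′ X X P) e₀ (≐-refl Y)) (Π-β (s₀-type X) Y) ≐≡ C₁-inst x x
          (rfls x) y)
          ▷≐ trans (step₁-[] d _ _ _) (cong₂ (step₁ d) (wk-inst x y) (var-[] _ _))
        e₂ : Γ ⊢ app (app (Jᶜ k (step d ids) x x (rfls x)) y) y ≐ step₂ d x y y ∶ C₂ x x
            (rfls x) y y
        e₂ = (≐-trans (app-cong (C₂-type′ X X P Y) e₁ (≐-refl Y))
          (Π-β (s₁-type X Y) Y) ≐≡ C₂-inst x x (rfls x) y y)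
          ▷≐ trans (step₂-[] d _ _ _ _) (cong₃ (step₂ d) (wk-inst x y) (wk-[inst] y y) (var-[] _ _))
        e₃ : Γ ⊢ Jᶜ (suc k) d (y ∷ x) (y ∷ x) (rfl y ∷ rfls x) ≐ J (d₁ x) y y (rfl y) ∶ fam C
            (y ∷ x) (y ∷ x) (rfl y ∷ rfls x)
        e₃ = (≐-trans (app-cong (C₃-type X X P Y Y) e₂ (≐-refl Q))
          (Π-β (s₂-type X Y Y) Q) ≐≡ C₃-inst x x (rfls x) y y (rfl y))
          ▷≐ trans (J-[] _ _ _ _ _) (cong₄ J
               (trans ([]-[] d _ _) (cong (d [_]) (cong₂ _∷_ (var-[] _ _)
                 (trans (wk-lift (x ⟨ wks ⟩) (rfl y ∷ ids))
                     (cong (_⟨ wks ⟩) (wk-inst x (rfl y)))))))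
               (wk-[inst] y _) (wk-[inst] y _) (var-[] _ _))

    elim′ : Elim (Φ ▷ D)
    elim′ = record { rfls-type = rfls-type′ ; J-type = J-type′ ; J-β = J-β′ }

  elim : ∀ {k} {Φ : Ctx k} → ⊢ Φ → Elim Φ
  elim []      = record
    { rfls-type = λ { ([] g) → [] g }
    ; J-type = λ { C d prem ([] g) ([] _) ([] _) → prem ([] g) }
    ; J-β = λ { C d prem ([] g) → ≐-refl (prem ([] g)) } }
  elim (Φ ▷ D) = Step.elim′ (elim Φ) D

module Telescopes {r j : Level} {S : TypeTheory r j} (M : ML₂ S) where
  open TypeTheory S
  open ML₂ M
  open Substitution S
  open Identity M

  infixl 20 _[_]ᵗ
  _[_]ᵗ : ∀ {m n l} → Tel n l → Sub m n → Tel m l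
  []      [ σ ]ᵗ = []
  _[_]ᵗ {l = suc l} (T ▷ A) σ = T [ σ ]ᵗ ▷ A [ lifts l σ ]ᵀ

  ⌜_⌝ : ∀ {k} → Ctx k → ∀ {n} → Tel n k
  ⌜ [] ⌝ = []
  ⌜_⌝ {suc k} (Φ ▷ D) = ⌜ Φ ⌝ ▷ D [ vars k ]ᵀ

  Πs : ∀ {n l} → Tel n l → Ty (l + n) → Ty n
  Πs []      C = C
  Πs (T ▷ A) C = Πs T (Π A C)

  lams : ∀ {n} l → Tm (l + n) → Tm n
  lams zero    t = t
  lams (suc l) t = lams l (lam t)

  apps : ∀ {n l} → Tm n → Sub n l → Tm n
  apps f []      = f
  apps f (t ∷ δ) = app (apps f δ) t

  ⌜⌝-[] : ∀ {k m n} (Φ : Ctx k) (σ : Sub m n) → ⌜ Φ ⌝ [ σ ]ᵗ ≡ ⌜ Φ ⌝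
  ⌜⌝-[] []      σ = refl
  ⌜⌝-[] {suc k} (Φ ▷ D) σ = cong₂ _▷_ (⌜⌝-[] Φ σ)
      (trans ([]-[]ᵀ D _ _) (cong (D [_]ᵀ) (vars-lifts k σ)))

  Πs-[] : ∀ {m n l} (T : Tel n l) C (σ : Sub m n) → Πs T C [ σ ]ᵀ ≡ Πs (T [ σ ]ᵗ) (C [ lifts l σ ]ᵀ)
  Πs-[] []      C σ = refl
  Πs-[] (T ▷ A) C σ = trans (Πs-[] T (Π A C) σ) (cong (Πs (T [ σ ]ᵗ)) (Π-[] A C _))

  lams-[] : ∀ {m n} l t (σ : Sub m n) → lams l t [ σ ] ≡ lams l (t [ lifts l σ ])
  lams-[] zero    t σ = refl
  lams-[] (suc l) t σ = trans (lams-[] l (lam t) σ) (cong (lams l) (lam-[] t _))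

  apps-[] : ∀ {m n l} f (δ : Sub n l) (σ : Sub m n) → apps f δ [ σ ] ≡ apps (f [ σ ]) (δ ⟨ σ ⟩)
  apps-[] f []      σ = refl
  apps-[] f (t ∷ δ) σ = trans (app-[] _ t σ) (cong₂ app (apps-[] f δ σ) refl)

  IdTel-[] : ∀ {k m n} (Φ : Ctx k) (a b : Sub n k) (σ : Sub m n) →
      IdTel Φ a b [ σ ]ᵗ ≡ IdTel Φ (a ⟨ σ ⟩) (b ⟨ σ ⟩)
  IdTel-[] []      []      []        σ = refl
  IdTel-[] {suc k} (Φ ▷ D) (y ∷ x) (y′ ∷ x′) σ = cong₂ _▷_ (IdTel-[] Φ x x′ σ)
    (trans (Id-[] _ _ _ _) (cong₃ Id (trans ([]-[]ᵀ D _ _) (cong (D [_]ᵀ) (wksBy-lifts k x σ)))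
      (e y)
      (trans (tr-[] (x ⟨ wksBy k ⟩) (x′ ⟨ wksBy k ⟩) (vars k) (y′ [ wksBy k ]) (lifts k σ))
        (cong₄ (tr {k}) (wksBy-lifts k x σ) (wksBy-lifts k x′ σ) (vars-lifts k σ) (e y′)))))
    where
    e : ∀ y → y [ wksBy k ] [ lifts k σ ] ≡ y [ σ ] [ wksBy k ]
    e y = trans ([]-[] y _ _) (trans
        (cong (y [_]) (trans (cong (wksBy k ⟨_⟩) (lifts≡ k σ)) (wksBy-⟨++⟩ (vars k) _)))
        (sym ([]-[] y σ _)))

  lift-∶ˢ : ∀ {m n} {Γ : Ctx m} {Δ : Ctx n} {σ A} → Γ ⊢ σ ∶ˢ Δ → Δ ⊢ A type →
      (Γ ▷ A [ σ ]ᵀ) ⊢ lift σ ∶ˢ Δ ▷ A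
  lift-∶ˢ s a = wk-∶ˢ (subst-type s a) s ∷ (a , var₀ a s)

  ++-∶ˢ : ∀ {m n l} {Δ : Ctx m} {Γ : Ctx n} {T : Tel n l} {σ δ} → ⊢ Γ ⧺ T → Δ ⊢ σ ∶ˢ Γ →
          Δ ⊢ δ ∶ᵗ T [ σ ]ᵗ →
          Δ ⊢ δ ++ σ ∶ˢ Γ ⧺ T
  ++-∶ˢ {T = []}    g       s ([] _)  = s
  ++-∶ˢ {l = suc l} {T = T ▷ A} {σ} (g ▷ a) s (_∷_ {δ = δ} d t) = ++-∶ˢ g s d ∷ (a , (t ∶≡
    trans ([]-[]ᵀ A _ _) (cong (A [_]ᵀ) (trans (lifts-⟨++⟩ σ δ ids) (cong (δ ++_) (⟨ids⟩ σ))))))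

  ++-∶ᵗ : ∀ {m n l} {Δ : Ctx m} {Γ : Ctx n} (T : Tel n l) {σ} (δ : Sub m l) → Δ ⊢ δ ++ σ ∶ˢ Γ ⧺ T →
      Δ ⊢ δ ∶ᵗ T [ σ ]ᵗ
  ++-∶ᵗ []      []      s = [] (∶ˢ-ctx s)
  ++-∶ᵗ {l = suc l} (T ▷ A) {σ} (_ ∷ δ) (s ∷ (_ , t)) = ++-∶ᵗ T δ s ∷ (t ∶≡ sym
    (trans ([]-[]ᵀ A _ _) (cong (A [_]ᵀ) (trans (lifts-⟨++⟩ σ δ ids) (cong (δ ++_) (⟨ids⟩ σ))))))

  ++-≐ˢ : ∀ {m n l} {Δ : Ctx m} {Γ : Ctx n} {T : Tel n l} {σ σ′ δ δ′} → ⊢ Γ ⧺ T → Δ ⊢ σ ≐ σ′ ∶ˢ Γ →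
          Δ ⊢ δ ≐ δ′ ∶ᵗ T [ σ ]ᵗ → Δ ⊢ δ ++ σ ≐ δ′ ++ σ′ ∶ˢ Γ ⧺ T
  ++-≐ˢ {T = []}    g       s ([] _)  = s
  ++-≐ˢ {l = suc l} {T = T ▷ A} {σ} (g ▷ a) s (_∷_ {δ = δ} d t) = ++-≐ˢ g s d ∷ (a , (t ≐≡
    trans ([]-[]ᵀ A _ _) (cong (A [_]ᵀ) (trans (lifts-⟨++⟩ σ δ ids) (cong (δ ++_) (⟨ids⟩ σ))))))

  []ᵗ-ids : ∀ {n l} (T : Tel n l) → T [ ids ]ᵗ ≡ T
  []ᵗ-ids []      = refl
  []ᵗ-ids {n} {suc l} (T ▷ A) = cong₂ _▷_ ([]ᵗ-ids T) (trans (cong (A [_]ᵀ) (e l)) ([]-idᵀ A))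
    where
    e : ∀ l → lifts l (ids {n}) ≡ ids
    e l = trans (lifts≡ l ids) (trans (cong (vars l ++_) (ids-⟨⟩ _)) (vars++wksBy l))

  inst-∶ˢ : ∀ {n l} {Γ : Ctx n} {T : Tel n l} {δ} → ⊢ Γ ⧺ T → Γ ⊢ δ ∶ᵗ T → Γ ⊢ δ ++ ids ∶ˢ Γ ⧺ T
  inst-∶ˢ {Γ = Γ} {T} {δ} g d = ++-∶ˢ g (ids-∶ˢ (⧺-ctx T g)) (subst (Γ ⊢ δ ∶ᵗ_) (sym ([]ᵗ-ids T)) d)

  vars-∶ᵗ : ∀ {n l} {Γ : Ctx n} (T : Tel n l) → ⊢ Γ ⧺ T → (Γ ⧺ T) ⊢ vars l ∶ᵗ T [ wksBy l ]ᵗ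
  vars-∶ᵗ {l = l} {Γ} T g = ++-∶ᵗ T (vars l)
      (subst (λ σ → (Γ ⧺ T) ⊢ σ ∶ˢ Γ ⧺ T) (sym (vars++wksBy l)) (ids-∶ˢ g))

  to⌜⌝ : ∀ {m k} {Γ : Ctx m} {Φ : Ctx k} {a} → Γ ⊢ a ∶ˢ Φ → Γ ⊢ a ∶ᵗ ⌜ Φ ⌝
  to⌜⌝ ([] g) = [] g
  to⌜⌝ {k = suc k} {Φ = Φ ▷ D} (_∷_ {σ = σ} s (_ , t)) = to⌜⌝ s ∷
      (t ∶≡ sym (trans ([]-[]ᵀ D _ _) (cong (D [_]ᵀ) (vars-⟨++⟩ σ ids))))

  from⌜⌝ : ∀ {m k} {Γ : Ctx m} {Φ : Ctx k} {a} → ⊢ Φ → Γ ⊢ a ∶ᵗ ⌜ Φ ⌝ → Γ ⊢ a ∶ˢ Φ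
  from⌜⌝ []      ([] g) = [] g
  from⌜⌝ {k = suc k} {Φ = Φ ▷ D} (f ▷ d) (_∷_ {δ = σ} s t) = from⌜⌝ f s ∷
      (d , (t ∶≡ trans ([]-[]ᵀ D _ _) (cong (D [_]ᵀ) (vars-⟨++⟩ σ ids))))

  to⌜⌝≐ : ∀ {m k} {Γ : Ctx m} {Φ : Ctx k} {a b} → Γ ⊢ a ≐ b ∶ˢ Φ → Γ ⊢ a ≐ b ∶ᵗ ⌜ Φ ⌝
  to⌜⌝≐ ([] g) = [] g
  to⌜⌝≐ {k = suc k} {Φ = Φ ▷ D} (_∷_ {σ = σ} s (_ , t)) = to⌜⌝≐ s ∷
      (t ≐≡ sym (trans ([]-[]ᵀ D _ _) (cong (D [_]ᵀ) (vars-⟨++⟩ σ ids))))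

  ⌜⌝-vars : ∀ {n k} {Γ : Ctx n} {Φ : Ctx k} → ⊢ Φ → ⊢ Γ ⧺ ⌜ Φ ⌝ → (Γ ⧺ ⌜ Φ ⌝) ⊢ vars k ∶ˢ Φ
  ⌜⌝-vars {k = k} {Γ} {Φ} f g = from⌜⌝ f
      (subst (λ T → (Γ ⧺ ⌜ Φ ⌝) ⊢ vars k ∶ᵗ T) (⌜⌝-[] Φ _) (vars-∶ᵗ ⌜ Φ ⌝ g))

  ⌜⌝-ctx : ∀ {n k} {Γ : Ctx n} {Φ : Ctx k} → ⊢ Γ → ⊢ Φ → ⊢ Γ ⧺ ⌜ Φ ⌝
  ⌜⌝-ctx g []      = g
  ⌜⌝-ctx g (f ▷ d) = ⌜⌝-ctx g f ▷ subst-type (⌜⌝-vars f (⌜⌝-ctx g f)) d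

  IdTel-vars : ∀ {n k} {Γ : Ctx n} {Φ : Ctx k} {a b} → ⊢ Γ ⧺ IdTel Φ a b →
               (Γ ⧺ IdTel Φ a b) ⊢ vars k ∶Id Φ ⦅ a ⟨ wksBy k ⟩ , b ⟨ wksBy k ⟩ ⦆
  IdTel-vars {k = k} {Γ} {Φ} {a} {b} g = toId
    (subst (λ T → (Γ ⧺ IdTel Φ a b) ⊢ vars k ∶ᵗ T) (IdTel-[] Φ a b _) (vars-∶ᵗ (IdTel Φ a b) g))

  IdTel-ctx : ∀ {n k} {Γ : Ctx n} {Φ : Ctx k} {a b} → ⊢ Φ → Γ ⊢ a ∶ˢ Φ → Γ ⊢ b ∶ˢ Φ →
      ⊢ Γ ⧺ IdTel Φ a b
  IdTel-ctx []      ([] g) ([] _) = g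
  IdTel-ctx {k = suc k} (f ▷ d) (_∷_ {σ = x} X (_ , Y)) (_∷_ {σ = x′} X′ (_ , Y′)) = g ▷ Id-form
    (subst-term w Y ∶≡ []-[]ᵀ _ x _)
    (Transport.tr-type (elim f) d (⟨⟩-∶ˢ X w) (⟨⟩-∶ˢ X′ w) (IdTel-vars g)
        (subst-term w Y′ ∶≡ []-[]ᵀ _ x′ _))
    where
    g = IdTel-ctx f X X′
    w = wksBy-∶ˢ (IdTel _ x x′) g

  Πs-form : ∀ {n l} {Γ : Ctx n} (T : Tel n l) {C} → (Γ ⧺ T) ⊢ C type → Γ ⊢ Πs T C type
  Πs-form []      c = c
  Πs-form (T ▷ A) c with type-ctx c
  ... | _ ▷ a = Πs-form T (Π-form a c)

  lams-intro : ∀ {n l} {Γ : Ctx n} (T : Tel n l) {C t} → (Γ ⧺ T) ⊢ t ∶ C → Γ ⊢ lams l t ∶ Πs T C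
  lams-intro []      t = t
  lams-intro (T ▷ A) t = lams-intro T (Π-intro t)

  private
    inst≡ : ∀ {n m} (C : Ty (suc n)) (τ : Sub m n) (t : Tm m) →
        C [ lift τ ]ᵀ [ t ∷ ids ]ᵀ ≡ C [ t ∷ τ ]ᵀ
    inst≡ C τ t = trans ([]-[]ᵀ C _ _)
        (cong (C [_]ᵀ) (trans (lift-⟨∷⟩ τ t ids) (cong (t ∷_) (⟨ids⟩ τ))))

  apps-elim : ∀ {n l} {Γ : Ctx n} {T : Tel n l} {C f δ} →
              (Γ ⧺ T) ⊢ C type → Γ ⊢ f ∶ Πs T C → Γ ⊢ δ ∶ᵗ T →
              Γ ⊢ apps f δ ∶ C [ δ ++ ids ]ᵀ
  apps-elim {T = []}    {C} c f ([] _) = f ∶≡ sym ([]-idᵀ C)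
  apps-elim {T = T ▷ A} {C} c f (_∷_ {δ = δ} {t} d u) with type-ctx c
  ... | g ▷ a = Π-elim (subst-type (lift-∶ˢ (inst-∶ˢ g d) a) c)
    (apps-elim (Π-form a c) f d ∶≡ Π-[] A C _) u ∶≡ inst≡ C _ t

  apps-cong : ∀ {n l} {Γ : Ctx n} {T : Tel n l} {C f f′ δ} →
              (Γ ⧺ T) ⊢ C type → Γ ⊢ f ≐ f′ ∶ Πs T C → Γ ⊢ δ ∶ᵗ T →
              Γ ⊢ apps f δ ≐ apps f′ δ ∶ C [ δ ++ ids ]ᵀ
  apps-cong {T = []}    {C} c f ([] _) = f ≐≡ sym ([]-idᵀ C)
  apps-cong {T = T ▷ A} {C} c f (_∷_ {δ = δ} {t} d u) with type-ctx c
  ... | g ▷ a = app-cong (subst-type (lift-∶ˢ (inst-∶ˢ g d) a) c)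
    (apps-cong (Π-form a c) f d ≐≡ Π-[] A C _) (≐-refl u) ≐≡ inst≡ C _ t

  apps-β : ∀ {n l} {Γ : Ctx n} {T : Tel n l} {C t δ} → (Γ ⧺ T) ⊢ t ∶ C → Γ ⊢ δ ∶ᵗ T →
           Γ ⊢ apps (lams l t) δ ≐ t [ δ ++ ids ] ∶ C [ δ ++ ids ]ᵀ
  apps-β {T = []}    {C} {t} x ([] _) = (≐-refl x ▷≐ sym ([]-id t)) ≐≡ sym ([]-idᵀ C)
  apps-β {Γ = Γ} {T = T ▷ A} {C} {t} x (_∷_ {δ = δ} {u} d U) with type-ctx (term-type x)
  ... | g ▷ a =
    (≐-trans (app-cong (subst-type s c) (apps-β (Π-intro x) d ≐≡ Π-[] A C _) (≐-refl U))
      (cong (λ z → app z u) (lam-[] t _) ◁≐ Π-β (subst-term s x) U)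
      ▷≐ trans ([]-[] t _ _) (cong (t [_]) (trans (lift-⟨∷⟩ _ u ids) (cong (u ∷_) (⟨ids⟩ _))))) ≐≡
          inst≡ C _ u
    where
    c = term-type x
    s = lift-∶ˢ (inst-∶ˢ g d) a

module PostContexts {r j : Level} {S : TypeTheory r j} (M : ML₂ S) where
  open TypeTheory S
  open ML₂ M
  open Substitution S
  open Identity M
  open Motive
  open Elim
  open Telescopes M

  module Generic {k} {Φ : Ctx k} (f : ⊢ Φ) where
    I-ctx : Ctx (k + (k + k))
    I-ctx = (Φ ⧺ ⌜ Φ ⌝) ⧺ IdTel Φ (wksBy k) (vars k)

    pairs : ⊢ Φ ⧺ ⌜ Φ ⌝
    pairs = ⌜⌝-ctx f f

    I-ok : ⊢ I-ctx
    I-ok = IdTel-ctx f (wksBy-∶ˢ ⌜ Φ ⌝ pairs) (⌜⌝-vars f pairs)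

    x̂ ŷ p̂ : Sub (k + (k + k)) k
    x̂ = wksBy k ⟨ wksBy k ⟩
    ŷ = vars k ⟨ wksBy k ⟩
    p̂ = vars k

    x̂-∶ : I-ctx ⊢ x̂ ∶ˢ Φ
    x̂-∶ = ⟨⟩-∶ˢ (wksBy-∶ˢ ⌜ Φ ⌝ pairs) (wksBy-∶ˢ (IdTel Φ (wksBy k) (vars k)) I-ok)
    ŷ-∶ : I-ctx ⊢ ŷ ∶ˢ Φ
    ŷ-∶ = ⟨⟩-∶ˢ (⌜⌝-vars f pairs) (wksBy-∶ˢ (IdTel Φ (wksBy k) (vars k)) I-ok)
    p̂-∶ : I-ctx ⊢ p̂ ∶Id Φ ⦅ x̂ , ŷ ⦆
    p̂-∶ = IdTel-vars I-ok

    x̂-⟨⟩ : ∀ {m} (a b p : Sub m k) → x̂ ⟨ p ++ (b ++ a) ⟩ ≡ a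
    x̂-⟨⟩ a b p = trans (wksBy-inst k (wksBy k) p (b ++ a)) (wksBy-⟨++⟩ b a)
    ŷ-⟨⟩ : ∀ {m} (a b p : Sub m k) → ŷ ⟨ p ++ (b ++ a) ⟩ ≡ b
    ŷ-⟨⟩ a b p = trans (wksBy-inst k (vars k) p (b ++ a)) (vars-⟨++⟩ b a)
    p̂-⟨⟩ : ∀ {m} (a b p : Sub m k) → p̂ ⟨ p ++ (b ++ a) ⟩ ≡ p
    p̂-⟨⟩ a b p = vars-⟨++⟩ p (b ++ a)

    point-≐ : ∀ {m} {Θ : Ctx m} {a a′ b b′ p p′} → Θ ⊢ a ≐ a′ ∶ˢ Φ → Θ ⊢ b ≐ b′ ∶ˢ Φ →
              Θ ⊢ p ≐ p′ ∶Id Φ ⦅ a , b ⦆ →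
              Θ ⊢ p ++ (b ++ a) ≐ p′ ++ (b′ ++ a′) ∶ˢ I-ctx
    point-≐ {Θ = Θ} {a} {b = b} {p = p} {p′} A B P = ++-≐ˢ I-ok
      (++-≐ˢ pairs A (subst (λ T → Θ ⊢ b ≐ _ ∶ᵗ T) (sym (⌜⌝-[] Φ a)) (to⌜⌝≐ B)))
      (subst (λ T → Θ ⊢ p ≐ p′ ∶ᵗ T)
        (sym (trans (IdTel-[] Φ _ _ _)
            (cong₂ (λ u v → IdTel Φ u v) (wksBy-⟨++⟩ b a) (vars-⟨++⟩ b a))))
        (fromId≐ P))

  tr-cong : ∀ {k} {Φ : Ctx k} {D : Ty k} → ⊢ Φ → Φ ⊢ D type →
            ∀ {m} {Θ : Ctx m} {a a′ b b′ p p′ z z′} →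
            Θ ⊢ a ≐ a′ ∶ˢ Φ → Θ ⊢ b ≐ b′ ∶ˢ Φ → Θ ⊢ p ≐ p′ ∶Id Φ ⦅ a , b ⦆ → Θ ⊢ z ≐ z′ ∶ D [ b ]ᵀ →
            Θ ⊢ tr a b p z ≐ tr a′ b′ p′ z′ ∶ D [ a ]ᵀ
  tr-cong {k} {Φ} {D} f d {Θ = Θ} {a} {a′} {b} {b′} {p} {p′} {z} {z′} A B P Z =
    (sym (e a b p z) ◁≐ (term-subst-≐ s t ▷≐ e a′ b′ p′ z′)) ≐≡
      trans ([]-[]ᵀ D _ _) (cong (D [_]ᵀ) (trans (wk-⟨∷⟩ x̂ z _) (x̂-⟨⟩ a b p)))
    where
    open Generic f
    dy = subst-type ŷ-∶ d
    t : (I-ctx ▷ D [ ŷ ]ᵀ) ⊢ tr (x̂ ⟨ wks ⟩) (ŷ ⟨ wks ⟩) (p̂ ⟨ wks ⟩) (var zero) ∶ D [ x̂ ⟨ wks ⟩ ]ᵀ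
    t = Transport.tr-type (elim f) d (wk-∶ˢ dy x̂-∶) (wk-∶ˢ dy ŷ-∶) (Id-subst p̂-∶ (wks-∶ˢ dy))
        (var₀ d ŷ-∶)
    s : Θ ⊢ z ∷ (p ++ (b ++ a)) ≐ z′ ∷ (p′ ++ (b′ ++ a′)) ∶ˢ I-ctx ▷ D [ ŷ ]ᵀ
    s = point-≐ A B P ∷ (dy , (Z ≐≡ sym (trans ([]-[]ᵀ D _ _) (cong (D [_]ᵀ) (ŷ-⟨⟩ a b p)))))
    e : ∀ {m} (a b p : Sub m k) z →
        tr (x̂ ⟨ wks ⟩) (ŷ ⟨ wks ⟩) (p̂ ⟨ wks ⟩) (var zero) [ z ∷ (p ++ (b ++ a)) ] ≡ tr a b p z
    e a b p z = trans (tr-[] (x̂ ⟨ wks ⟩) (ŷ ⟨ wks ⟩) (p̂ ⟨ wks ⟩) (var zero) _)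
      (cong₄ (tr {k}) (trans (wk-⟨∷⟩ _ _ _) (x̂-⟨⟩ a b p)) (trans (wk-⟨∷⟩ _ _ _) (ŷ-⟨⟩ a b p))
          (trans (wk-⟨∷⟩ _ _ _) (p̂-⟨⟩ a b p)) (var-[] _ _))

  Id≐-left : ∀ {m k} {Θ : Ctx m} {Φ : Ctx k} {a b p q} → Θ ⊢ p ≐ q ∶Id Φ ⦅ a , b ⦆ →
      Θ ⊢ p ∶Id Φ ⦅ a , b ⦆
  Id≐-left ([] g)  = [] g
  Id≐-left (P ∷ q) = Id≐-left P ∷ proj₁ (≐term-term q)

  Id≐-refl : ∀ {m k} {Θ : Ctx m} {Φ : Ctx k} {a b p} → Θ ⊢ p ∶Id Φ ⦅ a , b ⦆ →
      Θ ⊢ p ≐ p ∶Id Φ ⦅ a , b ⦆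
  Id≐-refl ([] g)  = [] g
  Id≐-refl (P ∷ q) = Id≐-refl P ∷ ≐-refl q

  last≐ : ∀ {m k} {Θ : Ctx m} {Φ : Ctx k} {D : Ty k} {a a′ b b′ p p′ y z y′ z′} →
          Θ ⊢ y ∷ a ≐ z ∷ a′ ∶ˢ Φ ▷ D → Θ ⊢ y′ ∷ b ≐ z′ ∷ b′ ∶ˢ Φ ▷ D → Θ ⊢ p ≐ p′ ∶Id Φ ⦅ a , b ⦆ →
          Θ ⊢ Id (D [ a ]ᵀ) y (tr a b p y′) ≐ Id (D [ a′ ]ᵀ) z (tr a′ b′ p′ z′) type
  last≐ (A ∷ (d , Y)) (B ∷ (_ , Y′)) P =
    Id-cong (type-subst-≐ A d) Y (tr-cong (∶ˢ-cod (≐ˢ-left A)) d A B P Y′)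

  Id-conv≐ : ∀ {m k} {Θ : Ctx m} {Φ : Ctx k} {a a′ b b′ p q} → Θ ⊢ a ≐ a′ ∶ˢ Φ → Θ ⊢ b ≐ b′ ∶ˢ Φ →
             Θ ⊢ p ≐ q ∶Id Φ ⦅ a , b ⦆ → Θ ⊢ p ≐ q ∶Id Φ ⦅ a′ , b′ ⦆
  Id-conv≐ ([] _) ([] _) ([] g) = [] g
  Id-conv≐ (A ∷ y) (B ∷ y′) (P ∷ q) = Id-conv≐ A B P ∷
    ≐-conv (last≐ (A ∷ y) (B ∷ y′) (Id≐-refl (Id≐-left P))) q

  Id-conv : ∀ {m k} {Θ : Ctx m} {Φ : Ctx k} {a a′ b b′ p} → Θ ⊢ a ≐ a′ ∶ˢ Φ → Θ ⊢ b ≐ b′ ∶ˢ Φ →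
            Θ ⊢ p ∶Id Φ ⦅ a , b ⦆ → Θ ⊢ p ∶Id Φ ⦅ a′ , b′ ⦆
  Id-conv A B P = Id≐-left (Id-conv≐ A B (Id≐-refl P))

  module _ {m} {Θ : Ctx m} where

    Id≐-sym : ∀ {k} {Φ : Ctx k} {a b p q} → Θ ⊢ a ∶ˢ Φ → Θ ⊢ b ∶ˢ Φ → Θ ⊢ p ≐ q ∶Id Φ ⦅ a , b ⦆ →
        Θ ⊢ q ≐ p ∶Id Φ ⦅ a , b ⦆
    Id≐-sym ([] _) ([] _) ([] g) = [] g
    Id≐-sym (A ∷ y) (B ∷ y′) (P ∷ q) = Id≐-sym A B P ∷
      ≐-conv (last≐ (≐ˢ-refl (A ∷ y)) (≐ˢ-refl (B ∷ y′)) P) (≐-sym q)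

    Id≐-trans : ∀ {k} {Φ : Ctx k} {a b p q s} → Θ ⊢ a ∶ˢ Φ → Θ ⊢ b ∶ˢ Φ →
                Θ ⊢ p ≐ q ∶Id Φ ⦅ a , b ⦆ → Θ ⊢ q ≐ s ∶Id Φ ⦅ a , b ⦆ → Θ ⊢ p ≐ s ∶Id Φ ⦅ a , b ⦆
    Id≐-trans ([] _) ([] _) ([] g) ([] _) = [] g
    Id≐-trans (A ∷ y) (B ∷ y′) (P ∷ q) (Q ∷ t) = Id≐-trans A B P Q ∷
      ≐-trans q (≐-conv (≐type-sym (last≐ (≐ˢ-refl (A ∷ y)) (≐ˢ-refl (B ∷ y′)) P)) t)

    Id≐-right : ∀ {k} {Φ : Ctx k} {a b p q} → Θ ⊢ a ∶ˢ Φ → Θ ⊢ b ∶ˢ Φ → Θ ⊢ p ≐ q ∶Id Φ ⦅ a , b ⦆ →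
        Θ ⊢ q ∶Id Φ ⦅ a , b ⦆
    Id≐-right A B P = Id≐-left (Id≐-sym A B P)

  Id-subst-≐ : ∀ {m l k} {Γ : Ctx m} {Δ : Ctx l} {Φ : Ctx k} {p x x′ σ τ} → Γ ⊢ p ∶Id Φ ⦅ x , x′ ⦆ →
               Δ ⊢ σ ≐ τ ∶ˢ Γ →
               Δ ⊢ p ⟨ σ ⟩ ≐ p ⟨ τ ⟩ ∶Id Φ ⦅ x ⟨ σ ⟩ , x′ ⟨ σ ⟩ ⦆
  Id-subst-≐ ([] g)  s = [] (∶ˢ-ctx (≐ˢ-left s))
  Id-subst-≐ {Φ = Φ ▷ D} {σ = σ} (_∷_ {p = p} {x} {x′} {y′ = y′} P q) s = Id-subst-≐ P s ∷
    (term-subst-≐ s q ≐≡ trans (Id-[] _ _ _ _) (cong₃ Id ([]-[]ᵀ D x σ) refl (tr-[] x x′ p y′ σ)))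

  -- Elimination for Id_Φ with a post-context (γ : Γ , δ : tel(γ , a , b , p)),
  -- obtained by Π-abstraction.  A Pt consists of all the arguments.

  record Pt (n k l m : ℕ) : Set r where
    constructor pt
    field
      γ     : Sub m n
      a b p : Sub m k
      δ     : Sub m l
  open Pt

  infixl 20 _⟪_⟫
  _⟪_⟫ : ∀ {n k l m m′} → Pt n k l m → Sub m′ m → Pt n k l m′
  pt γ a b p δ ⟪ σ ⟫ = pt (γ ⟨ σ ⟩) (a ⟨ σ ⟩) (b ⟨ σ ⟩) (p ⟨ σ ⟩) (δ ⟨ σ ⟩)

  record Post {n k} (Γ : Ctx n) (Φ : Ctx k) (l : ℕ) : Set (r ⊔ j) where
    field
      Γ-ctx   : ⊢ Γ
      Φ-ctx   : ⊢ Φ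
      tel     : ∀ {m} → Sub m n → Sub m k → Sub m k → Sub m k → Tel m l
      tel-[]  : ∀ {m m′} (γ : Sub m n) (a b p : Sub m k) (σ : Sub m′ m) →
                tel γ a b p [ σ ]ᵗ ≡ tel (γ ⟨ σ ⟩) (a ⟨ σ ⟩) (b ⟨ σ ⟩) (p ⟨ σ ⟩)
      tel-ctx : ∀ {m} {Θ : Ctx m} {γ a b p} → Θ ⊢ γ ∶ˢ Γ → Θ ⊢ a ∶ˢ Φ → Θ ⊢ b ∶ˢ Φ →
                Θ ⊢ p ∶Id Φ ⦅ a , b ⦆ →
                ⊢ Θ ⧺ tel γ a b p

  JP : ∀ {n k l m} → Tm (l + (n + k)) → Pt n k l m → Tm m
  JP {n} {k} {l} d (pt γ a b p δ) = apps (apps (Jᶜ k (lams n (lams l d)) a b p) γ) δ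

  JP-[] : ∀ {n k l m m′} d (P : Pt n k l m) (σ : Sub m′ m) → JP d P [ σ ] ≡ JP d (P ⟪ σ ⟫)
  JP-[] {n} {k} {l} d (pt γ a b p δ) σ = trans (apps-[] _ δ σ) (cong (λ z → apps z (δ ⟨ σ ⟩))
    (trans (apps-[] _ γ σ) (cong (λ z → apps z (γ ⟨ σ ⟩)) (Jᶜ-[] k _ a b p σ))))

  -- Elimination into a context is componentwise.
  JPs : ∀ {n k l m s} → Sub (l + (n + k)) s → Pt n k l m → Sub m s
  JPs ds P = map (λ d → JP d P) ds

  JPs-[] : ∀ {n k l m m′ s} (ds : Sub (l + (n + k)) s) (P : Pt n k l m) (σ : Sub m′ m) →
      JPs ds P ⟨ σ ⟩ ≡ JPs ds (P ⟪ σ ⟫)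
  JPs-[] []       P σ = refl
  JPs-[] (d ∷ ds) P σ = cong₂ _∷_ (JP-[] d P σ) (JPs-[] ds P σ)

  module ElimP {n k l} {Γ : Ctx n} {Φ : Ctx k} (T : Post Γ Φ l) where
    open Post T

    record _⊢ᵖ_ {m} (Θ : Ctx m) (P : Pt n k l m) : Set (r ⊔ j) where
      constructor ptᵗ
      field
        γ-∶ : Θ ⊢ γ P ∶ˢ Γ
        a-∶ : Θ ⊢ a P ∶ˢ Φ
        b-∶ : Θ ⊢ b P ∶ˢ Φ
        p-∶ : Θ ⊢ p P ∶Id Φ ⦅ a P , b P ⦆
        δ-∶ : Θ ⊢ δ P ∶ᵗ tel (γ P) (a P) (b P) (p P)
    open _⊢ᵖ_ public

    diag : ∀ {m} → Sub m n → Sub m k → Sub m l → Pt n k l m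
    diag γ x δ = pt γ x x (rfls x) δ

    diagᵗ : ∀ {m} {Θ : Ctx m} {γ x δ} → Θ ⊢ γ ∶ˢ Γ → Θ ⊢ x ∶ˢ Φ → Θ ⊢ δ ∶ᵗ tel γ x x (rfls x) →
        Θ ⊢ᵖ diag γ x δ
    diagᵗ G X D = ptᵗ G X X (rfls-type (elim Φ-ctx) X) D

    record PMotive : Set (r ⊔ j) where
      field
        pfam : ∀ {m} → Pt n k l m → Ty m
        pnat : ∀ {m m′} (P : Pt n k l m) (σ : Sub m′ m) → pfam P [ σ ]ᵀ ≡ pfam (P ⟪ σ ⟫)
        ptyp : ∀ {m} {Θ : Ctx m} {P} → Θ ⊢ᵖ P → Θ ⊢ pfam P type
    open PMotive public

    at : ∀ {m} → Tm (l + (n + k)) → Sub m n → Sub m k → Sub m l → Tm m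
    at d γ x δ = d [ δ ++ (γ ++ x) ]

    PPremise : PMotive → Tm (l + (n + k)) → Set (r ⊔ j)
    PPremise C d = ∀ {m} {Θ : Ctx m} {γ x δ} → Θ ⊢ γ ∶ˢ Γ → Θ ⊢ x ∶ˢ Φ →
                   Θ ⊢ δ ∶ᵗ tel γ x x (rfls x) →
                   Θ ⊢ at d γ x δ ∶ pfam C (diag γ x δ)

    module _ (C : PMotive) where
      private
        T₁ : ∀ {m} → Sub m k → Sub m k → Sub m k → Tel (n + m) l
        T₁ a b p = tel (vars n) (a ⟨ wksBy n ⟩) (b ⟨ wksBy n ⟩) (p ⟨ wksBy n ⟩)

        P₁ : ∀ {m} → Sub m k → Sub m k → Sub m k → Pt n k l (l + (n + m))
        P₁ a b p = pt (vars n ⟨ wksBy l ⟩) (a ⟨ wksBy n ⟩ ⟨ wksBy l ⟩) (b ⟨ wksBy n ⟩ ⟨ wksBy l ⟩)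
            (p ⟨ wksBy n ⟩ ⟨ wksBy l ⟩) (vars l)

        P₂ : ∀ {m} → Sub m n → Sub m k → Sub m k → Sub m k → Pt n k l (l + m)
        P₂ γ a b p = pt (γ ⟨ wksBy l ⟩) (a ⟨ wksBy l ⟩) (b ⟨ wksBy l ⟩) (p ⟨ wksBy l ⟩) (vars l)

        T₁-[] : ∀ {m m′} (a b p : Sub m k) (σ : Sub m′ m) →
            T₁ a b p [ lifts n σ ]ᵗ ≡ T₁ (a ⟨ σ ⟩) (b ⟨ σ ⟩) (p ⟨ σ ⟩)
        T₁-[] a b p σ = trans (tel-[] _ _ _ _ _)
            (cong₄ tel (vars-lifts n σ) (wksBy-lifts n a σ) (wksBy-lifts n b σ) (wksBy-lifts n p σ))

        T₁-inst : ∀ {m} (γ : Sub m n) (a b p : Sub m k) → T₁ a b p [ γ ++ ids ]ᵗ ≡ tel γ a b p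
        T₁-inst γ a b p = trans (tel-[] _ _ _ _ _) (cong₄ tel (vars-⟨++⟩ γ ids) (i a) (i b) (i p))
          where
          i : ∀ a → a ⟨ wksBy n ⟩ ⟨ γ ++ ids ⟩ ≡ a
          i a = trans (wksBy-inst n a γ ids) (⟨ids⟩ a)

        cong-pt : ∀ {m} {γ γ′ : Sub m n} {a a′ b b′ p p′ : Sub m k} {δ δ′ : Sub m l} →
                  γ ≡ γ′ → a ≡ a′ → b ≡ b′ → p ≡ p′ → δ ≡ δ′ → pt γ a b p δ ≡ pt γ′ a′ b′ p′ δ′
        cong-pt refl refl refl refl refl = refl

        P₁-[] : ∀ {m m′} (a b p : Sub m k) (σ : Sub m′ m) →
            P₁ a b p ⟪ lifts l (lifts n σ) ⟫ ≡ P₁ (a ⟨ σ ⟩) (b ⟨ σ ⟩) (p ⟨ σ ⟩)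
        P₁-[] a b p σ = cong-pt (trans (wksBy-lifts l _ _) (cong (_⟨ wksBy l ⟩) (vars-lifts n σ)))
            (i a) (i b) (i p) (vars-lifts l _)
          where
          i : ∀ a → a ⟨ wksBy n ⟩ ⟨ wksBy l ⟩ ⟨ lifts l (lifts n σ) ⟩ ≡ a ⟨ σ ⟩ ⟨ wksBy n ⟩
              ⟨ wksBy l ⟩
          i a = trans (wksBy-lifts l _ _) (cong (_⟨ wksBy l ⟩) (wksBy-lifts n a σ))

        P₁-inst : ∀ {m} (γ : Sub m n) (a b p : Sub m k) →
            P₁ a b p ⟪ lifts l (γ ++ ids) ⟫ ≡ P₂ γ a b p
        P₁-inst γ a b p = cong-pt (trans (wksBy-lifts l _ _)
            (cong (_⟨ wksBy l ⟩) (vars-⟨++⟩ γ ids))) (i a) (i b) (i p) (vars-lifts l _)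
          where
          i : ∀ a → a ⟨ wksBy n ⟩ ⟨ wksBy l ⟩ ⟨ lifts l (γ ++ ids) ⟩ ≡ a ⟨ wksBy l ⟩
          i a = trans (wksBy-lifts l _ _)
              (cong (_⟨ wksBy l ⟩) (trans (wksBy-inst n a γ ids) (⟨ids⟩ a)))

        P₂-inst : ∀ {m} (γ : Sub m n) (a b p : Sub m k) (δ : Sub m l) →
            P₂ γ a b p ⟪ δ ++ ids ⟫ ≡ pt γ a b p δ
        P₂-inst γ a b p δ = cong-pt (i γ) (i a) (i b) (i p) (vars-⟨++⟩ δ ids)
          where
          i : ∀ {s} (a : Sub _ s) → a ⟨ wksBy l ⟩ ⟨ δ ++ ids ⟩ ≡ a
          i a = trans (wksBy-inst l a δ ids) (⟨ids⟩ a)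

        F₁ : ∀ {m} → Sub m k → Sub m k → Sub m k → Ty (n + m)
        F₁ a b p = Πs (T₁ a b p) (pfam C (P₁ a b p))

        F₁-[] : ∀ {m m′} (a b p : Sub m k) (σ : Sub m′ m) →
            F₁ a b p [ lifts n σ ]ᵀ ≡ F₁ (a ⟨ σ ⟩) (b ⟨ σ ⟩) (p ⟨ σ ⟩)
        F₁-[] a b p σ = trans (Πs-[] (T₁ a b p) _ _)
            (cong₂ Πs (T₁-[] a b p σ) (trans (pnat C _ _) (cong (pfam C) (P₁-[] a b p σ))))

        F₁-inst : ∀ {m} (γ : Sub m n) (a b p : Sub m k) →
            F₁ a b p [ γ ++ ids ]ᵀ ≡ Πs (tel γ a b p) (pfam C (P₂ γ a b p))
        F₁-inst γ a b p = trans (Πs-[] (T₁ a b p) _ _)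
            (cong₂ Πs (T₁-inst γ a b p) (trans (pnat C _ _) (cong (pfam C) (P₁-inst γ a b p))))

        module _ {m} {Θ : Ctx m} {γ a b p} (G : Θ ⊢ γ ∶ˢ Γ) (A : Θ ⊢ a ∶ˢ Φ) (B : Θ ⊢ b ∶ˢ Φ)
            (P : Θ ⊢ p ∶Id Φ ⦅ a , b ⦆) where
          tel-ok : ⊢ Θ ⧺ tel γ a b p
          tel-ok = tel-ctx G A B P

          P₂-∶ : (Θ ⧺ tel γ a b p) ⊢ᵖ P₂ γ a b p
          P₂-∶ = ptᵗ (⟨⟩-∶ˢ G w) (⟨⟩-∶ˢ A w) (⟨⟩-∶ˢ B w) (Id-subst P w)
            (subst (λ T → (Θ ⧺ tel γ a b p) ⊢ vars l ∶ᵗ T) (tel-[] _ _ _ _ _)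
                (vars-∶ᵗ (tel γ a b p) tel-ok))
            where w = wksBy-∶ˢ (tel γ a b p) tel-ok

        module _ {m} {Θ : Ctx m} {a b p} (A : Θ ⊢ a ∶ˢ Φ) (B : Θ ⊢ b ∶ˢ Φ)
            (P : Θ ⊢ p ∶Id Φ ⦅ a , b ⦆) where
          ok : ⊢ Θ ⧺ ⌜ Γ ⌝
          ok = ⌜⌝-ctx (∶ˢ-ctx A) Γ-ctx

          wₙ : (Θ ⧺ ⌜ Γ ⌝) ⊢ wksBy n ∶ˢ Θ
          wₙ = wksBy-∶ˢ ⌜ Γ ⌝ ok

          F₁-type : (Θ ⧺ ⌜ Γ ⌝) ⊢ F₁ a b p type
          F₁-type = Πs-form (T₁ a b p)
              (ptyp C (P₂-∶ (⌜⌝-vars Γ-ctx ok) (⟨⟩-∶ˢ A wₙ) (⟨⟩-∶ˢ B wₙ) (Id-subst P wₙ)))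

        M₁ : Motive Φ
        M₁ = record
          { fam = λ a b p → Πs ⌜ Γ ⌝ (F₁ a b p)
          ; nat = λ a b p σ → trans (Πs-[] ⌜ Γ ⌝ _ σ) (cong₂ Πs (⌜⌝-[] Γ σ) (F₁-[] a b p σ))
          ; typ = λ A B P → Πs-form ⌜ Γ ⌝ (F₁-type A B P) }

        module _ (d : Tm (l + (n + k))) (prem : PPremise C d) where
          body : ∀ {m} → Sub m k → Tm (l + (n + m))
          body x = d [ lifts l (lifts n x) ]

          body≡ : ∀ {m} (x : Sub m k) →
              body x ≡ at d (vars n ⟨ wksBy l ⟩) (x ⟨ wksBy n ⟩ ⟨ wksBy l ⟩) (vars l)
          body≡ x = cong (d [_]) (trans (lifts≡ l _) (cong (vars l ++_)
            (trans (cong (_⟨ wksBy l ⟩) (lifts≡ n x)) (map-++ _ (vars n) _))))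

          lams≡ : ∀ {m} (x : Sub m k) → lams n (lams l d) [ x ] ≡ lams n (lams l (body x))
          lams≡ x = trans (lams-[] n _ x) (cong (lams n) (lams-[] l d _))

          module _ {m} {Θ : Ctx m} {x} (X : Θ ⊢ x ∶ˢ Φ) where
            private
              R = rfls-type (elim Φ-ctx) X
              w = wₙ X X R

            body-∶ : ((Θ ⧺ ⌜ Γ ⌝) ⧺ T₁ x x (rfls x)) ⊢ body x ∶ pfam C (P₁ x x (rfls x))
            body-∶ = subst (λ t → ((Θ ⧺ ⌜ Γ ⌝) ⧺ T₁ x x (rfls x)) ⊢ t ∶ pfam C (P₁ x x (rfls x)))
              (sym (body≡ x))
              (prem (γ-∶ q) (a-∶ q)
                (subst (λ T → ((Θ ⧺ ⌜ Γ ⌝) ⧺ T₁ x x (rfls x)) ⊢ vars l ∶ᵗ T)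
                    (cong (tel (vars n ⟨ wksBy l ⟩) y y) r≡) (δ-∶ q))
                ∶≡ cong (λ z → pfam C (pt (vars n ⟨ wksBy l ⟩) y y z (vars l))) (sym r≡))
              where
              q = P₂-∶ (⌜⌝-vars Γ-ctx (ok X X R)) (⟨⟩-∶ˢ X w) (⟨⟩-∶ˢ X w) (Id-subst R w)
              y = x ⟨ wksBy n ⟩ ⟨ wksBy l ⟩
              r≡ : rfls x ⟨ wksBy n ⟩ ⟨ wksBy l ⟩ ≡ rfls (x ⟨ wksBy n ⟩ ⟨ wksBy l ⟩)
              r≡ = trans (cong (_⟨ wksBy l ⟩) (rfls-⟨⟩ x (wksBy n))) (rfls-⟨⟩ _ _)

            lams-∶ : Θ ⊢ lams n (lams l d) [ x ] ∶ fam M₁ x x (rfls x)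
            lams-∶ = subst (λ t → Θ ⊢ t ∶ fam M₁ x x (rfls x)) (sym (lams≡ x))
              (lams-intro ⌜ Γ ⌝ (lams-intro (T₁ x x (rfls x)) body-∶))

          J-∶ : ∀ {m} {Θ : Ctx m} {P : Pt n k l m} → Θ ⊢ᵖ P → Θ ⊢ JP d P ∶ pfam C P
          J-∶ {P = pt γ a b p δ} (ptᵗ G A B Q D) =
            apps-elim (ptyp C (P₂-∶ G A B Q))
              (apps-elim (F₁-type A B Q) (J-type (elim Φ-ctx) M₁ _ lams-∶ A B Q)
                  (to⌜⌝ G) ∶≡ F₁-inst γ a b p) D
            ∶≡ trans (pnat C _ _) (cong (pfam C) (P₂-inst γ a b p δ))

          J-≐ : ∀ {m} {Θ : Ctx m} {γ x δ} → Θ ⊢ γ ∶ˢ Γ → Θ ⊢ x ∶ˢ Φ → Θ ⊢ δ ∶ᵗ tel γ x x (rfls x) →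
                Θ ⊢ JP d (diag γ x δ) ≐ at d γ x δ ∶ pfam C (diag γ x δ)
          J-≐ {m} {Θ} {γ = γ} {x} {δ} G X D = ≐-trans
            (apps-cong (ptyp C (P₂-∶ G X X R))
              (≐-trans (apps-cong (F₁-type X X R) (J-β (elim Φ-ctx) M₁ _ lams-∶ X ▷≐ lams≡ x)
                (to⌜⌝ G))
                (apps-β (lams-intro (T₁ x x (rfls x)) (body-∶ X)) (to⌜⌝ G) ▷≐ lams-[] l _ _) ≐≡
                    F₁-inst γ x x (rfls x)) D)
            (apps-β inner-∶ D ▷≐ e) ≐≡ trans (pnat C _ _) (cong (pfam C) (P₂-inst γ x x (rfls x) δ))
            where
            R = rfls-type (elim Φ-ctx) X
            inner≡ : body x [ lifts l (γ ++ ids) ] ≡ at d (γ ⟨ wksBy l ⟩) (x ⟨ wksBy l ⟩) (vars l)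
            inner≡ = trans ([]-[] d _ _)
              (cong (d [_]) (trans (cong (lifts l (lifts n x) ⟨_⟩) (lifts≡ l (γ ++ ids)))
              (trans (lifts-⟨++⟩ (lifts n x) (vars l) _) (cong (vars l ++_)
                (trans (cong (lifts n x ⟨_⟩) (map-++ _ γ ids))
                  (trans (lifts-⟨++⟩ x _ _) (cong (γ ⟨ wksBy l ⟩ ++_)
                  (cong (x ⟨_⟩) (ids-⟨⟩ (wksBy l))))))))))
            inner-∶ : (Θ ⧺ tel γ x x (rfls x)) ⊢ body x [ lifts l (γ ++ ids) ] ∶ pfam C
                (P₂ γ x x (rfls x))
            inner-∶ = subst (λ t → (Θ ⧺ tel γ x x (rfls x)) ⊢ t ∶ pfam C (P₂ γ x x (rfls x)))
              (sym inner≡)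
              (prem (γ-∶ q) (a-∶ q)
                (subst (λ T → (Θ ⧺ tel γ x x (rfls x)) ⊢ vars l ∶ᵗ T)
                    (cong (λ z → tel _ _ _ z) (rfls-⟨⟩ x _)) (δ-∶ q))
                ∶≡ cong (λ z → pfam C (pt _ _ _ z _)) (sym (rfls-⟨⟩ x _)))
              where q = P₂-∶ G X X R
            e : body x [ lifts l (γ ++ ids) ] [ δ ++ ids ] ≡ at d γ x δ
            e = trans (cong (_[ δ ++ ids ]) inner≡) (trans ([]-[] d _ _) (cong (d [_])
              (trans (map-++ _ (vars l) _) (cong₂ _++_ (vars-⟨++⟩ δ ids)
                (trans (map-++ _ (γ ⟨ wksBy l ⟩) _) (cong₂ _++_ (i γ) (i x)))))))
              where
              i : ∀ {s} (a : Sub m s) → a ⟨ wksBy l ⟩ ⟨ δ ++ ids ⟩ ≡ a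
              i a = trans (wksBy-inst l a δ ids) (⟨ids⟩ a)

      JP-type : (d : Tm (l + (n + k))) → PPremise C d → ∀ {m} {Θ : Ctx m} {P : Pt n k l m} →
          Θ ⊢ᵖ P → Θ ⊢ JP d P ∶ pfam C P
      JP-type = J-∶

      JP-β : (d : Tm (l + (n + k))) → PPremise C d → ∀ {m} {Θ : Ctx m} {γ x δ} → Θ ⊢ γ ∶ˢ Γ →
             Θ ⊢ x ∶ˢ Φ → Θ ⊢ δ ∶ᵗ tel γ x x (rfls x) →
             Θ ⊢ JP d (diag γ x δ) ≐ at d γ x δ ∶ pfam C (diag γ x δ)
      JP-β = J-≐

module Composition {r j : Level} {S : TypeTheory r j} (M : ML₂ S) where
  open TypeTheory S
  open ML₂ M
  open Substitution S
  open Identity M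
  open Motive
  open Elim
  open Telescopes M
  open PostContexts M

  private
    η : ∀ {m s} (σ : Sub m (suc s)) → head σ ∷ tail σ ≡ σ
    η (_ ∷ _) = refl

    head-⟨⟩ : ∀ {m m′ s} (σ : Sub m (suc s)) (τ : Sub m′ m) → head σ [ τ ] ≡ head (σ ⟨ τ ⟩)
    head-⟨⟩ (_ ∷ _) τ = refl

    tail-⟨⟩ : ∀ {m m′ s} (σ : Sub m (suc s)) (τ : Sub m′ m) → tail σ ⟨ τ ⟩ ≡ tail (σ ⟨ τ ⟩)
    tail-⟨⟩ (_ ∷ _) τ = refl

  ∶ˢ-tail : ∀ {m s} {Θ : Ctx m} {Ψ : Ctx s} {B σ} → Θ ⊢ σ ∶ˢ Ψ ▷ B → Θ ⊢ tail σ ∶ˢ Ψ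
  ∶ˢ-tail (s ∷ _) = s

  ∶ˢ-head : ∀ {m s} {Θ : Ctx m} {Ψ : Ctx s} {B σ} → Θ ⊢ σ ∶ˢ Ψ ▷ B → Θ ⊢ head σ ∶ B [ tail σ ]ᵀ
  ∶ˢ-head (_ ∷ (_ , t)) = t

  Id-tail : ∀ {m s} {Θ : Ctx m} {Ψ : Ctx s} {B p a b} → Θ ⊢ p ∶Id Ψ ▷ B ⦅ a , b ⦆ →
      Θ ⊢ tail p ∶Id Ψ ⦅ tail a , tail b ⦆
  Id-tail (p ∷ _) = p

  Id-head : ∀ {m s} {Θ : Ctx m} {Ψ : Ctx s} {B p a b} → Θ ⊢ p ∶Id Ψ ▷ B ⦅ a , b ⦆ →
            Θ ⊢ head p ∶ Id (B [ tail a ]ᵀ) (head a) (tr (tail a) (tail b) (tail p) (head b))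
  Id-head (_ ∷ q) = q

  Id≐-tail : ∀ {m s} {Θ : Ctx m} {Ψ : Ctx s} {B p q a b} → Θ ⊢ p ≐ q ∶Id Ψ ▷ B ⦅ a , b ⦆ →
      Θ ⊢ tail p ≐ tail q ∶Id Ψ ⦅ tail a , tail b ⦆
  Id≐-tail (p ∷ _) = p

  Id≐-head : ∀ {m s} {Θ : Ctx m} {Ψ : Ctx s} {B p q a b} → Θ ⊢ p ≐ q ∶Id Ψ ▷ B ⦅ a , b ⦆ →
            Θ ⊢ head p ≐ head q ∶ Id (B [ tail a ]ᵀ) (head a)
                (tr (tail a) (tail b) (tail p) (head b))
  Id≐-head (_ ∷ q) = q

  module IdElim {n k l} {Γ : Ctx n} {Φ : Ctx k} (T : Post Γ Φ l) where
    open Post T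
    open ElimP T

    record Fam (s : ℕ) : Set r where
      field
        el  : ∀ {m} → Pt n k l m → Sub m s
        el-⟨⟩ : ∀ {m m′} (P : Pt n k l m) (σ : Sub m′ m) → el P ⟨ σ ⟩ ≡ el (P ⟪ σ ⟫)
    open Fam public

    _∶Fam_ : ∀ {s} → Fam s → Ctx s → Set (r ⊔ j)
    u ∶Fam Ψ = ∀ {m} {Θ : Ctx m} {P} → Θ ⊢ᵖ P → Θ ⊢ el u P ∶ˢ Ψ

    tailF : ∀ {s} → Fam (suc s) → Fam s
    tailF u = record { el = λ P → tail (el u P) ; el-⟨⟩ = λ P σ → trans (tail-⟨⟩ (el u P) σ)
        (cong tail (el-⟨⟩ u P σ)) }

    record Elims {s} (Ψ : Ctx s) (u v : Fam s) (ds : Sub (l + (n + k)) s) : Set (r ⊔ j) where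
      field
        Js-type : ∀ {m} {Θ : Ctx m} {P} → Θ ⊢ᵖ P → Θ ⊢ JPs ds P ∶Id Ψ ⦅ el u P , el v P ⦆
        Js-β : ∀ {m} {Θ : Ctx m} {γ x δ} → Θ ⊢ γ ∶ˢ Γ → Θ ⊢ x ∶ˢ Φ → Θ ⊢ δ ∶ᵗ tel γ x x (rfls x) →
               Θ ⊢ JPs ds (diag γ x δ) ≐ ds ⟨ δ ++ (γ ++ x) ⟩ ∶Id Ψ
                   ⦅ el u (diag γ x δ) , el v (diag γ x δ) ⦆
    open Elims

    elims : ∀ {s} {Ψ : Ctx s} → ⊢ Ψ → (u v : Fam s) → u ∶Fam Ψ → v ∶Fam Ψ →
            (ds : Sub (l + (n + k)) s) →
            (∀ {m} {Θ : Ctx m} {γ x δ} → Θ ⊢ γ ∶ˢ Γ → Θ ⊢ x ∶ˢ Φ → Θ ⊢ δ ∶ᵗ tel γ x x (rfls x) →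
              Θ ⊢ ds ⟨ δ ++ (γ ++ x) ⟩ ∶Id Ψ ⦅ el u (diag γ x δ) , el v (diag γ x δ) ⦆) →
            Elims Ψ u v ds
    elims [] u v U V [] prem = record
      { Js-type = λ {_} {Θ} {P} Q → t Θ (el u P) (el v P) (∶ˢ-ctx (γ-∶ Q))
      ; Js-β = λ {_} {Θ} {γ} {x} {δ} G X D →
          e Θ (el u (diag γ x δ)) (el v (diag γ x δ)) (∶ˢ-ctx G) }
      where
      t : ∀ {m} (Θ : Ctx m) (a b : Sub m zero) → ⊢ Θ → Θ ⊢ [] ∶Id [] ⦅ a , b ⦆
      t Θ [] [] g = [] g
      e : ∀ {m} (Θ : Ctx m) (a b : Sub m zero) → ⊢ Θ → Θ ⊢ [] ≐ [] ∶Id [] ⦅ a , b ⦆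
      e Θ [] [] g = [] g
    elims {Ψ = Ψ ▷ B} (ψ ▷ β) u v U V (d ∷ ds) prem = record
      { Js-type = λ {_} {Θ} {P} Q →
          subst₂ (λ a b → Θ ⊢ JPs (d ∷ ds) P ∶Id Ψ ▷ B ⦅ a , b ⦆) (η (el u P)) (η (el v P))
          (Js-type ih Q ∷ JP-type C d prem′ Q)
      ; Js-β = λ {_} {Θ} {γ} {x} {δ} G X D →
          subst₂ (λ a b → Θ ⊢ JPs (d ∷ ds) (diag γ x δ) ≐
          (d ∷ ds) ⟨ δ ++ (γ ++ x) ⟩ ∶Id Ψ ▷ B ⦅ a , b ⦆)
          (η (el u (diag γ x δ))) (η (el v (diag γ x δ)))
          (Js-β ih G X D ∷ JP-β C d prem′ G X D) }
      where
      U′ : tailF u ∶Fam Ψ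
      U′ Q = ∶ˢ-tail (U Q)
      V′ : tailF v ∶Fam Ψ
      V′ Q = ∶ˢ-tail (V Q)
      ih : Elims Ψ (tailF u) (tailF v) ds
      ih = elims ψ (tailF u) (tailF v) U′ V′ ds (λ G X D → Id-tail (prem G X D))
      C : PMotive
      C = record
        { pfam = λ P → Id (B [ tail (el u P) ]ᵀ) (head (el u P))
            (tr (tail (el u P)) (tail (el v P)) (JPs ds P) (head (el v P)))
        ; pnat = λ P σ → trans (Id-[] _ _ _ σ) (cong₃ Id
            (trans ([]-[]ᵀ B _ σ) (cong (B [_]ᵀ) (el-⟨⟩ (tailF u) P σ)))
            (trans (head-⟨⟩ (el u P) σ) (cong head (el-⟨⟩ u P σ)))
            (trans (tr-[] (tail (el u P)) (tail (el v P)) (JPs ds P) (head (el v P)) σ)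
              (cong₄ tr (el-⟨⟩ (tailF u) P σ) (el-⟨⟩ (tailF v) P σ)
              (JPs-[] ds P σ) (trans (head-⟨⟩ (el v P) σ) (cong head (el-⟨⟩ v P σ))))))
        ; ptyp = λ Q → Id-form (∶ˢ-head (U Q))
            (Transport.tr-type (elim ψ) β (U′ Q) (V′ Q) (Js-type ih Q) (∶ˢ-head (V Q)))
        }
      prem′ : PPremise C d
      prem′ {Θ = Θ} {γ} {x} {δ} G X D = conv
        (last≐ (lem (U Q)) (lem (V Q)) (Id≐-sym (U′ Q) (V′ Q) (Js-β ih G X D)))
        (Id-head (prem G X D))
        where
        Q = diagᵗ G X D
        lem : ∀ {σ} → Θ ⊢ σ ∶ˢ Ψ ▷ B → Θ ⊢ head σ ∷ tail σ ≐ head σ ∷ tail σ ∶ˢ Ψ ▷ B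
        lem {σ} s = ≐ˢ-refl (subst (λ σ → Θ ⊢ σ ∶ˢ Ψ ▷ B) (sym (η σ)) s)

    -- Elements of an identity context which agree on reflexivities agree.

    private
      ĝ : Pt n k l (l + (n + k))
      ĝ = diag (vars n ⟨ wksBy l ⟩) (wksBy n ⟨ wksBy l ⟩) (vars l)

      ĝ-at : ∀ {m} (γ : Sub m n) (x : Sub m k) (δ : Sub m l) → ĝ ⟪ δ ++ (γ ++ x) ⟫ ≡ diag γ x δ
      ĝ-at γ x δ = c (trans (wksBy-inst l (vars n) δ _) (vars-⟨++⟩ γ x)) e
        (trans (rfls-⟨⟩ _ _) (cong rfls e)) (vars-⟨++⟩ δ _)
        where
        e = trans (wksBy-inst l (wksBy n) δ _) (wksBy-⟨++⟩ γ x)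
        c : ∀ {m} {γ γ′ : Sub m n} {a a′ p p′ : Sub m k} {δ δ′ : Sub m l} →
            γ ≡ γ′ → a ≡ a′ → p ≡ p′ → δ ≡ δ′ → pt γ a a p δ ≡ pt γ′ a′ a′ p′ δ′
        c refl refl refl refl = refl

    uniq : ∀ {s} {Ψ : Ctx s} → ⊢ Ψ → (u v : Fam s) → u ∶Fam Ψ → v ∶Fam Ψ → (t t′ : Fam s) →
           (∀ {m} {Θ : Ctx m} {P} → Θ ⊢ᵖ P → Θ ⊢ el t P ∶Id Ψ ⦅ el u P , el v P ⦆) →
           (∀ {m} {Θ : Ctx m} {P} → Θ ⊢ᵖ P → Θ ⊢ el t′ P ∶Id Ψ ⦅ el u P , el v P ⦆) →
           (∀ {m} {Θ : Ctx m} {γ x δ} → Θ ⊢ γ ∶ˢ Γ → Θ ⊢ x ∶ˢ Φ → Θ ⊢ δ ∶ᵗ tel γ x x (rfls x) →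
             Θ ⊢ el t (diag γ x δ) ≐ el t′
                 (diag γ x δ) ∶Id Ψ ⦅ el u (diag γ x δ) , el v (diag γ x δ) ⦆) →
           ∀ {m} {Θ : Ctx m} {P} → Θ ⊢ᵖ P → Θ ⊢ el t P ≐ el t′ P ∶Id Ψ ⦅ el u P , el v P ⦆
    uniq [] u v U V t t′ tt tt′ prem {Θ = Θ} {P} Q = e Θ (el u P) (el v P) (el t P) (el t′ P)
        (∶ˢ-ctx (γ-∶ Q))
      where
      e : ∀ {m} (Θ : Ctx m) (a b c d : Sub m zero) → ⊢ Θ → Θ ⊢ c ≐ d ∶Id [] ⦅ a , b ⦆
      e Θ [] [] [] [] g = [] g
    uniq {Ψ = Ψ ▷ B} (ψ ▷ β) u v U V t t′ tt tt′ prem {Θ = Θ} {P} Q =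
      subst₂ (λ p q → Θ ⊢ p ≐ q ∶Id Ψ ▷ B ⦅ el u P , el v P ⦆) (η (el t P)) (η (el t′ P))
        (subst₂ (λ a b → Θ ⊢ head (el t P) ∷ tail (el t P) ≐ head (el t′ P) ∷ tail
          (el t′ P) ∶Id Ψ ▷ B ⦅ a , b ⦆)
          (η (el u P)) (η (el v P))
          (ih Q ∷ discrete (Id-head (tt Q)) (head′ Q) (JP-type C d prem′ Q)))
      where
      U′ : tailF u ∶Fam Ψ
      U′ Q = ∶ˢ-tail (U Q)
      V′ : tailF v ∶Fam Ψ
      V′ Q = ∶ˢ-tail (V Q)
      ih : ∀ {m} {Θ : Ctx m} {P} → Θ ⊢ᵖ P →
          Θ ⊢ tail (el t P) ≐ tail (el t′ P) ∶Id Ψ ⦅ tail (el u P) , tail (el v P) ⦆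
      ih = uniq ψ (tailF u) (tailF v) U′ V′ (tailF t) (tailF t′) (λ Q → Id-tail (tt Q))
             (λ Q → Id-tail (tt′ Q))
             (λ G X D → Id≐-tail (prem G X D))
      A : ∀ {m} → Pt n k l m → Ty m
      A P = Id (B [ tail (el u P) ]ᵀ) (head (el u P))
          (tr (tail (el u P)) (tail (el v P)) (tail (el t P)) (head (el v P)))
      A-[] : ∀ {m m′} (P : Pt n k l m) (σ : Sub m′ m) → A P [ σ ]ᵀ ≡ A (P ⟪ σ ⟫)
      A-[] P σ = trans (Id-[] _ _ _ σ) (cong₃ Id
            (trans ([]-[]ᵀ B _ σ) (cong (B [_]ᵀ) (el-⟨⟩ (tailF u) P σ)))
            (trans (head-⟨⟩ (el u P) σ) (cong head (el-⟨⟩ u P σ)))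
            (trans (tr-[] (tail (el u P)) (tail (el v P)) (tail (el t P)) (head (el v P)) σ)
              (cong₄ tr (el-⟨⟩ (tailF u) P σ) (el-⟨⟩ (tailF v) P σ)
              (el-⟨⟩ (tailF t) P σ) (trans (head-⟨⟩ (el v P) σ) (cong head (el-⟨⟩ v P σ))))))
      head′ : ∀ {m} {Θ : Ctx m} {P} → Θ ⊢ᵖ P → Θ ⊢ head (el t′ P) ∶ A P
      head′ {Θ = Θ} {P} Q = conv (≐type-sym (last≐ (lem (U Q)) (lem (V Q)) (ih Q)))
          (Id-head (tt′ Q))
        where
        lem : ∀ {σ} → Θ ⊢ σ ∶ˢ Ψ ▷ B → Θ ⊢ head σ ∷ tail σ ≐ head σ ∷ tail σ ∶ˢ Ψ ▷ B
        lem {σ} s = ≐ˢ-refl (subst (λ σ → Θ ⊢ σ ∶ˢ Ψ ▷ B) (sym (η σ)) s)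
      C : PMotive
      C = record
        { pfam = λ P → Id (A P) (head (el t P)) (head (el t′ P))
        ; pnat = λ P σ → trans (Id-[] _ _ _ σ) (cong₃ Id (A-[] P σ)
            (trans (head-⟨⟩ (el t P) σ) (cong head (el-⟨⟩ t P σ)))
            (trans (head-⟨⟩ (el t′ P) σ) (cong head (el-⟨⟩ t′ P σ))))
        ; ptyp = λ Q → Id-form (Id-head (tt Q)) (head′ Q)
        }
      d : Tm (l + (n + k))
      d = rfl (head (el t ĝ))
      d-at : ∀ {m} (γ : Sub m n) (x : Sub m k) (δ : Sub m l) →
          at d γ x δ ≡ rfl (head (el t (diag γ x δ)))
      d-at γ x δ = trans (rfl-[] _ _)
          (cong rfl (trans (head-⟨⟩ (el t ĝ) _)
          (cong head (trans (el-⟨⟩ t ĝ _) (cong (el t) (ĝ-at γ x δ))))))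
      prem′ : PPremise C d
      prem′ {Θ = Θ} {γ} {x} {δ} G X D = subst (λ z → Θ ⊢ z ∶ pfam C (diag γ x δ)) (sym (d-at γ x δ))
        (conv (Id-cong (≐type-refl (term-type h)) (≐-refl h) (Id≐-head (prem G X D))) (Id-intro h))
        where h = Id-head (tt (diagᵗ G X D))

module CellOperations {r j : Level} {S : TypeTheory r j} (M : ML₂ S) where
  open TypeTheory S
  open ML₂ M
  open Substitution S
  open Identity M
  open Motive
  open Elim
  open Telescopes M
  open PostContexts M
  open Composition M

  noPost : ∀ {n k} {Γ : Ctx n} {Φ : Ctx k} → ⊢ Γ → ⊢ Φ → Post Γ Φ zero
  noPost g f = record { Γ-ctx = g ; Φ-ctx = f ; tel = λ _ _ _ _ → [] ; tel-[] = λ _ _ _ _ _ → refl ;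
      tel-ctx = λ G _ _ _ → ∶ˢ-ctx G }

  -- the post-context Id_Φ(x₀(γ) , a)
  idPost : ∀ {n k} {Γ : Ctx n} {Φ : Ctx k} {x₀ : Sub n k} → Γ ⊢ x₀ ∶ˢ Φ → Post Γ Φ k
  idPost {Φ = Φ} {x₀} X₀ = record
      { Γ-ctx = ∶ˢ-ctx X₀ ; Φ-ctx = ∶ˢ-cod X₀ ; tel = λ γ a b p → IdTel Φ (x₀ ⟨ γ ⟩) a
    ; tel-[] = λ γ a b p σ → trans (IdTel-[] Φ _ _ σ)
        (cong (λ z → IdTel Φ z (a ⟨ σ ⟩)) (⟨⟩-⟨⟩ x₀ γ σ))
    ; tel-ctx = λ G A _ _ → IdTel-ctx (∶ˢ-cod X₀) (⟨⟩-∶ˢ X₀ G) A }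

  opaque
    -- h•(p) = J_{r(h x)}(a , b , p)
    bullet : ∀ {k s m} → Sub k s → Sub m k → Sub m k → Sub m k → Sub m s
    bullet h a b p = JPs {zero} {l = zero} (rfls h) (pt [] a b p [])

    -- q ∘ p for p : Id_Φ(x , y) and q : Id_Φ(y , z), by elimination on q with
    -- post-context (x : Φ , p : Id_Φ(x , y)) and r(y) ∘ p = p
    comp : ∀ {k m} → Sub m k → Sub m k → Sub m k → Sub m k → Sub m k → Sub m k
    comp {k} x y z q p = JPs (vars k) (pt x y z q p)

    bullet-[] : ∀ {k s m m′} (h : Sub k s) (a b p : Sub m k) (σ : Sub m′ m) →
                bullet h a b p ⟨ σ ⟩ ≡ bullet h (a ⟨ σ ⟩) (b ⟨ σ ⟩) (p ⟨ σ ⟩)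
    bullet-[] h a b p σ = JPs-[] {zero} {l = zero} (rfls h) (pt [] a b p []) σ

    comp-[] : ∀ {k m m′} (x y z q p : Sub m k) (σ : Sub m′ m) →
              comp x y z q p ⟨ σ ⟩ ≡ comp (x ⟨ σ ⟩) (y ⟨ σ ⟩) (z ⟨ σ ⟩) (q ⟨ σ ⟩) (p ⟨ σ ⟩)
    comp-[] {k} x y z q p σ = JPs-[] (vars k) (pt x y z q p) σ

  module _ {k s} {Φ : Ctx k} {Ψ : Ctx s} {h : Sub k s} (H : Φ ⊢ h ∶ˢ Ψ) where
    private
      T : Post [] Φ zero
      T = noPost [] (∶ˢ-ctx H)
      open ElimP T
      open IdElim T

      src tgt : Fam s
      src = record { el = λ P → h ⟨ Pt.a P ⟩ ; el-⟨⟩ = λ P σ → ⟨⟩-⟨⟩ h _ σ }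
      tgt = record { el = λ P → h ⟨ Pt.b P ⟩ ; el-⟨⟩ = λ P σ → ⟨⟩-⟨⟩ h _ σ }

      El = elims (∶ˢ-cod H) src tgt (λ Q → ⟨⟩-∶ˢ H (a-∶ Q)) (λ Q → ⟨⟩-∶ˢ H (b-∶ Q)) (rfls h)
            λ { {Θ = Θ} {γ = []} {x} {[]} G X D →
              subst (λ z → Θ ⊢ z ∶Id Ψ ⦅ h ⟨ x ⟩ , h ⟨ x ⟩ ⦆) (sym (rfls-⟨⟩ h x))
                (rfls-type (elim (∶ˢ-cod H)) (⟨⟩-∶ˢ H X)) }

    opaque
      unfolding bullet

      bullet-∶ : ∀ {m} {Θ : Ctx m} {a b p} → Θ ⊢ a ∶ˢ Φ → Θ ⊢ b ∶ˢ Φ → Θ ⊢ p ∶Id Φ ⦅ a , b ⦆ →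
                 Θ ⊢ bullet h a b p ∶Id Ψ ⦅ h ⟨ a ⟩ , h ⟨ b ⟩ ⦆
      bullet-∶ A B P = Elims.Js-type El (ptᵗ ([] (∶ˢ-ctx A)) A B P ([] (∶ˢ-ctx A)))

      bullet-β : ∀ {m} {Θ : Ctx m} {x} → Θ ⊢ x ∶ˢ Φ →
                 Θ ⊢ bullet h x x (rfls x) ≐ rfls (h ⟨ x ⟩) ∶Id Ψ ⦅ h ⟨ x ⟩ , h ⟨ x ⟩ ⦆
      bullet-β {Θ = Θ} {x} X = subst
        (λ z → Θ ⊢ bullet h x x (rfls x) ≐ z ∶Id Ψ ⦅ h ⟨ x ⟩ , h ⟨ x ⟩ ⦆) (rfls-⟨⟩ h x)
        (Elims.Js-β El ([] (∶ˢ-ctx X)) X ([] (∶ˢ-ctx X)))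

    bullet-cong : ∀ {m} {Θ : Ctx m} {a a′ b b′ p p′} → Θ ⊢ a ≐ a′ ∶ˢ Φ → Θ ⊢ b ≐ b′ ∶ˢ Φ →
                  Θ ⊢ p ≐ p′ ∶Id Φ ⦅ a , b ⦆ →
                  Θ ⊢ bullet h a b p ≐ bullet h a′ b′ p′ ∶Id Ψ ⦅ h ⟨ a ⟩ , h ⟨ b ⟩ ⦆
    bullet-cong {Θ = Θ} {a} {a′} {b} {b′} {p} {p′} A B P =
      subst₂ (λ u v → Θ ⊢ bullet h a b p ≐ bullet h a′ b′ p′ ∶Id Ψ ⦅ u , v ⦆)
        (trans (⟨⟩-⟨⟩ h x̂ _) (cong (h ⟨_⟩) (x̂-⟨⟩ a b p)))
            (trans (⟨⟩-⟨⟩ h ŷ _) (cong (h ⟨_⟩) (ŷ-⟨⟩ a b p)))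
        (subst₂ (λ t t′ → Θ ⊢ t ≐ t′ ∶Id Ψ
          ⦅ h ⟨ x̂ ⟩ ⟨ p ++ (b ++ a) ⟩ , h ⟨ ŷ ⟩ ⟨ p ++ (b ++ a) ⟩ ⦆) (e a b p) (e a′ b′ p′)
          (Id-subst-≐ (bullet-∶ x̂-∶ ŷ-∶ p̂-∶) (point-≐ A B P)))
      where
      open Generic (∶ˢ-ctx H)
      e : ∀ a b p → bullet h x̂ ŷ p̂ ⟨ p ++ (b ++ a) ⟩ ≡ bullet h a b p
      e a b p = trans (bullet-[] h x̂ ŷ p̂ _)
          (cong₃ (bullet h) (x̂-⟨⟩ a b p) (ŷ-⟨⟩ a b p) (p̂-⟨⟩ a b p))

  module _ {k} {Φ : Ctx k} (f : ⊢ Φ) where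
    private
      T : Post Φ Φ k
      T = idPost (ids-∶ˢ f)
      open ElimP T
      open IdElim T

      src tgt : Fam k
      src = record { el = Pt.γ ; el-⟨⟩ = λ P σ → refl }
      tgt = record { el = Pt.b ; el-⟨⟩ = λ P σ → refl }

      from : ∀ {m} {Θ : Ctx m} {x y p} → Θ ⊢ p ∶ᵗ IdTel Φ (ids ⟨ x ⟩) y → Θ ⊢ p ∶Id Φ ⦅ x , y ⦆
      from {Θ = Θ} {x} {y} {p} P = subst (λ z → Θ ⊢ p ∶Id Φ ⦅ z , y ⦆) (ids-⟨⟩ x) (toId P)

      to : ∀ {m} {Θ : Ctx m} {x y p} → Θ ⊢ p ∶Id Φ ⦅ x , y ⦆ → Θ ⊢ p ∶ᵗ IdTel Φ (ids ⟨ x ⟩) y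
      to {Θ = Θ} {x} {y} {p} P = subst (λ z → Θ ⊢ p ∶ᵗ IdTel Φ z y) (sym (ids-⟨⟩ x)) (fromId P)

      El = elims f src tgt γ-∶ b-∶ (vars k)
            λ {_} {Θ} {γ} {x} {δ} G X D →
                subst (λ z → Θ ⊢ z ∶Id Φ ⦅ γ , x ⦆) (sym (vars-⟨++⟩ δ _)) (from D)

    opaque
      unfolding comp

      comp-∶ : ∀ {m} {Θ : Ctx m} {x y z q p} → Θ ⊢ x ∶ˢ Φ → Θ ⊢ y ∶ˢ Φ → Θ ⊢ z ∶ˢ Φ →
               Θ ⊢ q ∶Id Φ ⦅ y , z ⦆ → Θ ⊢ p ∶Id Φ ⦅ x , y ⦆ → Θ ⊢ comp x y z q p ∶Id Φ ⦅ x , z ⦆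
      comp-∶ X Y Z Q P = Elims.Js-type El (ptᵗ X Y Z Q (to P))

      comp-β : ∀ {m} {Θ : Ctx m} {x y p} → Θ ⊢ x ∶ˢ Φ → Θ ⊢ y ∶ˢ Φ → Θ ⊢ p ∶Id Φ ⦅ x , y ⦆ →
               Θ ⊢ comp x y y (rfls y) p ≐ p ∶Id Φ ⦅ x , y ⦆
      comp-β {Θ = Θ} {x} {y} {p} X Y P = subst (λ z → Θ ⊢ comp x y y (rfls y) p ≐ z ∶Id Φ ⦅ x , y ⦆)
        (vars-⟨++⟩ p _)
        (Elims.Js-β El X Y (to P))

    -- congruence, via the generic context (x y : Φ , p : Id (x , y) , z : Φ , q : Id (y , z))
    comp-cong : ∀ {m} {Θ : Ctx m} {x x′ y y′ z z′ q q′ p p′} →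
                Θ ⊢ x ≐ x′ ∶ˢ Φ → Θ ⊢ y ≐ y′ ∶ˢ Φ → Θ ⊢ z ≐ z′ ∶ˢ Φ →
                Θ ⊢ q ≐ q′ ∶Id Φ ⦅ y , z ⦆ → Θ ⊢ p ≐ p′ ∶Id Φ ⦅ x , y ⦆ →
                Θ ⊢ comp x y z q p ≐ comp x′ y′ z′ q′ p′ ∶Id Φ ⦅ x , z ⦆
    comp-cong {Θ = Θ} {x} {x′} {y} {y′} {z} {z′} {q} {q′} {p} {p′} X Y Z Q P =
      subst₂ (λ u v → Θ ⊢ comp x y z q p ≐ comp x′ y′ z′ q′ p′ ∶Id Φ ⦅ u , v ⦆) (e₁ x y z q p)
        (e₃ x y z q p)
        (subst₂ (λ t t′ → Θ ⊢ t ≐ t′ ∶Id Φ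
          ⦅ x₁ ⟨ q ++ (z ++ (p ++ (y ++ x))) ⟩ , z₁ ⟨ q ++ (z ++ (p ++ (y ++ x))) ⟩ ⦆)
          (e x y z q p) (e x′ y′ z′ q′ p′)
          (Id-subst-≐ (comp-∶ X₁ Y₁ Z₁ Q₁ P₁) s))
      where
      open Generic f
      w : ∀ {n} → Sub (k + n) n
      w = wksBy k
      ok₁ : ⊢ I-ctx ⧺ ⌜ Φ ⌝
      ok₁ = ⌜⌝-ctx I-ok f
      W₁ = wksBy-∶ˢ ⌜ Φ ⌝ ok₁
      Yᵢ : (I-ctx ⧺ ⌜ Φ ⌝) ⊢ ŷ ⟨ w ⟩ ∶ˢ Φ
      Yᵢ = ⟨⟩-∶ˢ ŷ-∶ W₁
      Zᵢ : (I-ctx ⧺ ⌜ Φ ⌝) ⊢ vars k ∶ˢ Φ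
      Zᵢ = ⌜⌝-vars f ok₁
      ok₂ : ⊢ (I-ctx ⧺ ⌜ Φ ⌝) ⧺ IdTel Φ (ŷ ⟨ w ⟩) (vars k)
      ok₂ = IdTel-ctx f Yᵢ Zᵢ
      W₂ = wksBy-∶ˢ (IdTel Φ (ŷ ⟨ w ⟩) (vars k)) ok₂
      x₁ y₁ z₁ q₁ p₁ : Sub (k + (k + (k + (k + k)))) k
      x₁ = x̂ ⟨ w ⟩ ⟨ w ⟩
      y₁ = ŷ ⟨ w ⟩ ⟨ w ⟩
      z₁ = vars k ⟨ w ⟩
      q₁ = vars k
      p₁ = p̂ ⟨ w ⟩ ⟨ w ⟩
      X₁ = ⟨⟩-∶ˢ (⟨⟩-∶ˢ x̂-∶ W₁) W₂
      Y₁ = ⟨⟩-∶ˢ Yᵢ W₂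
      Z₁ = ⟨⟩-∶ˢ Zᵢ W₂
      Q₁ = IdTel-vars ok₂
      P₁ = Id-subst (Id-subst p̂-∶ W₁) W₂
      module _ {m} (x y z q p : Sub m k) where
        σ : Sub m (k + (k + (k + (k + k))))
        σ = q ++ (z ++ (p ++ (y ++ x)))
        i : ∀ (u : Sub (k + (k + k)) k) → u ⟨ w ⟩ ⟨ w ⟩ ⟨ σ ⟩ ≡ u ⟨ p ++ (y ++ x) ⟩
        i u = trans (wksBy-inst k _ q _) (wksBy-inst k u z _)
        e₁ : x₁ ⟨ σ ⟩ ≡ x
        e₁ = trans (i x̂) (x̂-⟨⟩ x y p)
        e₂ : y₁ ⟨ σ ⟩ ≡ y
        e₂ = trans (i ŷ) (ŷ-⟨⟩ x y p)
        e₃ : z₁ ⟨ σ ⟩ ≡ z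
        e₃ = trans (wksBy-inst k _ q _) (vars-⟨++⟩ z _)
        e : comp x₁ y₁ z₁ q₁ p₁ ⟨ σ ⟩ ≡ comp x y z q p
        e = trans (comp-[] x₁ y₁ z₁ q₁ p₁ σ)
            (cong₅ comp e₁ e₂ e₃ (vars-⟨++⟩ q _) (trans (i p̂) (p̂-⟨⟩ x y p)))
      s : Θ ⊢ q ++ (z ++ (p ++ (y ++ x))) ≐ q′ ++ (z′ ++ (p′ ++ (y′ ++ x′))) ∶ˢ
          (I-ctx ⧺ ⌜ Φ ⌝) ⧺ IdTel Φ (ŷ ⟨ w ⟩) (vars k)
      s = ++-≐ˢ ok₂ (++-≐ˢ ok₁ (point-≐ X Y P)
        (subst (λ T → Θ ⊢ z ≐ z′ ∶ᵗ T) (sym (⌜⌝-[] Φ _)) (to⌜⌝≐ Z)))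
        (subst (λ T → Θ ⊢ q ≐ q′ ∶ᵗ T) (sym (trans (IdTel-[] Φ _ _ _)
          (cong₂ (λ u v → IdTel Φ u v) (trans (wksBy-inst k ŷ z _) (ŷ-⟨⟩ x y p)) (vars-⟨++⟩ z _))))
              (fromId≐ Q))

  module _ {k} {Φ : Ctx k} (f : ⊢ Φ) {m₀} {Θ₀ : Ctx m₀} where

    compʳ : ∀ {x z q} → Θ₀ ⊢ x ∶ˢ Φ → Θ₀ ⊢ z ∶ˢ Φ → Θ₀ ⊢ q ∶Id Φ ⦅ x , z ⦆ →
            Θ₀ ⊢ comp x x z q (rfls x) ≐ q ∶Id Φ ⦅ x , z ⦆
    compʳ {x} {z} {q} X Z Q = uniq f
      (record { el = Pt.a ; el-⟨⟩ = λ P σ → refl })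
          (record { el = Pt.b ; el-⟨⟩ = λ P σ → refl }) a-∶ b-∶
      (record { el = λ P → comp (Pt.a P) (Pt.a P) (Pt.b P) (Pt.p P) (rfls (Pt.a P))
              ; el-⟨⟩ = λ P σ → trans (comp-[] (Pt.a P) (Pt.a P) (Pt.b P) (Pt.p P) _ σ)
                  (cong (comp _ _ _ _) (rfls-⟨⟩ (Pt.a P) σ)) })
      (record { el = Pt.p ; el-⟨⟩ = λ P σ → refl })
      (λ Q → comp-∶ f (a-∶ Q) (a-∶ Q) (b-∶ Q) (p-∶ Q) (rfls-type (elim f) (a-∶ Q)))
      p-∶
      (λ G X D → comp-β f X X (rfls-type (elim f) X))
      {P = pt [] x z q []}
      (ptᵗ ([] (∶ˢ-ctx X)) X Z Q ([] (∶ˢ-ctx X)))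
      where
      T : Post [] Φ zero
      T = noPost [] f
      open ElimP T
      open IdElim T

    comp-assoc : ∀ {x y z w s q p} → Θ₀ ⊢ x ∶ˢ Φ → Θ₀ ⊢ y ∶ˢ Φ → Θ₀ ⊢ z ∶ˢ Φ → Θ₀ ⊢ w ∶ˢ Φ →
                 Θ₀ ⊢ s ∶Id Φ ⦅ z , w ⦆ → Θ₀ ⊢ q ∶Id Φ ⦅ y , z ⦆ → Θ₀ ⊢ p ∶Id Φ ⦅ x , y ⦆ →
                 Θ₀ ⊢ comp x y w (comp y z w s q) p ≐ comp x z w s (comp x y z q p) ∶Id Φ ⦅ x , w ⦆
    comp-assoc {x} {y} {z} {w} {s} {q} {p} X Y Z W S′ Q P =
      subst₂ (λ u v → Θ₀ ⊢ u ≐ v ∶Id Φ ⦅ x , w ⦆)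
        (cong₃ (λ x y p → comp x y w (comp y z w s q) p) (⟨ids⟩ x) (⟨ids⟩ y) (⟨ids⟩ p))
        (cong₃ (λ x y p → comp x z w s (comp x y z q p)) (⟨ids⟩ x) (⟨ids⟩ y) (⟨ids⟩ p))
      (subst (λ v → Θ₀ ⊢ comp (x ⟨ ids ⟩) (y ⟨ ids ⟩) w (comp (y ⟨ ids ⟩) z w s q) (p ⟨ ids ⟩) ≐
                         comp (x ⟨ ids ⟩) z w s (comp (x ⟨ ids ⟩) (y ⟨ ids ⟩) z q (p ⟨ ids ⟩)) ∶Id Φ
                             ⦅ v , w ⦆) (⟨ids⟩ x)
        (uniq f src tgt (λ R → ⟨⟩-∶ˢ X (γ-∶ R)) b-∶ t t′
          (λ R → comp-∶ f (⟨⟩-∶ˢ X (γ-∶ R)) (⟨⟩-∶ˢ Y (γ-∶ R)) (b-∶ R)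
            (comp-∶ f (⟨⟩-∶ˢ Y (γ-∶ R)) (a-∶ R) (b-∶ R) (p-∶ R) (toId (δ-∶ R)))
                (Id-subst P (γ-∶ R)))
          (λ R → comp-∶ f (⟨⟩-∶ˢ X (γ-∶ R)) (a-∶ R) (b-∶ R) (p-∶ R)
            (comp-∶ f (⟨⟩-∶ˢ X (γ-∶ R)) (⟨⟩-∶ˢ Y (γ-∶ R)) (a-∶ R) (toId (δ-∶ R))
                (Id-subst P (γ-∶ R))))
          (λ G A D → let X′ = ⟨⟩-∶ˢ X G ; Y′ = ⟨⟩-∶ˢ Y G ; P′ = Id-subst P G ; D′ = toId D in
            Id≐-trans X′ A
              (comp-cong f (≐ˢ-refl X′) (≐ˢ-refl Y′) (≐ˢ-refl A) (comp-β f Y′ A D′) (Id≐-refl P′))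
              (Id≐-sym X′ A (comp-β f X′ A (comp-∶ f X′ Y′ A D′ P′))))
          {P = pt ids z w s q}
          (ptᵗ (ids-∶ˢ (∶ˢ-ctx X)) Z W S′
              (subst (λ v → Θ₀ ⊢ q ∶ᵗ IdTel Φ v z) (sym (⟨ids⟩ y)) (fromId Q)))))
      where
      T : Post Θ₀ Φ k
      T = idPost Y
      open ElimP T
      open IdElim T
      src tgt t t′ : Fam k
      src = record { el = λ P → x ⟨ Pt.γ P ⟩ ; el-⟨⟩ = λ P σ → ⟨⟩-⟨⟩ x _ σ }
      tgt = record { el = Pt.b ; el-⟨⟩ = λ P σ → refl }
      t = record
        { el = λ P → comp (x ⟨ Pt.γ P ⟩) (y ⟨ Pt.γ P ⟩) (Pt.b P)
            (comp (y ⟨ Pt.γ P ⟩) (Pt.a P) (Pt.b P) (Pt.p P) (Pt.δ P)) (p ⟨ Pt.γ P ⟩)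
        ; el-⟨⟩ = λ P σ → trans (comp-[] (x ⟨ Pt.γ P ⟩) (y ⟨ Pt.γ P ⟩) (Pt.b P) _ _ σ)
            (cong₅ comp (⟨⟩-⟨⟩ x _ σ) (⟨⟩-⟨⟩ y _ σ) refl
              (trans (comp-[] (y ⟨ Pt.γ P ⟩) (Pt.a P) (Pt.b P) (Pt.p P) (Pt.δ P) σ)
                  (cong (λ y → comp y _ _ _ _) (⟨⟩-⟨⟩ y _ σ)))
              (⟨⟩-⟨⟩ p _ σ)) }
      t′ = record
        { el = λ P → comp (x ⟨ Pt.γ P ⟩) (Pt.a P) (Pt.b P) (Pt.p P)
            (comp (x ⟨ Pt.γ P ⟩) (y ⟨ Pt.γ P ⟩) (Pt.a P) (Pt.δ P) (p ⟨ Pt.γ P ⟩))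
        ; el-⟨⟩ = λ P σ → trans (comp-[] (x ⟨ Pt.γ P ⟩) (Pt.a P) (Pt.b P) (Pt.p P) _ σ)
            (cong₂ (λ x z → comp x _ _ _ z) (⟨⟩-⟨⟩ x _ σ)
              (trans (comp-[] (x ⟨ Pt.γ P ⟩) (y ⟨ Pt.γ P ⟩) (Pt.a P) (Pt.δ P) _ σ)
                (cong₃ (λ x y p → comp x y _ _ p) (⟨⟩-⟨⟩ x _ σ) (⟨⟩-⟨⟩ y _ σ) (⟨⟩-⟨⟩ p _ σ)))) }

  module _ {k s} {Φ : Ctx k} {Ψ : Ctx s} {h : Sub k s} (H : Φ ⊢ h ∶ˢ Ψ) {m₀} {Θ₀ : Ctx m₀} where
    private
      f = ∶ˢ-ctx H
      ψ = ∶ˢ-cod H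

    bullet-comp : ∀ {x y z q p} → Θ₀ ⊢ x ∶ˢ Φ → Θ₀ ⊢ y ∶ˢ Φ → Θ₀ ⊢ z ∶ˢ Φ →
                  Θ₀ ⊢ q ∶Id Φ ⦅ y , z ⦆ → Θ₀ ⊢ p ∶Id Φ ⦅ x , y ⦆ →
                  Θ₀ ⊢ bullet h x z (comp x y z q p) ≐
                       comp (h ⟨ x ⟩) (h ⟨ y ⟩) (h ⟨ z ⟩) (bullet h y z q)
                           (bullet h x y p) ∶Id Ψ ⦅ h ⟨ x ⟩ , h ⟨ z ⟩ ⦆
    bullet-comp {x} {y} {z} {q} {p} X Y Z Q P =
      subst (λ v → Θ₀ ⊢ bullet h v z (comp v y z q p) ≐
                       comp (h ⟨ v ⟩) (h ⟨ y ⟩) (h ⟨ z ⟩) (bullet h y z q)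
                           (bullet h v y p) ∶Id Ψ ⦅ h ⟨ v ⟩ , h ⟨ z ⟩ ⦆) (⟨ids⟩ x)
        (uniq ψ src tgt (λ R → ⟨⟩-∶ˢ H (⟨⟩-∶ˢ X (γ-∶ R))) (λ R → ⟨⟩-∶ˢ H (b-∶ R)) t t′
          (λ R → bullet-∶ H (⟨⟩-∶ˢ X (γ-∶ R)) (b-∶ R)
              (comp-∶ f (⟨⟩-∶ˢ X (γ-∶ R)) (a-∶ R) (b-∶ R) (p-∶ R) (toId (δ-∶ R))))
          (λ R → comp-∶ ψ (⟨⟩-∶ˢ H (⟨⟩-∶ˢ X (γ-∶ R))) (⟨⟩-∶ˢ H (a-∶ R)) (⟨⟩-∶ˢ H (b-∶ R))
            (bullet-∶ H (a-∶ R) (b-∶ R) (p-∶ R))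
                (bullet-∶ H (⟨⟩-∶ˢ X (γ-∶ R)) (a-∶ R) (toId (δ-∶ R))))
          (λ G A D → let X′ = ⟨⟩-∶ˢ X G ; D′ = toId D ; HX = ⟨⟩-∶ˢ H X′ ; HA = ⟨⟩-∶ˢ H A ; b = bullet-∶ H X′ A D′ in
            Id≐-trans HX HA (bullet-cong H (≐ˢ-refl X′) (≐ˢ-refl A) (comp-β f X′ A D′))
              (Id≐-sym HX HA (Id≐-trans HX HA
                (comp-cong ψ (≐ˢ-refl HX) (≐ˢ-refl HA) (≐ˢ-refl HA) (bullet-β H A) (Id≐-refl b))
                (comp-β ψ HX HA b))))
          {P = pt ids y z q p}
          (ptᵗ (ids-∶ˢ (∶ˢ-ctx X)) Y Z Q
              (subst (λ v → Θ₀ ⊢ p ∶ᵗ IdTel Φ v y) (sym (⟨ids⟩ x)) (fromId P))))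
      where
      T : Post Θ₀ Φ k
      T = idPost X
      open ElimP T
      open IdElim T
      src tgt t t′ : Fam s
      src = record { el = λ P → h ⟨ x ⟨ Pt.γ P ⟩ ⟩ ; el-⟨⟩ = λ P σ → trans (⟨⟩-⟨⟩ h _ σ)
          (cong (h ⟨_⟩) (⟨⟩-⟨⟩ x _ σ)) }
      tgt = record { el = λ P → h ⟨ Pt.b P ⟩ ; el-⟨⟩ = λ P σ → ⟨⟩-⟨⟩ h _ σ }
      t = record
        { el = λ P → bullet h (x ⟨ Pt.γ P ⟩) (Pt.b P)
            (comp (x ⟨ Pt.γ P ⟩) (Pt.a P) (Pt.b P) (Pt.p P) (Pt.δ P))
        ; el-⟨⟩ = λ P σ → trans (bullet-[] h (x ⟨ Pt.γ P ⟩) (Pt.b P) _ σ)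
            (cong₂ (λ u v → bullet h u _ v) (⟨⟩-⟨⟩ x _ σ)
              (trans (comp-[] (x ⟨ Pt.γ P ⟩) (Pt.a P) (Pt.b P) (Pt.p P) (Pt.δ P) σ)
              (cong (λ u → comp u _ _ _ _) (⟨⟩-⟨⟩ x _ σ)))) }
      t′ = record
        { el = λ P → comp (h ⟨ x ⟨ Pt.γ P ⟩ ⟩) (h ⟨ Pt.a P ⟩) (h ⟨ Pt.b P ⟩)
                          (bullet h (Pt.a P) (Pt.b P) (Pt.p P))
                          (bullet h (x ⟨ Pt.γ P ⟩) (Pt.a P) (Pt.δ P))
        ; el-⟨⟩ = λ P σ → trans (comp-[] (h ⟨ x ⟨ Pt.γ P ⟩ ⟩) (h ⟨ Pt.a P ⟩) (h ⟨ Pt.b P ⟩) _ _ σ)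
            (cong₅ comp (trans (⟨⟩-⟨⟩ h _ σ) (cong (h ⟨_⟩) (⟨⟩-⟨⟩ x _ σ))) (⟨⟩-⟨⟩ h _ σ)
              (⟨⟩-⟨⟩ h _ σ)
              (bullet-[] h (Pt.a P) (Pt.b P) (Pt.p P) σ)
              (trans (bullet-[] h (x ⟨ Pt.γ P ⟩) (Pt.a P) (Pt.δ P) σ)
                  (cong (λ u → bullet h u _ _) (⟨⟩-⟨⟩ x _ σ)))) }

    module _ {a b p} (A : Θ₀ ⊢ a ∶ˢ Φ) (B : Θ₀ ⊢ b ∶ˢ Φ) (P : Θ₀ ⊢ p ∶Id Φ ⦅ a , b ⦆) where
      private
        T : Post [] Φ zero
        T = noPost [] f
        open ElimP T
        open IdElim T
        P₀ : Θ₀ ⊢ᵖ pt [] a b p []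
        P₀ = ptᵗ ([] (∶ˢ-ctx A)) A B P ([] (∶ˢ-ctx A))

        compF : ∀ {s} (g : Sub k s) → Fam s
        compF g = record { el = λ P → g ⟨ Pt.a P ⟩ ; el-⟨⟩ = λ P σ → ⟨⟩-⟨⟩ g _ σ }
        compG : ∀ {s} (g : Sub k s) → Fam s
        compG g = record { el = λ P → g ⟨ Pt.b P ⟩ ; el-⟨⟩ = λ P σ → ⟨⟩-⟨⟩ g _ σ }
        bulletF : ∀ {s} (g : Sub k s) → Fam s
        bulletF g = record { el = λ P → bullet g (Pt.a P) (Pt.b P) (Pt.p P)
                           ; el-⟨⟩ = λ P σ → bullet-[] g (Pt.a P) (Pt.b P) (Pt.p P) σ }

      bullet-congˡ : ∀ {h′} → Φ ⊢ h ≐ h′ ∶ˢ Ψ →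
                     Θ₀ ⊢ bullet h a b p ≐ bullet h′ a b p ∶Id Ψ ⦅ h ⟨ a ⟩ , h ⟨ b ⟩ ⦆
      bullet-congˡ {h′} e = uniq ψ (compF h) (compG h) (λ R → ⟨⟩-∶ˢ H (a-∶ R))
        (λ R → ⟨⟩-∶ˢ H (b-∶ R))
        (bulletF h) (bulletF h′)
        (λ R → bullet-∶ H (a-∶ R) (b-∶ R) (p-∶ R))
        (λ R → Id-conv (≐ˢ-sym (≐ˢ-⟨⟩ e (a-∶ R))) (≐ˢ-sym (≐ˢ-⟨⟩ e (b-∶ R)))
            (bullet-∶ (≐ˢ-right e) (a-∶ R) (b-∶ R) (p-∶ R)))
        (λ G X D → let e′ = ≐ˢ-⟨⟩ e X in
          Id≐-trans (⟨⟩-∶ˢ H X) (⟨⟩-∶ˢ H X) (bullet-β H X)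
          (Id≐-trans (⟨⟩-∶ˢ H X) (⟨⟩-∶ˢ H X) (rfls-cong e′)
            (Id-conv≐ (≐ˢ-sym e′) (≐ˢ-sym e′)
                (Id≐-sym (≐ˢ-right e′) (≐ˢ-right e′) (bullet-β (≐ˢ-right e) X)))))
        P₀
        where
        rfls-cong : ∀ {m} {Θ : Ctx m} {σ τ} → Θ ⊢ σ ≐ τ ∶ˢ Ψ → Θ ⊢ rfls σ ≐ rfls τ ∶Id Ψ ⦅ σ , σ ⦆
        rfls-cong {Θ = Θ} {σ} {τ} e = subst₂ (λ u v → Θ ⊢ u ≐ v ∶Id Ψ ⦅ σ , σ ⦆) (i σ) (i τ)
          (subst₂ (λ u v → Θ ⊢ rfls ids ⟨ σ ⟩ ≐ rfls ids ⟨ τ ⟩ ∶Id Ψ ⦅ u , v ⦆) (ids-⟨⟩ σ)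
            (ids-⟨⟩ σ)
            (Id-subst-≐ (rfls-type (elim ψ) (ids-∶ˢ ψ)) e))
          where
          i : ∀ σ → rfls ids ⟨ σ ⟩ ≡ rfls σ
          i σ = trans (rfls-⟨⟩ ids σ) (cong rfls (ids-⟨⟩ σ))

      bullet-∙ : ∀ {t} {Ξ : Ctx t} {g} → Ψ ⊢ g ∶ˢ Ξ →
                 Θ₀ ⊢ bullet (g ⟨ h ⟩) a b p ≐ bullet g (h ⟨ a ⟩) (h ⟨ b ⟩)
                     (bullet h a b p) ∶Id Ξ ⦅ g ⟨ h ⟩ ⟨ a ⟩ , g ⟨ h ⟩ ⟨ b ⟩ ⦆
      bullet-∙ {Ξ = Ξ} {g} G₀ = uniq (∶ˢ-cod G₀) (compF (g ⟨ h ⟩)) (compG (g ⟨ h ⟩))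
        (λ R → ⟨⟩-∶ˢ GH (a-∶ R)) (λ R → ⟨⟩-∶ˢ GH (b-∶ R))
        (bulletF (g ⟨ h ⟩))
        (record { el = λ P → bullet g (h ⟨ Pt.a P ⟩) (h ⟨ Pt.b P ⟩)
            (bullet h (Pt.a P) (Pt.b P) (Pt.p P))
                ; el-⟨⟩ = λ P σ → trans (bullet-[] g (h ⟨ Pt.a P ⟩) (h ⟨ Pt.b P ⟩) _ σ)
                    (cong₃ (bullet g) (⟨⟩-⟨⟩ h _ σ) (⟨⟩-⟨⟩ h _ σ)
                        (bullet-[] h (Pt.a P) (Pt.b P) (Pt.p P) σ)) })
        (λ R → bullet-∶ GH (a-∶ R) (b-∶ R) (p-∶ R))
        (λ {_} {Θ} {P} R → subst₂ (λ u v → Θ ⊢ bullet g (h ⟨ Pt.a P ⟩) (h ⟨ Pt.b P ⟩)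
          (bullet h (Pt.a P) (Pt.b P) (Pt.p P)) ∶Id Ξ ⦅ u , v ⦆)
          (sym (⟨⟩-⟨⟩ g h _)) (sym (⟨⟩-⟨⟩ g h _))
          (bullet-∶ G₀ (⟨⟩-∶ˢ H (a-∶ R)) (⟨⟩-∶ˢ H (b-∶ R)) (bullet-∶ H (a-∶ R) (b-∶ R) (p-∶ R))))
        (λ {_} {Θ} {γ} {x} {δ} G X D → let X′ = ⟨⟩-∶ˢ GH X ; HX = ⟨⟩-∶ˢ H X in
          Id≐-trans X′ X′ (bullet-β GH X) (Id≐-sym X′ X′
            (subst (λ u → Θ ⊢ bullet g (h ⟨ x ⟩) (h ⟨ x ⟩)
              (bullet h x x (rfls x)) ≐ rfls u ∶Id Ξ ⦅ u , u ⦆) (sym (⟨⟩-⟨⟩ g h x))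
              (Id≐-trans (⟨⟩-∶ˢ G₀ HX) (⟨⟩-∶ˢ G₀ HX)
                  (bullet-cong G₀ (≐ˢ-refl HX) (≐ˢ-refl HX) (bullet-β H X)) (bullet-β G₀ HX)))))
        P₀
        where GH = ⟨⟩-∶ˢ G₀ H

      bullet-interchange : ∀ {h′ β} → Φ ⊢ h′ ∶ˢ Ψ → Φ ⊢ β ∶Id Ψ ⦅ h , h′ ⦆ →
        Θ₀ ⊢ comp (h ⟨ a ⟩) (h′ ⟨ a ⟩) (h′ ⟨ b ⟩) (bullet h′ a b p) (β ⟨ a ⟩) ≐
             comp (h ⟨ a ⟩) (h ⟨ b ⟩) (h′ ⟨ b ⟩) (β ⟨ b ⟩)
                 (bullet h a b p) ∶Id Ψ ⦅ h ⟨ a ⟩ , h′ ⟨ b ⟩ ⦆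
      bullet-interchange {h′} {β} H′ B₀ = uniq ψ (compF h) (compG h′) (λ R → ⟨⟩-∶ˢ H (a-∶ R))
        (λ R → ⟨⟩-∶ˢ H′ (b-∶ R))
        (record { el = λ P → comp (h ⟨ Pt.a P ⟩) (h′ ⟨ Pt.a P ⟩) (h′ ⟨ Pt.b P ⟩)
            (bullet h′ (Pt.a P) (Pt.b P) (Pt.p P)) (β ⟨ Pt.a P ⟩)
                ; el-⟨⟩ = λ P σ → trans (comp-[] (h ⟨ Pt.a P ⟩) (h′ ⟨ Pt.a P ⟩)
                    (h′ ⟨ Pt.b P ⟩) _ _ σ)
                    (cong₅ comp (⟨⟩-⟨⟩ h _ σ) (⟨⟩-⟨⟩ h′ _ σ) (⟨⟩-⟨⟩ h′ _ σ)
                        (bullet-[] h′ (Pt.a P) (Pt.b P) (Pt.p P) σ) (⟨⟩-⟨⟩ β _ σ)) })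
        (record { el = λ P → comp (h ⟨ Pt.a P ⟩) (h ⟨ Pt.b P ⟩) (h′ ⟨ Pt.b P ⟩) (β ⟨ Pt.b P ⟩)
            (bullet h (Pt.a P) (Pt.b P) (Pt.p P))
                ; el-⟨⟩ = λ P σ → trans (comp-[] (h ⟨ Pt.a P ⟩) (h ⟨ Pt.b P ⟩)
                    (h′ ⟨ Pt.b P ⟩) _ _ σ)
                    (cong₅ comp (⟨⟩-⟨⟩ h _ σ) (⟨⟩-⟨⟩ h _ σ) (⟨⟩-⟨⟩ h′ _ σ) (⟨⟩-⟨⟩ β _ σ)
                        (bullet-[] h (Pt.a P) (Pt.b P) (Pt.p P) σ)) })
        (λ R → comp-∶ ψ (⟨⟩-∶ˢ H (a-∶ R)) (⟨⟩-∶ˢ H′ (a-∶ R)) (⟨⟩-∶ˢ H′ (b-∶ R))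
            (bullet-∶ H′ (a-∶ R) (b-∶ R) (p-∶ R)) (Id-subst B₀ (a-∶ R)))
        (λ R → comp-∶ ψ (⟨⟩-∶ˢ H (a-∶ R)) (⟨⟩-∶ˢ H (b-∶ R)) (⟨⟩-∶ˢ H′ (b-∶ R)) (Id-subst B₀ (b-∶ R))
            (bullet-∶ H (a-∶ R) (b-∶ R) (p-∶ R)))
        (λ G X D → let HX = ⟨⟩-∶ˢ H X ; H′X = ⟨⟩-∶ˢ H′ X ; βX = Id-subst B₀ X in
          Id≐-trans HX H′X
            (Id≐-trans HX H′X (comp-cong ψ (≐ˢ-refl HX) (≐ˢ-refl H′X) (≐ˢ-refl H′X) (bullet-β H′ X)
                (Id≐-refl βX)) (comp-β ψ HX H′X βX))
            (Id≐-sym HX H′X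
              (Id≐-trans HX H′X (comp-cong ψ (≐ˢ-refl HX) (≐ˢ-refl HX) (≐ˢ-refl H′X) (Id≐-refl βX)
                  (bullet-β H X)) (compʳ ψ HX H′X βX))))
        P₀

  bullet-ids : ∀ {k} {Φ : Ctx k} {m} {Θ : Ctx m} {a b p} → Θ ⊢ a ∶ˢ Φ → Θ ⊢ b ∶ˢ Φ →
               Θ ⊢ p ∶Id Φ ⦅ a , b ⦆ →
               Θ ⊢ bullet ids a b p ≐ p ∶Id Φ ⦅ a , b ⦆
  bullet-ids {k} {Φ} A B P = uniq f (record { el = Pt.a ; el-⟨⟩ = λ P σ → refl })
    (record { el = Pt.b ; el-⟨⟩ = λ P σ → refl }) a-∶ b-∶
    (record { el = λ P → bullet ids (Pt.a P) (Pt.b P) (Pt.p P) ; el-⟨⟩ = λ P σ → bullet-[] ids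
        (Pt.a P) (Pt.b P) (Pt.p P) σ })
    (record { el = Pt.p ; el-⟨⟩ = λ P σ → refl })
    (λ {_} {Θ} {P} R → subst₂ (λ u v → Θ ⊢ bullet ids (Pt.a P) (Pt.b P) (Pt.p P) ∶Id Φ ⦅ u , v ⦆)
      (ids-⟨⟩ _) (ids-⟨⟩ _)
      (bullet-∶ (ids-∶ˢ f) (a-∶ R) (b-∶ R) (p-∶ R)))
    p-∶
    (λ {_} {Θ} {γ} {x} {δ} G X D →
        subst (λ u → Θ ⊢ bullet ids x x (rfls x) ≐ rfls u ∶Id Φ ⦅ u , u ⦆) (ids-⟨⟩ x)
        (bullet-β (ids-∶ˢ f) X))
    (ptᵗ ([] (∶ˢ-ctx A)) A B P ([] (∶ˢ-ctx A)))
    where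
    f = ∶ˢ-cod A
    T : Post [] Φ zero
    T = noPost [] f
    open ElimP T
    open IdElim T

module Contexts {r j : Level} {S : TypeTheory r j} (M : ML₂ S) where
  open TypeTheory S
  open ML₂ M
  open Substitution S
  open Identity M
  open Elim
  open Telescopes M
  open PostContexts M
  open Composition M
  open CellOperations M

  -- Contexts, lists of terms and lists of paths are representatives; the
  -- quotient by definitional equality is taken by Morphism≈ and Cell≋.
  record Context : Set (r ⊔ j) where
    constructor context
    field
      {size}  : ℕ
      ctx     : Ctx size
      ctx-ok  : ⊢ ctx
  open Context

  record Morphism (Γ Δ : Context) : Set (r ⊔ j) where
    constructor morphism
    field
      terms : Sub (size Γ) (size Δ)
      typed : ctx Γ ⊢ terms ∶ˢ ctx Δ
  open Morphism

  record Cell {Γ Δ : Context} (f g : Morphism Γ Δ) : Set (r ⊔ j) where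
    constructor cell
    field
      terms : Sub (size Γ) (size Δ)
      typed : ctx Γ ⊢ terms ∶ᵗ IdTel (ctx Δ) (Morphism.terms f) (Morphism.terms g)
  open Cell renaming (terms to paths; typed to ptyped)

  record Morphism≈ {Γ Δ : Context} (f g : Morphism Γ Δ) : Set (r ⊔ j) where
    constructor morphism≈
    field
      equal : ctx Γ ⊢ terms f ≐ terms g ∶ˢ ctx Δ
  open Morphism≈

  record Cell≋ {Γ Δ : Context} {f g f′ g′ : Morphism Γ Δ} (α : Cell f g) (β : Cell f′ g′) : Set
      (r ⊔ j) where
    constructor cell≋
    field
      dom≈   : Morphism≈ f f′
      cod≈   : Morphism≈ g g′
      paths≐ : ctx Γ ⊢ paths α ≐ paths β ∶ᵗ IdTel (ctx Δ) (terms f) (terms g)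
  open Cell≋

  private
    ≈refl : ∀ {Γ Δ} {f : Morphism Γ Δ} → Morphism≈ f f
    ≈refl {f = f} = morphism≈ (≐ˢ-refl (typed f))
    ≈sym : ∀ {Γ Δ} {f g : Morphism Γ Δ} → Morphism≈ f g → Morphism≈ g f
    ≈sym p = morphism≈ (≐ˢ-sym (equal p))
    ≈trans : ∀ {Γ Δ} {f g h : Morphism Γ Δ} → Morphism≈ f g → Morphism≈ g h → Morphism≈ f h
    ≈trans p q = morphism≈ (≐ˢ-trans (equal p) (equal q))
    ≈≡ : ∀ {Γ Δ} {f g : Morphism Γ Δ} → terms f ≡ terms g → Morphism≈ f g
    ≈≡ {Γ} {Δ} {f} e = morphism≈ (subst (λ t → ctx Γ ⊢ terms f ≐ t ∶ˢ ctx Δ) e (≐ˢ-refl (typed f)))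

    cellᴵ : ∀ {Γ Δ} {f g : Morphism Γ Δ} t → ctx Γ ⊢ t ∶Id ctx Δ ⦅ terms f , terms g ⦆ → Cell f g
    cellᴵ t p = cell t (fromId p)
    ptypedᴵ : ∀ {Γ Δ} {f g : Morphism Γ Δ} (α : Cell f g) →
        ctx Γ ⊢ paths α ∶Id ctx Δ ⦅ terms f , terms g ⦆
    ptypedᴵ α = toId (ptyped α)
    ≐ᴵ : ∀ {Γ Δ} {f g f′ g′ : Morphism Γ Δ} {α : Cell f g} {β : Cell f′ g′} → Cell≋ α β →
         ctx Γ ⊢ paths α ≐ paths β ∶Id ctx Δ ⦅ terms f , terms g ⦆
    ≐ᴵ p = toId≐ (paths≐ p)
    same : ∀ {Γ Δ} {f g : Morphism Γ Δ} {α : Cell f g} {β : Cell f g} →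
           ctx Γ ⊢ paths α ≐ paths β ∶Id ctx Δ ⦅ terms f , terms g ⦆ → Cell≋ α β
    same p = cell≋ ≈refl ≈refl (fromId≐ p)
    ≋≡ : ∀ {Γ Δ} {f g f′ g′ : Morphism Γ Δ} {α : Cell f g} {β : Cell f′ g′} →
         Morphism≈ f f′ → Morphism≈ g g′ → paths α ≡ paths β → Cell≋ α β
    ≋≡ {Γ} {Δ} {f} {g} {α = α} p q e = cell≋ p q
      (fromId≐ (subst (λ t → ctx Γ ⊢ paths α ≐ t ∶Id ctx Δ ⦅ terms f , terms g ⦆) e
          (Id≐-refl (ptypedᴵ α))))

    rfl-cell : ∀ {Γ Δ} (f : Morphism Γ Δ) → Cell f f
    rfl-cell {Γ} {Δ} f = cellᴵ (rfls (terms f)) (rfls-type (elim (ctx-ok Δ)) (typed f))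

  HomCat : Context → Context → Category (r ⊔ j) (r ⊔ j) (r ⊔ j) (r ⊔ j)
  HomCat Γ Δ = record
    { Obj = Morphism Γ Δ
    ; _≈_ = Morphism≈
    ; _⇒_ = Cell
    ; _≋_ = Cell≋
    ; ≈-isEquivalence = record { refl = ≈refl ; sym = ≈sym ; trans = ≈trans }
    ; ≋-refl = ≋≡ ≈refl ≈refl refl
    ; ≋-sym = λ {_} {_} {_} {_} {α} {β} p → cell≋ (≈sym (dom≈ p)) (≈sym (cod≈ p))
        (fromId≐ (Id-conv≐ (equal (dom≈ p)) (equal (cod≈ p))
            (Id≐-sym (≐ˢ-left (equal (dom≈ p))) (≐ˢ-left (equal (cod≈ p))) (≐ᴵ p))))
    ; ≋-trans = λ p q → cell≋ (≈trans (dom≈ p) (dom≈ q)) (≈trans (cod≈ p) (cod≈ q))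
        (fromId≐ (Id≐-trans (≐ˢ-left (equal (dom≈ p))) (≐ˢ-left (equal (cod≈ p))) (≐ᴵ p)
          (Id-conv≐ (≐ˢ-sym (equal (dom≈ p))) (≐ˢ-sym (equal (cod≈ p))) (≐ᴵ q))))
    ; ≋-dom = dom≈
    ; ≋-cod = cod≈
    ; cast = λ p q α → cellᴵ (paths α) (Id-conv (equal p) (equal q) (ptypedᴵ α))
    ; cast-≋ = λ {_} {_} {_} {_} {p} {q} → ≋≡ (≈sym p) (≈sym q) refl
    ; id = λ {f} → rfl-cell f
    ; _∘_ = λ {f} {g} {h} β α → cellᴵ (comp (terms f) (terms g) (terms h) (paths β) (paths α))
        (comp-∶ (ctx-ok Δ) (typed f) (typed g) (typed h) (ptypedᴵ β) (ptypedᴵ α))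
    ; id-cong = λ {f} {g} p → cell≋ p p
        (fromId≐ (subst₂ (λ u v → ctx Γ ⊢ u ≐ v ∶Id ctx Δ ⦅ terms f , terms f ⦆)
        (rfls-ids (terms f)) (rfls-ids (terms g))
        (subst₂ (λ u v → ctx Γ ⊢ rfls ids ⟨ terms f ⟩ ≐ rfls ids ⟨ terms g ⟩ ∶Id ctx Δ ⦅ u , v ⦆)
          (ids-⟨⟩ _) (ids-⟨⟩ _)
          (Id-subst-≐ (rfls-type (elim (ctx-ok Δ)) (ids-∶ˢ (ctx-ok Δ))) (equal p)))))
    ; ∘-cong = λ p q → cell≋ (dom≈ q) (cod≈ p)
        (fromId≐ (comp-cong (ctx-ok Δ) (equal (dom≈ q)) (equal (cod≈ q)) (equal (cod≈ p)) (≐ᴵ p)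
            (≐ᴵ q)))
    ; identityˡ = λ {f} {g} {α} → same (comp-β (ctx-ok Δ) (typed f) (typed g) (ptypedᴵ α))
    ; identityʳ = λ {f} {g} {α} → same (compʳ (ctx-ok Δ) (typed f) (typed g) (ptypedᴵ α))
    ; assoc = λ {x} {y} {z} {w} {γ} {β} {α} →
        same (comp-assoc (ctx-ok Δ) (typed x) (typed y) (typed z) (typed w)
        (ptypedᴵ γ) (ptypedᴵ β) (ptypedᴵ α))
    }
    where
    rfls-ids : ∀ σ → rfls ids ⟨ σ ⟩ ≡ rfls σ
    rfls-ids σ = trans (rfls-⟨⟩ ids σ) (cong rfls (ids-⟨⟩ σ))

  ℭ : TwoCategory (r ⊔ j) (r ⊔ j) (r ⊔ j) (r ⊔ j) (r ⊔ j)
  ℭ = record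
    { Cell₀ = Context
    ; Hom = HomCat
    ; 1₁ = λ {Γ} → morphism ids (ids-∶ˢ (ctx-ok Γ))
    ; _∙_ = λ h f → morphism (terms h ⟨ terms f ⟩) (⟨⟩-∶ˢ (typed h) (typed f))
    ; _▹_ = λ h {f} {g} α → cellᴵ (bullet (terms h) (terms f) (terms g) (paths α))
        (bullet-∶ (typed h) (typed f) (typed g) (ptypedᴵ α))
    ; _◃_ = λ α k → cellᴵ (paths α ⟨ terms k ⟩) (Id-subst (ptypedᴵ α) (typed k))
    ; ∙-cong = λ p q → morphism≈ (⟨⟩-cong (equal p) (equal q))
    ; ▹-cong = λ {_} {_} {_} {h} {h′} {f} {g} {f′} {g′} {α} {β} p q → cell≋
        (morphism≈ (⟨⟩-cong (equal p) (equal (dom≈ q))))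
            (morphism≈ (⟨⟩-cong (equal p) (equal (cod≈ q))))
        (fromId≐ (Id≐-trans (⟨⟩-∶ˢ (typed h) (typed f)) (⟨⟩-∶ˢ (typed h) (typed g))
          (bullet-cong (typed h) (equal (dom≈ q)) (equal (cod≈ q)) (≐ᴵ q))
          (Id-conv≐ (⟨⟩-≐ˢ (typed h) (≐ˢ-sym (equal (dom≈ q))))
            (⟨⟩-≐ˢ (typed h) (≐ˢ-sym (equal (cod≈ q))))
            (bullet-congˡ (typed h) (typed f′) (typed g′) (ptypedᴵ β) (equal p)))))
    ; ◃-cong = λ {_} {_} {_} {k} {k′} {f} {g} {f′} {g′} {α} {β} p q → cell≋
        (morphism≈ (⟨⟩-cong (equal (dom≈ p)) (equal q)))
            (morphism≈ (⟨⟩-cong (equal (cod≈ p)) (equal q)))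
        (fromId≐ (Id≐-trans (⟨⟩-∶ˢ (typed f) (typed k)) (⟨⟩-∶ˢ (typed g) (typed k))
          (Id-subst-≐ (ptypedᴵ α) (equal q))
          (Id-conv≐ (⟨⟩-≐ˢ (typed f) (≐ˢ-sym (equal q))) (⟨⟩-≐ˢ (typed g) (≐ˢ-sym (equal q)))
            (Id-subst≐ (≐ᴵ p) (typed k′)))))
    ; ∙-identityˡ = ≈≡ (ids-⟨⟩ _)
    ; ∙-identityʳ = ≈≡ (⟨ids⟩ _)
    ; ∙-assoc = ≈≡ (⟨⟩-⟨⟩ _ _ _)
    ; ▹-id = λ {_} {_} {_} {h} {f} → same (bullet-β (typed h) (typed f))
    ; ▹-∘ = λ {_} {_} {_} {h} {f} {g} {k} {β} {α} → same
        (bullet-comp (typed h) (typed f) (typed g) (typed k) (ptypedᴵ β) (ptypedᴵ α))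
    ; ◃-id = λ {_} {_} {_} {k} {f} → ≋≡ ≈refl ≈refl (rfls-⟨⟩ (terms f) (terms k))
    ; ◃-∘ = λ {_} {_} {_} {k} {f} {g} {h} {β} {α} →
        ≋≡ ≈refl ≈refl (comp-[] (terms f) (terms g) (terms h) (paths β) (paths α) (terms k))
    ; 1▹ = λ {Γ} {Δ} {f} {g} {α} → cell≋ (≈≡ (ids-⟨⟩ _)) (≈≡ (ids-⟨⟩ _)) (fromId≐
        (subst₂ (λ u v → ctx Γ ⊢ bullet ids (terms f) (terms g)
          (paths α) ≐ paths α ∶Id ctx Δ ⦅ u , v ⦆)
          (sym (ids-⟨⟩ _)) (sym (ids-⟨⟩ _)) (bullet-ids (typed f) (typed g) (ptypedᴵ α))))
    ; ∙▹ = λ {_} {_} {_} {_} {h} {k} {f} {g} {α} →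
        cell≋ (≈≡ (⟨⟩-⟨⟩ _ _ _)) (≈≡ (⟨⟩-⟨⟩ _ _ _)) (fromId≐
        (bullet-∙ (typed k) (typed f) (typed g) (ptypedᴵ α) (typed h)))
    ; ◃1 = ≋≡ (≈≡ (⟨ids⟩ _)) (≈≡ (⟨ids⟩ _)) (⟨ids⟩ _)
    ; ◃∙ = ≋≡ (≈≡ (sym (⟨⟩-⟨⟩ _ _ _))) (≈≡ (sym (⟨⟩-⟨⟩ _ _ _))) (sym (⟨⟩-⟨⟩ _ _ _))
    ; ▹◃ = λ {_} {_} {_} {_} {h} {f} {g} {α} {k} → ≋≡ (≈≡ (⟨⟩-⟨⟩ _ _ _)) (≈≡ (⟨⟩-⟨⟩ _ _ _))
        (bullet-[] (terms h) (terms f) (terms g) (paths α) (terms k))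
    ; interchange = λ {_} {_} {_} {f} {g} {h} {k} {α} {β} → same
        (bullet-interchange (typed h) (typed f) (typed g) (ptypedᴵ α) (typed k) (ptypedᴵ β))
    }

  record Type (Γ : Context) : Set (r ⊔ j) where
    constructor type
    field
      expr    : Ty (size Γ)
      is-type : ctx Γ ⊢ expr type
  open Type

  infixl 5 _⨟_
  _⨟_ : (Γ : Context) → Type Γ → Context
  Γ ⨟ A = context (ctx Γ ▷ expr A) (ctx-ok Γ ▷ is-type A)

  π : ∀ {Γ} (A : Type Γ) → Morphism (Γ ⨟ A) Γ
  π A = morphism wks (wks-∶ˢ (is-type A))

  pullback : ∀ {Γ Δ} → Type Δ → Morphism Γ Δ → Type Γ
  pullback A f = type (expr A [ terms f ]ᵀ) (subst-type (typed f) (is-type A))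

  module _ {Γ : Context} (A : Type Γ) where
    open TwoCategory ℭ using (_∙_; _≈_; ∙-assoc; ∙-cong; module Hom)

    ΓA ΓAA : Context
    ΓA  = Γ ⨟ A
    ΓAA = ΓA ⨟ pullback A (π A)

    π₁ π₂ : Morphism ΓAA ΓA
    π₁ = π (pullback A (π A))
    π₂ = morphism (var zero ∷ wks ⟨ wks ⟩)
      (⟨⟩-∶ˢ (typed (π A)) (typed π₁) ∷ (is-type A ,
        (var-zero (is-type (pullback A (π A))) ∶≡ []-[]ᵀ (expr A) wks wks)))

    Id-type : Type ΓAA
    Id-type = type (Id (expr A [ wks ]ᵀ [ wks ]ᵀ) (var (suc zero)) (var zero))
      (Id-form (var-type (ctx-ok ΓAA) (suc zero)) (var-type (ctx-ok ΓAA) zero))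

    ΓAAId : Context
    ΓAAId = ΓAA ⨟ Id-type

    π-Id : Morphism ΓAAId ΓAA
    π-Id = π Id-type

    ΓA/Γ ΓAAId/Γ : Over ℭ Γ
    ΓA/Γ    = over (π A)
    ΓAAId/Γ = over ((π A ∙ π₁) ∙ π-Id)

    π₁π-Id π₂π-Id : Over₁ ℭ Γ ΓAAId/Γ ΓA/Γ
    π₁π-Id = over₁ (π₁ ∙ π-Id) (Hom.≈.sym (∙-assoc {h = π A} {π₁} {π-Id}))
    π₂π-Id = over₁ (π₂ ∙ π-Id)
      (Hom.≈.trans (Hom.≈.sym (∙-assoc {h = π A} {π₂} {π-Id}))
        (∙-cong {f = π A ∙ π₂} {π A ∙ π₁} {π-Id} (≈≡ (wks-⟨∷⟩ _ _)) Hom.≈.refl))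

-- The context Γ.A.A.Id_A has the generic path p as a vertical 2-cell κ = (r(x) , p) between its
-- projections to Γ.A.  Three facts about ℭ make κ universal over Γ.
--  * Paths lift along a projection π : Φ.D → Φ: (p , r(p*z)) goes from (x , p*z) to (x′ , z).
--    Hence a 2-cell into Φ.D over β is a lifting of β composed with a vertical 2-cell (r(x) , q),
--    and whiskering with Φ.D[σ] → Ψ.D sends (r(x) , q) to (r(σx) , q).  So Φ.D[σ] is a
--    pullback of Ψ.D on 2-cells; in particular Γ.A.A is a product of Γ.A with itself over Γ.
--  * 2-cells into Γ.A.A.Id_A are determined by their projection to Γ.A.A, because identity
--    types are discrete.
--  * A 2-cell into Γ.A.A making the square with (κh , κk) commute lifts to a 2-cell with target
--    k and some source h′; interchange and cancellation give κh′ = κh, and so h′ = h.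

module Submission where

open import Level using (Level; _⊔_)
open import Data.Nat.Base using (zero; suc)
open import Data.Fin.Base using (zero; suc)
open import Data.Vec.Base using ([]; _∷_; head; tail)
open import Data.Product using (Σ; _×_; _,_; proj₁; proj₂)
open import Relation.Binary.PropositionalEquality
  using (_≡_; refl; sym; trans; cong; cong₂; subst; subst₂)
open import Defs

-- Cancellation and isomorphisms in strict categories with an equality of objects.

module _ {o e a q : Level} (C : Category o e a q) where
  open Category C

  -- A left inverse of `f`, cast to the endpoints of `f′`, is still a left inverse there, so
  -- composing with it undoes both sides.
  cancelˡ : ∀ {x y z x′ y′ z′} {f : y ⇒ z} {f′ : y′ ⇒ z′} {α : x ⇒ y} {β : x′ ⇒ y′} →
            (g : z ⇒ y) → g ∘ f ≋ id {y} → f ≋ f′ → f ∘ α ≋ f′ ∘ β → α ≋ β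
  cancelˡ {f = f} {f′} g inverse e p = ≋-trans (≋-sym (undo inverse)) (≋-trans
    (∘-cong (≋-sym cast-≋) p) (undo inverse′))
    where
    undo : ∀ {w y z} {f : y ⇒ z} {g : z ⇒ y} {γ : w ⇒ y} → g ∘ f ≋ id {y} → g ∘ (f ∘ γ) ≋ γ
    undo i = ≋-trans (≋-sym assoc) (≋-trans (∘-cong i ≋-refl) identityˡ)
    inverse′ : cast (≋-cod e) (≋-dom e) g ∘ f′ ≋ id
    inverse′ = ≋-trans (∘-cong cast-≋ (≋-sym e)) (≋-trans inverse (id-cong (≋-dom e)))

module _ {o e a q o′ e′ a′ q′ : Level} {C : Category o e a q} {D : Category o′ e′ a′ q′}
         (F : Functor C D) where
  private
    module C = Category C
    module D = Category D
  open Functor F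

  -- The inverse chooses preimages of objects and arrows; all its laws become laws of `D` after
  -- applying `F`, which reflects equality.
  bijective⇒isIsomorphism :
    (∀ {x y} → F₀ x D.≈ F₀ y → x C.≈ y) →
    (∀ d → Σ C.Obj λ x → F₀ x D.≈ d) →
    (∀ {x y} {μ ν : x C.⇒ y} → F₁ μ D.≋ F₁ ν → μ C.≋ ν) →
    (∀ {x y} (f : F₀ x D.⇒ F₀ y) → Σ (x C.⇒ y) λ μ → F₁ μ D.≋ f) →
    IsIsomorphism F
  bijective⇒isIsomorphism injective surjective faithful full = record
    { inverse = record
      { F₀ = G₀
      ; F₁ = G₁
      ; F₀-cong = λ p → injective (D.≈.trans (FG₀ _) (D.≈.trans p (D.≈.sym (FG₀ _))))
      ; F₁-cong = λ p → faithful′ (D.≋-trans (FG₁ _) (D.≋-trans p (D.≋-sym (FG₁ _))))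
      ; F-id = faithful′ (D.≋-trans (FG₁ _) (D.≋-trans (D.id-cong (D.≈.sym (FG₀ _)))
          (D.≋-sym F-id)))
      ; F-∘ = faithful′ (D.≋-trans (FG₁ _) (D.≋-trans (D.∘-cong (D.≋-sym (FG₁ _))
          (D.≋-sym (FG₁ _))) (D.≋-sym F-∘)))
      }
    ; GF₀ = λ x → injective (FG₀ (F₀ x))
    ; GF₁ = λ f → faithful′ (FG₁ (F₁ f))
    ; FG₀ = FG₀
    ; FG₁ = FG₁
    }
    where
    -- Faithfulness concerns parallel arrows only; injectivity on objects supplies the cast that
    -- makes `μ` and `ν` parallel.
    faithful′ : ∀ {x y x′ y′} {μ : x C.⇒ y} {ν : x′ C.⇒ y′} → F₁ μ D.≋ F₁ ν → μ C.≋ ν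
    faithful′ p = C.≋-trans
      (faithful (D.≋-trans p (D.≋-sym (F₁-cong C.cast-≋))))
      (C.cast-≋ {p = C.≈.sym (injective (D.≋-dom p))} {C.≈.sym (injective (D.≋-cod p))})
    G₀ : D.Obj → C.Obj
    G₀ d = proj₁ (surjective d)
    FG₀ : ∀ d → F₀ (G₀ d) D.≈ d
    FG₀ d = proj₂ (surjective d)
    -- Fullness needs an arrow between values of `F₀`, so `f` is first cast to the images of the
    -- chosen preimages.
    lift₁ : ∀ {x y} (f : x D.⇒ y) → Σ (G₀ x C.⇒ G₀ y) λ μ →
            F₁ μ D.≋ D.cast (D.≈.sym (FG₀ x)) (D.≈.sym (FG₀ y)) f
    lift₁ f = full _
    G₁ : ∀ {x y} → x D.⇒ y → G₀ x C.⇒ G₀ y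
    G₁ f = proj₁ (lift₁ f)
    FG₁ : ∀ {x y} (f : x D.⇒ y) → F₁ (G₁ f) D.≋ f
    FG₁ f = D.≋-trans (proj₂ (lift₁ f)) D.cast-≋

-- 2-naturality of composition with a 2-cell.

module _ {c o e a q : Level} (K : TwoCategory c o e a q) where
  open TwoCategory K

  composeWith-isTwoNatural : ∀ {X Y : Cell₀} {s t : Cell₁ Y X} (κ : s ⇒ t) →
                             IsTwoNatural K (composeWith K κ)
  composeWith-isTwoNatural κ = record
    { natural₀ = λ f y → ◃∙
    ; natural₁ = λ f μ → square≋ ◃∙ ◃∙ (Hom.≋-sym ▹◃) (Hom.≋-sym ▹◃)
    ; natural₂ = λ φ y → square≋ ◃∙ ◃∙ (Hom.≋-sym ∙▹) (Hom.≋-sym ∙▹)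
    }

-- Locally groupoidal 2-categories: liftings and vertical 2-cells.

record IsLocallyGroupoidal {c o e a q : Level} (K : TwoCategory c o e a q) : Set (c ⊔ o ⊔ a ⊔ q) where
  open TwoCategory K
  infix 10 _⁻¹
  field
    _⁻¹      : ∀ {A B} {f g : Cell₁ A B} → f ⇒ g → g ⇒ f
    inverseˡ : ∀ {A B} {f g : Cell₁ A B} (α : f ⇒ g) → α ⁻¹ Hom.∘ α ≋ Hom.id {x = f}
    inverseʳ : ∀ {A B} {f g : Cell₁ A B} (α : f ⇒ g) → α Hom.∘ α ⁻¹ ≋ Hom.id {x = g}

module LocallyGroupoidal {c o e a q : Level} {K : TwoCategory c o e a q}
                         (K-groupoidal : IsLocallyGroupoidal K) where
  open TwoCategory K
  open IsLocallyGroupoidal K-groupoidal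

  cancel : ∀ {A B} {x y z x′ y′ z′ : Cell₁ A B} {φ : y ⇒ z} {φ′ : y′ ⇒ z′} {α : x ⇒ y}
             {β : x′ ⇒ y′} → φ ≋ φ′ → φ Hom.∘ α ≋ φ′ Hom.∘ β → α ≋ β
  cancel {A} {B} {φ = φ} = cancelˡ (Hom A B) (φ ⁻¹) (inverseˡ φ)

  undo : ∀ {A B} {x y z : Cell₁ A B} (φ : y ⇒ z) (α : x ⇒ z) → φ Hom.∘ (φ ⁻¹ Hom.∘ α) ≋ α
  undo φ α = Hom.≋-trans (Hom.≋-sym Hom.assoc)
    (Hom.≋-trans (Hom.∘-cong (inverseʳ φ) Hom.≋-refl) Hom.identityˡ)

  IsVertical : ∀ {E B Θ} (p : Cell₁ E B) {f g : Cell₁ Θ E} → f ⇒ g → Set q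
  IsVertical p {f} γ = p ▹ γ ≋ Hom.id {x = p ∙ f}

  -- This is the lifting property of an isofibration, all 2-cells being invertible: the target is
  -- prescribed, and the source only over `m`.
  record Lifting {E B Θ} (p : Cell₁ E B) {m : Cell₁ Θ B} (k : Cell₁ Θ E) (β : m ⇒ p ∙ k) :
                 Set (o ⊔ e ⊔ a ⊔ q) where
    field
      source  : Cell₁ Θ E
      source≈ : p ∙ source ≈ m
      lifted  : source ⇒ k
      lifted≋ : p ▹ lifted ≋ β
  open Lifting

  -- If 2-cells lift along p, and vertical 2-cells correspond along σ̂, then the square is a
  -- pullback on 2-cells: up to a lifting, every 2-cell into E is vertical.
  module _ {E B E′ B′ Θ} {p : Cell₁ E B} {p′ : Cell₁ E′ B′} {σ : Cell₁ B B′} {σ̂ : Cell₁ E E′}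
    (square : p′ ∙ σ̂ ≈ σ ∙ p)
    (lifting : ∀ {m : Cell₁ Θ B} (k : Cell₁ Θ E) (β : m ⇒ p ∙ k) → Lifting p k β)
    where

    ▹-square : {f g : Cell₁ Θ E} {γ : f ⇒ g} → p′ ▹ (σ̂ ▹ γ) ≋ σ ▹ (p ▹ γ)
    ▹-square = Hom.≋-trans (Hom.≋-sym ∙▹) (Hom.≋-trans (▹-cong square Hom.≋-refl) ∙▹)

    ∙-square : {f g : Cell₁ Θ E} → p ∙ f ≈ p ∙ g → p′ ∙ (σ̂ ∙ f) ≈ p′ ∙ (σ̂ ∙ g)
    ∙-square e = Hom.≈.trans over-square (Hom.≈.trans (∙-cong Hom.≈.refl e)
      (Hom.≈.sym over-square))
      where
      over-square : {h : Cell₁ Θ E} → p′ ∙ (σ̂ ∙ h) ≈ σ ∙ (p ∙ h)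
      over-square = Hom.≈.trans (Hom.≈.sym ∙-assoc)
        (Hom.≈.trans (∙-cong square Hom.≈.refl) ∙-assoc)

    -- Composing with the inverse of one common lifting `χ` of `p ▹ μ` makes both `μ` and `ν`
    -- vertical, and composing with `χ` restores them.
    faithful-from-vertical :
      (∀ {f g : Cell₁ Θ E} {γ δ : f ⇒ g} →
        IsVertical p γ → IsVertical p δ → σ̂ ▹ γ ≋ σ̂ ▹ δ → γ ≋ δ) →
      ∀ {f g : Cell₁ Θ E} {μ ν : f ⇒ g} → p ▹ μ ≋ p ▹ ν → σ̂ ▹ μ ≋ σ̂ ▹ ν → μ ≋ ν
    faithful-from-vertical faithful {f} {g} {μ} {ν} u v = Hom.≋-trans (Hom.≋-sym (undo χ μ))
      (Hom.≋-trans (Hom.∘-cong Hom.≋-refl (faithful (isVertical μ Hom.≋-refl)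
        (isVertical ν (Hom.≋-sym u))
        (Hom.≋-trans ▹-∘ (Hom.≋-trans (Hom.∘-cong Hom.≋-refl v) (Hom.≋-sym ▹-∘)))))
      (undo χ ν))
      where
      L = lifting g (p ▹ μ)
      χ = lifted L
      isVertical : (ε : f ⇒ g) → p ▹ ε ≋ p ▹ μ → IsVertical p (χ ⁻¹ Hom.∘ ε)
      isVertical ε w = cancel (lifted≋ L) (Hom.≋-trans (Hom.≋-sym ▹-∘) (Hom.≋-trans
        (▹-cong Hom.≈.refl (undo χ ε)) (Hom.≋-trans w (Hom.≋-sym Hom.identityʳ))))

    -- A lifting `χ` of `β` takes care of the base; what is left of `α` once `σ̂ ▹ χ` is divided out
    -- is vertical and comes from a vertical `γ`.
    full-from-vertical :
      (∀ {f g : Cell₁ Θ E} → p ∙ f ≈ p ∙ g → (γ′ : σ̂ ∙ f ⇒ σ̂ ∙ g) → IsVertical p′ γ′ →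
        Σ (f ⇒ g) λ γ → IsVertical p γ × σ̂ ▹ γ ≋ γ′) →
      ∀ {f g : Cell₁ Θ E} (β : p ∙ f ⇒ p ∙ g) (α : σ̂ ∙ f ⇒ σ̂ ∙ g) → p′ ▹ α ≋ σ ▹ β →
      Σ (f ⇒ g) λ μ → p ▹ μ ≋ β × σ̂ ▹ μ ≋ α
    full-from-vertical full {f} {g} β α w = χ Hom.∘ γ ,
      Hom.≋-trans ▹-∘ (Hom.≋-trans (Hom.∘-cong (lifted≋ L) (proj₁ (proj₂ γ-full)))
        Hom.identityʳ) ,
      Hom.≋-trans ▹-∘ (Hom.≋-trans (Hom.∘-cong Hom.≋-refl (proj₂ (proj₂ γ-full)))
        (undo (σ̂ ▹ χ) α))
      where
      L = lifting g β
      χ = lifted L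
      γ′ = (σ̂ ▹ χ) ⁻¹ Hom.∘ α
      isVertical : IsVertical p′ γ′
      -- Both `α` and `σ̂ ▹ χ` lie over `σ ▹ β`, so `p′ ▹ (σ̂ ▹ χ)` can be cancelled.
      isVertical = Hom.≋-trans
        (cancel Hom.≋-refl (Hom.≋-trans (Hom.≋-sym ▹-∘)
          (Hom.≋-trans (▹-cong Hom.≈.refl (undo (σ̂ ▹ χ) α)) (Hom.≋-trans w
          (Hom.≋-trans (▹-cong Hom.≈.refl (Hom.≋-sym (lifted≋ L)))
          (Hom.≋-trans (Hom.≋-sym ▹-square) (Hom.≋-sym Hom.identityʳ)))))))
        (Hom.id-cong (∙-square (source≈ L)))
      γ-full = full (Hom.≈.sym (source≈ L)) γ′ isVertical
      γ = proj₁ γ-full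

  -- A criterion for arrow objects in a slice.

  module _ {Γ A P I} {π : Cell₁ A Γ} {π₁ π₂ : Cell₁ P A} {ϖ : Cell₁ I P}
    (κ : π₁ ∙ ϖ ⇒ π₂ ∙ ϖ) (κ-vertical : IsVertical π κ)
    (s-triangle : π ∙ (π₁ ∙ ϖ) ≈ (π ∙ π₁) ∙ ϖ) (t-triangle : π ∙ (π₂ ∙ ϖ) ≈ (π ∙ π₁) ∙ ϖ)
    (κ-injective : ∀ {Θ} {h k : Cell₁ Θ I} → κ ◃ h ≋ κ ◃ k → h ≈ k)
    (κ-surjective : ∀ {Θ} {f g : Cell₁ Θ A} (α : f ⇒ g) → IsVertical π α →
      Σ (Cell₁ Θ I) λ h → κ ◃ h ≋ α)
    (pair-faithful : ∀ {Θ} {f g : Cell₁ Θ P} {μ ν : f ⇒ g} →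
      π₁ ▹ μ ≋ π₁ ▹ ν → π₂ ▹ μ ≋ π₂ ▹ ν → μ ≋ ν)
    (pair-full : ∀ {Θ} {f g : Cell₁ Θ P} (β : π₁ ∙ f ⇒ π₁ ∙ g) (α : π₂ ∙ f ⇒ π₂ ∙ g) →
      π ▹ α ≋ π ▹ β → Σ (f ⇒ g) λ μ → π₁ ▹ μ ≋ β × π₂ ▹ μ ≋ α)
    (ϖ-faithful : ∀ {Θ} {h k : Cell₁ Θ I} {μ ν : h ⇒ k} → ϖ ▹ μ ≋ ϖ ▹ ν → μ ≋ ν)
    (ϖ-lifting : ∀ {Θ} {m : Cell₁ Θ P} (k : Cell₁ Θ I) (β : m ⇒ ϖ ∙ k) → Lifting ϖ k β)
    where
    private
      module 𝕊 = TwoCategory (Slice K Γ)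
      open Over₁
      open Over₂

      s t : Over₁ K Γ (over ((π ∙ π₁) ∙ ϖ)) (over π)
      s = over₁ (π₁ ∙ ϖ) s-triangle
      t = over₁ (π₂ ∙ ϖ) t-triangle

      κ̂ : s 𝕊.⇒ t
      κ̂ = over₂ κ κ-vertical

      module _ (X : Over K Γ) where
        F : Functor (𝕊.Hom X (over ((π ∙ π₁) ∙ ϖ))) (Arrows (𝕊.Hom X (over π)))
        F = composeWith (Slice K Γ) κ̂ X
        module F = Functor F
        module ℍ = Category (𝕊.Hom X (over ((π ∙ π₁) ∙ ϖ)))
        module 𝔸 = Category (Arrows (𝕊.Hom X (over π)))

        surjective : ∀ d → Σ ℍ.Obj λ x → F.F₀ x 𝔸.≈ d
        surjective (arrow {f} {g} (over₂ α v)) with κ-surjective α v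
        -- `h` lies over `Γ` because `f` does, and `f` is the domain of `κ ◃ h`.
        ... | h , e = over₁ h (Hom.≈.trans (∙-cong (Hom.≈.sym s-triangle) Hom.≈.refl)
          (Hom.≈.trans ∙-assoc
          (Hom.≈.trans (∙-cong Hom.≈.refl (Hom.≋-dom e)) (triangle f)))) , e

        faithful : ∀ {x y} {μ ν : x ℍ.⇒ y} → F.F₁ μ 𝔸.≋ F.F₁ ν → μ ℍ.≋ ν
        faithful e = ϖ-faithful (pair-faithful
          (Hom.≋-trans (Hom.≋-sym ∙▹) (Hom.≋-trans (SquareEq.top≋ e) ∙▹))
          (Hom.≋-trans (Hom.≋-sym ∙▹) (Hom.≋-trans (SquareEq.bottom≋ e) ∙▹)))

        full : ∀ {x y} (f : F.F₀ x 𝔸.⇒ F.F₀ y) → Σ (x ℍ.⇒ y) λ μ → F.F₁ μ 𝔸.≋ f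
        full {x} {y} (square n₁ n₂ commutes) =
          over₂ μ (Hom.≋-trans (▹-cong (Hom.≈.sym s-triangle) Hom.≋-refl)
            (Hom.≋-trans ∙▹ (Hom.≋-trans (▹-cong Hom.≈.refl sμ) (Hom.≋-trans (identity n₁)
              (Hom.id-cong (Hom.≈.trans (Hom.≈.sym ∙-assoc) (∙-cong s-triangle Hom.≈.refl))))))) ,
          square≋ Hom.≋-refl Hom.≋-refl sμ (Hom.≋-trans (▹-cong Hom.≈.refl Hom.cast-≋) tχ)
          where
          h = cell₁ x
          k = cell₁ y
          β : π₁ ∙ (ϖ ∙ h) ⇒ π₁ ∙ (ϖ ∙ k)
          β = Hom.cast ∙-assoc ∙-assoc (cell₂ n₁)
          α : π₂ ∙ (ϖ ∙ h) ⇒ π₂ ∙ (ϖ ∙ k)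
          α = Hom.cast ∙-assoc ∙-assoc (cell₂ n₂)
          -- As 2-cells of the slice, `n₁` and `n₂` both lie over identities.
          πα≋πβ : π ▹ α ≋ π ▹ β
          πα≋πβ = Hom.≋-trans (▹-cong Hom.≈.refl Hom.cast-≋) (Hom.≋-trans (identity n₂)
            (Hom.≋-trans
              (Hom.id-cong (Hom.≈.trans (triangle (t 𝕊.∙ x)) (Hom.≈.sym (triangle (s 𝕊.∙ x)))))
              (Hom.≋-trans (Hom.≋-sym (identity n₁))
                (▹-cong Hom.≈.refl (Hom.≋-sym Hom.cast-≋)))))
          pair = pair-full β α πα≋πβ
          L = ϖ-lifting k (proj₁ pair)
          χ = lifted L
          sχ : (π₁ ∙ ϖ) ▹ χ ≋ cell₂ n₁
          sχ = Hom.≋-trans ∙▹ (Hom.≋-trans (▹-cong Hom.≈.refl (lifted≋ L))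
            (Hom.≋-trans (proj₁ (proj₂ pair)) Hom.cast-≋))
          tχ : (π₂ ∙ ϖ) ▹ χ ≋ cell₂ n₂
          tχ = Hom.≋-trans ∙▹ (Hom.≋-trans (▹-cong Hom.≈.refl (lifted≋ L))
            (Hom.≋-trans (proj₂ (proj₂ pair)) Hom.cast-≋))
          source≈h : source L ≈ h
          -- Naturality of `κ` along `χ`, followed by `commutes`, equates `(t ▹ χ) ∘ (κ ◃ source)`
          -- with `n₂ ∘ (κ ◃ h)`; the left factors agree by `tχ`.
          source≈h = κ-injective (cancel tχ (Hom.≋-trans interchange
            (Hom.≋-trans (Hom.∘-cong Hom.≋-refl sχ) (Hom.≋-sym commutes))))
          μ : h ⇒ k
          μ = Hom.cast source≈h Hom.≈.refl χ
          sμ : (π₁ ∙ ϖ) ▹ μ ≋ cell₂ n₁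
          sμ = Hom.≋-trans (▹-cong Hom.≈.refl Hom.cast-≋) sχ

    canBeMadeArrowObject : CanBeMadeArrowObject (Slice K Γ) (over ((π ∙ π₁) ∙ ϖ)) s t
    canBeMadeArrowObject = κ̂ , record
      { isomorphism = λ X → bijective⇒isIsomorphism (F X) κ-injective (surjective X) (faithful X)
          (full X)
      ; natural = composeWith-isTwoNatural (Slice K Γ) κ̂
      }

-- Paths in identity contexts: inverses and projections.

module Paths {r j : Level} {S : TypeTheory r j} (M : ML₂ S) where
  open TypeTheory S
  open ML₂ M
  open Substitution S
  open Identity M
  open Elim
  open Telescopes M
  open PostContexts M
  open Composition M
  open CellOperations M

  wks-⟨⟩ : ∀ {m n} (σ : Sub m (suc n)) → wks ⟨ σ ⟩ ≡ tail σ
  wks-⟨⟩ (t ∷ σ) = wks-⟨∷⟩ t σ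

  private
    tail-⟨⟩ : ∀ {m m′ s} (σ : Sub m (suc s)) (τ : Sub m′ m) → tail σ ⟨ τ ⟩ ≡ tail (σ ⟨ τ ⟩)
    tail-⟨⟩ (_ ∷ _) τ = refl
    head-⟨⟩ : ∀ {m m′ s} (σ : Sub m (suc s)) (τ : Sub m′ m) → head σ [ τ ] ≡ head (σ ⟨ τ ⟩)
    head-⟨⟩ (_ ∷ _) τ = refl

  module Inverse {k} {Φ : Ctx k} (f : ⊢ Φ) where
    private
      T : Post [] Φ zero
      T = noPost [] f
      open ElimP T
      open IdElim T

      source target : Fam k
      source = record { el = Pt.a ; el-⟨⟩ = λ P σ → refl }
      target = record { el = Pt.b ; el-⟨⟩ = λ P σ → refl }

      rfls-ids : ∀ {m} (x : Sub m k) → rfls ids ⟨ x ⟩ ≡ rfls x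
      rfls-ids x = trans (rfls-⟨⟩ ids x) (cong rfls (ids-⟨⟩ x))

      El = elims f target source b-∶ a-∶ (rfls ids)
            λ { {Θ = Θ} {γ = []} {x} {[]} G X D →
              subst (λ z → Θ ⊢ z ∶Id Φ ⦅ x , x ⦆) (sym (rfls-ids x)) (rfls-type (elim f) X) }

    -- Elimination with r(x) as the value at r(x): substituting `x` in `rfls ids` gives `rfls x`.
    inv : ∀ {m} → Sub m k → Sub m k → Sub m k → Sub m k
    inv a b p = JPs {zero} {l = zero} (rfls ids) (pt [] a b p [])

    inv-[] : ∀ {m m′} (a b p : Sub m k) (σ : Sub m′ m) →
             inv a b p ⟨ σ ⟩ ≡ inv (a ⟨ σ ⟩) (b ⟨ σ ⟩) (p ⟨ σ ⟩)
    inv-[] a b p σ = JPs-[] {zero} {l = zero} (rfls ids) (pt [] a b p []) σ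

    inv-∶ : ∀ {m} {Θ : Ctx m} {a b p} → Θ ⊢ a ∶ˢ Φ → Θ ⊢ b ∶ˢ Φ → Θ ⊢ p ∶Id Φ ⦅ a , b ⦆ →
            Θ ⊢ inv a b p ∶Id Φ ⦅ b , a ⦆
    inv-∶ A B P = Elims.Js-type El (ptᵗ ([] (∶ˢ-ctx A)) A B P ([] (∶ˢ-ctx A)))

    inv-β : ∀ {m} {Θ : Ctx m} {x} → Θ ⊢ x ∶ˢ Φ →
            Θ ⊢ inv x x (rfls x) ≐ rfls x ∶Id Φ ⦅ x , x ⦆
    inv-β {Θ = Θ} {x} X = subst
      (λ z → Θ ⊢ inv x x (rfls x) ≐ z ∶Id Φ ⦅ x , x ⦆) (rfls-ids x)
      (Elims.Js-β El ([] (∶ˢ-ctx X)) X ([] (∶ˢ-ctx X)))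

    -- By discreteness, in the form of `uniq`, it is enough to compare on reflexivities, where
    -- everything computes to a reflexivity.
    inv-comp : ∀ {m} {Θ : Ctx m} {a b p} → Θ ⊢ a ∶ˢ Φ → Θ ⊢ b ∶ˢ Φ → Θ ⊢ p ∶Id Φ ⦅ a , b ⦆ →
               Θ ⊢ comp a b a (inv a b p) p ≐ rfls a ∶Id Φ ⦅ a , a ⦆
    inv-comp A B P = uniq f source source a-∶ a-∶
      (record { el = λ P → comp (Pt.a P) (Pt.b P) (Pt.a P) (inv (Pt.a P) (Pt.b P) (Pt.p P)) (Pt.p P)
              ; el-⟨⟩ = λ P σ → trans (comp-[] (Pt.a P) (Pt.b P) (Pt.a P) _ (Pt.p P) σ)
                  (cong (λ q → comp _ _ _ q _) (inv-[] (Pt.a P) (Pt.b P) (Pt.p P) σ)) })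
      (record { el = λ P → rfls (Pt.a P) ; el-⟨⟩ = λ P σ → rfls-⟨⟩ (Pt.a P) σ })
      (λ R → comp-∶ f (a-∶ R) (b-∶ R) (a-∶ R) (inv-∶ (a-∶ R) (b-∶ R) (p-∶ R)) (p-∶ R))
      (λ R → rfls-type (elim f) (a-∶ R))
      (λ G X D → let R = rfls-type (elim f) X in Id≐-trans X X
        (comp-cong f (≐ˢ-refl X) (≐ˢ-refl X) (≐ˢ-refl X) (inv-β X) (Id≐-refl R))
        (comp-β f X X R))
      (ptᵗ ([] (∶ˢ-ctx A)) A B P ([] (∶ˢ-ctx A)))

    comp-inv : ∀ {m} {Θ : Ctx m} {a b p} → Θ ⊢ a ∶ˢ Φ → Θ ⊢ b ∶ˢ Φ → Θ ⊢ p ∶Id Φ ⦅ a , b ⦆ →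
               Θ ⊢ comp b a b p (inv a b p) ≐ rfls b ∶Id Φ ⦅ b , b ⦆
    comp-inv A B P = uniq f target target b-∶ b-∶
      (record { el = λ P → comp (Pt.b P) (Pt.a P) (Pt.b P) (Pt.p P) (inv (Pt.a P) (Pt.b P) (Pt.p P))
              ; el-⟨⟩ = λ P σ → trans (comp-[] (Pt.b P) (Pt.a P) (Pt.b P) (Pt.p P) _ σ)
                  (cong (comp _ _ _ _) (inv-[] (Pt.a P) (Pt.b P) (Pt.p P) σ)) })
      (record { el = λ P → rfls (Pt.b P) ; el-⟨⟩ = λ P σ → rfls-⟨⟩ (Pt.b P) σ })
      (λ R → comp-∶ f (b-∶ R) (a-∶ R) (b-∶ R) (p-∶ R) (inv-∶ (a-∶ R) (b-∶ R) (p-∶ R)))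
      (λ R → rfls-type (elim f) (b-∶ R))
      (λ G X D → let R = rfls-type (elim f) X in Id≐-trans X X
        (comp-cong f (≐ˢ-refl X) (≐ˢ-refl X) (≐ˢ-refl X) (Id≐-refl R) (inv-β X))
        (comp-β f X X R))
      (ptᵗ ([] (∶ˢ-ctx A)) A B P ([] (∶ˢ-ctx A)))

  -- Again by `uniq`: on a reflexivity both sides are reflexivities, so whiskering with a projection
  -- merely drops the last component.
  bullet-wks : ∀ {k m} {Φ : Ctx k} {D : Ty k} {Θ : Ctx m} {a b p} →
               Θ ⊢ a ∶ˢ Φ ▷ D → Θ ⊢ b ∶ˢ Φ ▷ D → Θ ⊢ p ∶Id Φ ▷ D ⦅ a , b ⦆ →
               Θ ⊢ bullet wks a b p ≐ tail p ∶Id Φ ⦅ tail a , tail b ⦆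
  bullet-wks {k} {Φ = Φ} {D} A B P with ∶ˢ-cod A
  ... | f ▷ d = uniq f
    (record { el = λ P → tail (Pt.a P) ; el-⟨⟩ = λ P σ → tail-⟨⟩ (Pt.a P) σ })
    (record { el = λ P → tail (Pt.b P) ; el-⟨⟩ = λ P σ → tail-⟨⟩ (Pt.b P) σ })
    (λ R → ∶ˢ-tail (a-∶ R)) (λ R → ∶ˢ-tail (b-∶ R))
    (record { el = λ P → bullet wks (Pt.a P) (Pt.b P) (Pt.p P)
            ; el-⟨⟩ = λ P σ → bullet-[] wks (Pt.a P) (Pt.b P) (Pt.p P) σ })
    (record { el = λ P → tail (Pt.p P) ; el-⟨⟩ = λ P σ → tail-⟨⟩ (Pt.p P) σ })
    (λ {_} {Θ} {P} R → subst₂ (λ u v → Θ ⊢ bullet wks (Pt.a P) (Pt.b P) (Pt.p P) ∶Id Φ ⦅ u , v ⦆)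
      (wks-⟨⟩ (Pt.a P)) (wks-⟨⟩ (Pt.b P)) (bullet-∶ (wks-∶ˢ d) (a-∶ R) (b-∶ R) (p-∶ R)))
    (λ R → Id-tail (p-∶ R))
    (λ { {_} {Θ} {γ} {y ∷ x} {δ} G X D → subst
      (λ z → Θ ⊢ bullet wks (y ∷ x) (y ∷ x) (rfls (y ∷ x)) ≐ rfls z ∶Id Φ ⦅ z , z ⦆)
      (wks-⟨∷⟩ y x) (bullet-β (wks-∶ˢ d) X) })
    (ptᵗ ([] (∶ˢ-ctx A)) A B P ([] (∶ˢ-ctx A)))
    where
    T : Post [] (Φ ▷ D) zero
    T = noPost [] (∶ˢ-cod A)
    open ElimP T
    open IdElim T

  -- Vertical paths and their images under `lift σ`.

  module _ {k} {Φ : Ctx k} {D : Ty k} (d : Φ ⊢ D type) {m} {Θ : Ctx m} {x}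
           (X : Θ ⊢ x ∶ˢ Φ) where
    private
      f = type-ctx d
      open Transport (elim f) d

    -- The last component of a path should end at the transport of `z`; transport along a
    -- reflexivity is definitionally the identity.
    vertical-∶ : ∀ {y z q} → Θ ⊢ y ∶ D [ x ]ᵀ → Θ ⊢ z ∶ D [ x ]ᵀ → Θ ⊢ q ∶ Id (D [ x ]ᵀ) y z →
                 Θ ⊢ q ∷ rfls x ∶Id Φ ▷ D ⦅ y ∷ x , z ∷ x ⦆
    vertical-∶ Y Z Q = rfls-type (elim f) X ∷ conv (≐type-sym (Id-tr X Y Z)) Q

  module _ {k l} {Φ : Ctx k} {Ψ : Ctx l} {σ : Sub k l} {D : Ty l}
           (s : Φ ⊢ σ ∶ˢ Ψ) (d : Ψ ⊢ D type) where
    private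
      Dσ : Ty k
      Dσ = D [ σ ]ᵀ
      dσ = subst-type s d
      f = ∶ˢ-ctx s
      ψ = ∶ˢ-cod s
      open Transport (elim f) dσ

      T : Post [] (Φ ▷ Dσ) zero
      T = noPost [] (f ▷ dσ)
      open ElimP T
      open IdElim T

      transported : ∀ {m} → Pt 0 (suc k) 0 m → Tm m
      transported P = tr (tail (Pt.a P)) (tail (Pt.b P)) (tail (Pt.p P)) (head (Pt.b P))

      transported-[] : ∀ {m m′} (P : Pt 0 (suc k) 0 m) (τ : Sub m′ m) →
                       transported P [ τ ] ≡ transported (P ⟪ τ ⟫)
      transported-[] P τ = trans
        (tr-[] (tail (Pt.a P)) (tail (Pt.b P)) (tail (Pt.p P)) (head (Pt.b P)) τ)
        (cong₄ tr (tail-⟨⟩ (Pt.a P) τ) (tail-⟨⟩ (Pt.b P) τ) (tail-⟨⟩ (Pt.p P) τ)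
          (head-⟨⟩ (Pt.b P) τ))

      σtail-[] : ∀ {m m′} (a : Sub m (suc k)) (τ : Sub m′ m) →
                 σ ⟨ tail a ⟩ ⟨ τ ⟩ ≡ σ ⟨ tail (a ⟨ τ ⟩) ⟩
      σtail-[] a τ = trans (⟨⟩-⟨⟩ σ (tail a) τ) (cong (σ ⟨_⟩) (tail-⟨⟩ a τ))

      source target before after : Fam (suc l)
      source = record
        { el = λ P → head (Pt.a P) ∷ σ ⟨ tail (Pt.a P) ⟩
        ; el-⟨⟩ = λ P τ → cong₂ _∷_ (head-⟨⟩ (Pt.a P) τ) (σtail-[] (Pt.a P) τ) }
      target = record
        { el = λ P → transported P ∷ σ ⟨ tail (Pt.a P) ⟩
        ; el-⟨⟩ = λ P τ → cong₂ _∷_ (transported-[] P τ) (σtail-[] (Pt.a P) τ) }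
      before = record
        { el = λ P → bullet (lift σ) (head (Pt.a P) ∷ tail (Pt.a P))
            (transported P ∷ tail (Pt.a P)) (head (Pt.p P) ∷ rfls (tail (Pt.a P)))
        ; el-⟨⟩ = λ P τ → trans (bullet-[] (lift σ) _ _ _ τ) (cong₃ (bullet (lift σ))
            (cong₂ _∷_ (head-⟨⟩ (Pt.a P) τ) (tail-⟨⟩ (Pt.a P) τ))
            (cong₂ _∷_ (transported-[] P τ) (tail-⟨⟩ (Pt.a P) τ))
            (cong₂ _∷_ (head-⟨⟩ (Pt.p P) τ)
              (trans (rfls-⟨⟩ (tail (Pt.a P)) τ) (cong rfls (tail-⟨⟩ (Pt.a P) τ))))) }
      after = record
        { el = λ P → head (Pt.p P) ∷ rfls (σ ⟨ tail (Pt.a P) ⟩)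
        ; el-⟨⟩ = λ P τ → cong₂ _∷_ (head-⟨⟩ (Pt.p P) τ)
            (trans (rfls-⟨⟩ (σ ⟨ tail (Pt.a P) ⟩) τ) (cong rfls (σtail-[] (Pt.a P) τ))) }

      D-inst : ∀ {m} (x : Sub m k) → Dσ [ x ]ᵀ ≡ D [ σ ⟨ x ⟩ ]ᵀ
      D-inst x = []-[]ᵀ D σ x

      σ̂ : Φ ▷ Dσ ⊢ lift σ ∶ˢ Ψ ▷ D
      σ̂ = lift-∶ˢ s d

      -- The vertical path (q , r(x)) starting at (y , x) ends at (p*(y′) , x), so it is a
      -- function of the path (q , p) from (y , x) to (y′ , x′), on which one can eliminate.
      bullet-lift-tr : ∀ {m} {Θ : Ctx m} {P} → Θ ⊢ᵖ P →
                       Θ ⊢ el before P ≐ el after P ∶Id Ψ ▷ D ⦅ el source P , el target P ⦆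
      bullet-lift-tr = uniq (ψ ▷ d) source target
        (λ R → ⟨⟩-∶ˢ s (∶ˢ-tail (a-∶ R)) ∷ (d , (∶ˢ-head (a-∶ R) ∶≡ D-inst _)))
        (λ R → ⟨⟩-∶ˢ s (∶ˢ-tail (a-∶ R)) ∷ (d , (transported-∶ R ∶≡ D-inst _)))
        before after
        (λ {_} {Θ} {P} R → subst₂ (λ u v → Θ ⊢ el before P ∶Id Ψ ▷ D ⦅ u , v ⦆)
          (lift-⟨∷⟩ σ _ _) (lift-⟨∷⟩ σ _ _)
          (bullet-∶ σ̂ (∶ˢ-tail (a-∶ R) ∷ (dσ , ∶ˢ-head (a-∶ R)))
            (∶ˢ-tail (a-∶ R) ∷ (dσ , transported-∶ R))
            (vertical-∶ dσ (∶ˢ-tail (a-∶ R)) (∶ˢ-head (a-∶ R)) (transported-∶ R)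
              (Id-head (p-∶ R)))))
        (λ {_} {_} {P} R → vertical-∶ d (⟨⟩-∶ˢ s (∶ˢ-tail (a-∶ R))) (∶ˢ-head (a-∶ R) ∶≡ D-inst _)
          (transported-∶ R ∶≡ D-inst _)
          (Id-head (p-∶ R) ∶≡ cong (λ B → Id B (head (Pt.a P)) (transported P)) (D-inst _)))
        -- On reflexivities the endpoint `tr x x (rfls x) y` is `y` by `tr-β`; conversion along `e`
        -- makes `bullet-β` applicable.
        (λ { {_} {Θ} {γ} {y ∷ x} {δ} G (X ∷ (_ , Y)) D′ →
          let R = rfls-type (elim f) X
              X₁ = X ∷ (dσ , Y)
              e = ≐ˢ-refl X ∷ (dσ , tr-β X Y)
              R₁ = rfls-type (elim (f ▷ dσ)) X₁
          in subst₂ (λ u v → Θ ⊢ bullet (lift σ) (y ∷ x) (tr x x (rfls x) y ∷ x) (rfls (y ∷ x)) ≐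
                                  rfl y ∷ rfls (σ ⟨ x ⟩) ∶Id Ψ ▷ D ⦅ u , v ⦆)
            (lift-⟨∷⟩ σ y x) (lift-⟨∷⟩ σ (tr x x (rfls x) y) x)
            (Id-conv≐ (≐ˢ-refl (⟨⟩-∶ˢ σ̂ X₁)) (⟨⟩-≐ˢ σ̂ (≐ˢ-sym e))
              (Id≐-trans (⟨⟩-∶ˢ σ̂ X₁) (⟨⟩-∶ˢ σ̂ X₁)
                (Id-conv≐ (≐ˢ-refl (⟨⟩-∶ˢ σ̂ X₁)) (⟨⟩-≐ˢ σ̂ e)
                  (bullet-cong σ̂ (≐ˢ-refl X₁) e
                    (Id-conv≐ (≐ˢ-refl X₁) (≐ˢ-sym e) (Id≐-refl R₁))))
                (subst (λ z → Θ ⊢ bullet (lift σ) (y ∷ x) (y ∷ x) (rfls (y ∷ x)) ≐ rfls z ∶Id Ψ ▷ D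
                          ⦅ lift σ ⟨ y ∷ x ⟩ , lift σ ⟨ y ∷ x ⟩ ⦆)
                  (lift-⟨∷⟩ σ y x) (bullet-β σ̂ X₁)))) })
        where
        transported-∶ : ∀ {m} {Θ : Ctx m} {P} → Θ ⊢ᵖ P →
                        Θ ⊢ transported P ∶ Dσ [ tail (Pt.a P) ]ᵀ
        transported-∶ R = tr-type (∶ˢ-tail (a-∶ R)) (∶ˢ-tail (b-∶ R)) (Id-tail (p-∶ R))
          (∶ˢ-head (b-∶ R))

    -- The case of `bullet-lift-tr` where the path eliminated on is itself (`q` , r(x)), so that the
    -- transported endpoint reduces to `z`.
    bullet-lift : ∀ {m} {Θ : Ctx m} {x y z q} → Θ ⊢ x ∶ˢ Φ → Θ ⊢ y ∶ Dσ [ x ]ᵀ →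
                  Θ ⊢ z ∶ Dσ [ x ]ᵀ → Θ ⊢ q ∶ Id (Dσ [ x ]ᵀ) y z →
                  Θ ⊢ bullet (lift σ) (y ∷ x) (z ∷ x) (q ∷ rfls x) ≐ q ∷ rfls (σ ⟨ x ⟩)
                    ∶Id Ψ ▷ D ⦅ y ∷ σ ⟨ x ⟩ , z ∷ σ ⟨ x ⟩ ⦆
    bullet-lift {Θ = Θ} {x} {y} {z} {q} X Y Z Q = subst₂
      (λ u v → Θ ⊢ bullet (lift σ) (y ∷ x) (z ∷ x) (q ∷ rfls x) ≐ q ∷ rfls (σ ⟨ x ⟩)
                 ∶Id Ψ ▷ D ⦅ u , v ⦆)
      (lift-⟨∷⟩ σ y x) (lift-⟨∷⟩ σ z x)
      (Id≐-trans HY HZ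
        (bullet-cong σ̂ (≐ˢ-refl (X ∷ (dσ , Y))) (≐ˢ-sym e) (Id≐-refl (vertical-∶ dσ X Y Z Q)))
        (Id-conv≐ (≐ˢ-refl HY) (⟨⟩-≐ˢ σ̂ e)
          (subst₂ (λ u v → Θ ⊢ bullet (lift σ) (y ∷ x) (tr x x (rfls x) z ∷ x) (q ∷ rfls x) ≐
                     q ∷ rfls (σ ⟨ x ⟩) ∶Id Ψ ▷ D ⦅ u , v ⦆)
            (sym (lift-⟨∷⟩ σ y x)) (sym (lift-⟨∷⟩ σ (tr x x (rfls x) z) x))
            (bullet-lift-tr (ptᵗ ([] (∶ˢ-ctx X)) (X ∷ (dσ , Y)) (X ∷ (dσ , Z))
              (vertical-∶ dσ X Y Z Q) ([] (∶ˢ-ctx X)))))))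
      where
      e : Θ ⊢ tr x x (rfls x) z ∷ x ≐ z ∷ x ∶ˢ Φ ▷ Dσ
      e = ≐ˢ-refl X ∷ (dσ , tr-β X Z)
      HY = ⟨⟩-∶ˢ σ̂ (X ∷ (dσ , Y))
      HZ = ⟨⟩-∶ˢ σ̂ (X ∷ (dσ , Z))

  module _ {k} {Φ : Ctx k} {D : Ty k} (d : Φ ⊢ D type) {m} {Θ : Ctx m} where

    -- The base of a vertical 2-cell is reflexive only up to definitional equality; congruence of
    -- transport reduces this to `Id-tr`.
    Id-over-rfls : ∀ {x x′ p y z} → Θ ⊢ x ∶ˢ Φ → Θ ⊢ x ≐ x′ ∶ˢ Φ → Θ ⊢ p ≐ rfls x ∶Id Φ ⦅ x , x′ ⦆ →
                   Θ ⊢ y ∶ D [ x ]ᵀ → Θ ⊢ z ∶ D [ x′ ]ᵀ →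
                   Θ ⊢ Id (D [ x ]ᵀ) y (tr x x′ p z) ≐ Id (D [ x ]ᵀ) y z type
    Id-over-rfls X e p Y Z = ≐type-trans
      (last≐ (≐ˢ-refl X ∷ (d , ≐-refl Y)) (≐ˢ-sym e ∷ (d , ≐-refl Z)) p)
      (Transport.Id-tr (elim (type-ctx d)) d X Y (conv (≐type-sym (type-subst-≐ e d)) Z))

    vertical-≐ : ∀ {f g q q′} → Θ ⊢ f ∶ˢ Φ ▷ D → Θ ⊢ g ∶ˢ Φ ▷ D → Θ ⊢ tail f ≐ tail g ∶ˢ Φ →
                 Θ ⊢ q ≐ q′ ∶ Id (D [ tail f ]ᵀ) (head f) (head g) →
                 Θ ⊢ q ∷ rfls (tail f) ≐ q′ ∷ rfls (tail f) ∶Id Φ ▷ D ⦅ f , g ⦆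
    vertical-≐ (X ∷ (_ , Y)) (X′ ∷ (_ , Z)) e Q = R ∷
      ≐-conv (≐type-sym (Id-over-rfls X e R Y Z)) Q
      where R = Id-conv≐ (≐ˢ-refl X) e (Id≐-refl (rfls-type (elim (type-ctx d)) X))

    vertical-∶′ : ∀ {f g q} → Θ ⊢ f ∶ˢ Φ ▷ D → Θ ⊢ g ∶ˢ Φ ▷ D → Θ ⊢ tail f ≐ tail g ∶ˢ Φ →
                  Θ ⊢ q ∶ Id (D [ tail f ]ᵀ) (head f) (head g) →
                  Θ ⊢ q ∷ rfls (tail f) ∶Id Φ ▷ D ⦅ f , g ⦆
    vertical-∶′ F G e Q = Id≐-left (vertical-≐ F G e (≐-refl Q))

    vertical-head : ∀ {f g p} → Θ ⊢ f ∶ˢ Φ ▷ D → Θ ⊢ g ∶ˢ Φ ▷ D → Θ ⊢ tail f ≐ tail g ∶ˢ Φ →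
                    Θ ⊢ p ∶Id Φ ▷ D ⦅ f , g ⦆ →
                    Θ ⊢ tail p ≐ rfls (tail f) ∶Id Φ ⦅ tail f , tail g ⦆ →
                    Θ ⊢ head p ∶ Id (D [ tail f ]ᵀ) (head f) (head g)
    vertical-head (X ∷ (_ , Y)) (X′ ∷ (_ , Z)) e (_ ∷ q) p = conv (Id-over-rfls X e p Y Z) q

    vertical-η : ∀ {f g p} → Θ ⊢ p ∶Id Φ ▷ D ⦅ f , g ⦆ →
                 Θ ⊢ tail p ≐ rfls (tail f) ∶Id Φ ⦅ tail f , tail g ⦆ →
                 Θ ⊢ p ≐ head p ∷ rfls (tail f) ∶Id Φ ▷ D ⦅ f , g ⦆
    vertical-η (_ ∷ q) p = p ∷ ≐-refl q

    -- `p′` is left arbitrary because the second path may start over a point only definitionally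
    -- equal to `tail f`.
    vertical-injective : ∀ {f g p′ q q′} → Θ ⊢ f ∶ˢ Φ ▷ D → Θ ⊢ g ∶ˢ Φ ▷ D →
                         Θ ⊢ tail f ≐ tail g ∶ˢ Φ →
                         Θ ⊢ q ∷ rfls (tail f) ≐ q′ ∷ p′ ∶Id Φ ▷ D ⦅ f , g ⦆ →
                         Θ ⊢ q ≐ q′ ∶ Id (D [ tail f ]ᵀ) (head f) (head g)
    vertical-injective (X ∷ (_ , Y)) (X′ ∷ (_ , Z)) e (_ ∷ q) = ≐-conv
      (Id-over-rfls X e (Id-conv≐ (≐ˢ-refl X) e (Id≐-refl (rfls-type (elim (type-ctx d)) X))) Y Z) q

  -- Conversion along `e` moves `z` over the base point of `y`, the situation of `bullet-lift`.
  bullet-vertical : ∀ {k l m} {Φ : Ctx k} {Ψ : Ctx l} {Θ : Ctx m} {σ : Sub k l} {D : Ty l} {f g q} →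
                    Φ ⊢ σ ∶ˢ Ψ → Ψ ⊢ D type →
                    Θ ⊢ f ∶ˢ Φ ▷ D [ σ ]ᵀ → Θ ⊢ g ∶ˢ Φ ▷ D [ σ ]ᵀ → Θ ⊢ tail f ≐ tail g ∶ˢ Φ →
                    Θ ⊢ q ∶ Id (D [ σ ]ᵀ [ tail f ]ᵀ) (head f) (head g) →
                    Θ ⊢ bullet (lift σ) f g (q ∷ rfls (tail f)) ≐ q ∷ rfls (tail (lift σ ⟨ f ⟩))
                      ∶Id Ψ ▷ D ⦅ lift σ ⟨ f ⟩ , lift σ ⟨ g ⟩ ⦆
  bullet-vertical {Ψ = Ψ} {Θ} {σ} {D} {y ∷ x} {z ∷ x′} {q} s d (X ∷ (_ , Y)) (X′ ∷ (_ , Z)) e Q =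
    Id-conv≐ (≐ˢ-refl HF) (⟨⟩-≐ˢ σ̂ (≐ˢ-sym G≐))
      (Id≐-trans HF (⟨⟩-∶ˢ σ̂ (X ∷ (dσ , Z′)))
        (Id-conv≐ (≐ˢ-refl HF) (⟨⟩-≐ˢ σ̂ G≐) (bullet-cong σ̂ (≐ˢ-refl F) G≐
          (Id≐-refl (vertical-∶′ dσ F (X′ ∷ (dσ , Z)) e Q))))
        (subst₂ (λ u v → Θ ⊢ bullet (lift σ) (y ∷ x) (z ∷ x) (q ∷ rfls x) ≐ q ∷ rfls (tail u)
                   ∶Id Ψ ▷ D ⦅ u , v ⦆)
          (sym (lift-⟨∷⟩ σ y x)) (sym (lift-⟨∷⟩ σ z x)) (bullet-lift s d X Y Z′ Q)))
    where
    dσ = subst-type s d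
    σ̂ = lift-∶ˢ s d
    F = X ∷ (dσ , Y)
    Z′ = conv (≐type-sym (type-subst-≐ e dσ)) Z
    G≐ = ≐ˢ-sym e ∷ (dσ , ≐-refl Z)
    HF = ⟨⟩-∶ˢ σ̂ F

  -- The last components are paths between elements of an identity type, hence both are `rfl u`,
  -- once `e` has brought the second into the type of the first.
  discrete-≐ : ∀ {k m} {Φ : Ctx k} {Θ : Ctx m} {B b c f g p p′} → Θ ⊢ f ∶ˢ Φ ▷ Id B b c →
               Θ ⊢ g ∶ˢ Φ ▷ Id B b c →
               Θ ⊢ p ∶Id Φ ▷ Id B b c ⦅ f , g ⦆ → Θ ⊢ p′ ∶Id Φ ▷ Id B b c ⦅ f , g ⦆ →
               Θ ⊢ tail p ≐ tail p′ ∶Id Φ ⦅ tail f , tail g ⦆ →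
               Θ ⊢ p ≐ p′ ∶Id Φ ▷ Id B b c ⦅ f , g ⦆
  discrete-≐ {Θ = Θ} {B} {b} {c} {u ∷ x} {v ∷ x′} {q ∷ p} {q′ ∷ p′} F@(X ∷ (d , U)) G@(_ ∷ (_ , V))
    (P ∷ Q) (P′ ∷ Q′) e = e ∷ (≐-trans (reflexivity Q) (≐-sym (reflexivity
      (conv (≐type-sym (last≐ (≐ˢ-refl F) (≐ˢ-refl G) e)) Q′))) ≐≡ sym endpoints)
    where
    T = Transport.tr-type (elim (∶ˢ-cod X)) d X (∶ˢ-tail G) P V
    endpoints : Id (Id B b c [ x ]ᵀ) u (tr x x′ p v) ≡
                Id (Id (B [ x ]ᵀ) (b [ x ]) (c [ x ])) u (tr x x′ p v)
    endpoints = cong (λ C → Id C u (tr x x′ p v)) (Id-[] B b c x)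
    reflexivity : ∀ {α} → Θ ⊢ α ∶ Id (Id B b c [ x ]ᵀ) u (tr x x′ p v) →
                  Θ ⊢ α ≐ rfl u ∶ Id (Id (B [ x ]ᵀ) (b [ x ]) (c [ x ])) u (tr x x′ p v)
    reflexivity A = discrete-rfl (U ∶≡ Id-[] B b c x) (T ∶≡ Id-[] B b c x) (A ∶≡ endpoints)

-- Inverses, vertical 2-cells and liftings in `ℭ`.

module Cells {r j : Level} {S : TypeTheory r j} (M : ML₂ S) where
  open TypeTheory S
  open ML₂ M
  open Substitution S
  open Identity M
  open PostContexts M
  open CellOperations M
  open Contexts M
  open Context
  open Type
  open Morphism
  open Morphism≈
  open Cell renaming (terms to paths; typed to paths-typed)
  open Cell≋
  open Paths M
  open TwoCategory ℭ

  paths-∶ : ∀ {Γ Δ} {f g : Morphism Γ Δ} (α : Cell f g) →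
            ctx Γ ⊢ paths α ∶Id ctx Δ ⦅ terms f , terms g ⦆
  paths-∶ α = toId (paths-typed α)

  ≡⇒≈ : ∀ {Γ Δ} {f g : Morphism Γ Δ} → terms f ≡ terms g → f ≈ g
  ≡⇒≈ {Γ} {Δ} {f} e = morphism≈ (subst (λ t → ctx Γ ⊢ terms f ≐ t ∶ˢ ctx Δ) e (≐ˢ-refl (typed f)))

  parallel : ∀ {Γ Δ} {f g : Morphism Γ Δ} {α β : Cell f g} →
             ctx Γ ⊢ paths α ≐ paths β ∶Id ctx Δ ⦅ terms f , terms g ⦆ → α ≋ β
  parallel p = cell≋ Hom.≈.refl Hom.≈.refl (fromId≐ p)

  private
    inverse-paths : ∀ {Γ Δ} {f g : Morphism Γ Δ} → f ⇒ g → g ⇒ f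
    inverse-paths {Δ = Δ} {f} {g} α = cell (Inverse.inv (ctx-ok Δ) (terms f) (terms g) (paths α))
      (fromId (Inverse.inv-∶ (ctx-ok Δ) (typed f) (typed g) (paths-∶ α)))

  ℭ-isLocallyGroupoidal : IsLocallyGroupoidal ℭ
  ℭ-isLocallyGroupoidal = record
    { _⁻¹ = inverse-paths
    ; inverseˡ = λ {_} {Δ} {f} {g} α →
        parallel (Inverse.inv-comp (ctx-ok Δ) (typed f) (typed g) (paths-∶ α))
    ; inverseʳ = λ {_} {Δ} {f} {g} α →
        parallel (Inverse.comp-inv (ctx-ok Δ) (typed f) (typed g) (paths-∶ α))
    }

  open LocallyGroupoidal ℭ-isLocallyGroupoidal

  module _ {Φ : Context} (D : Type Φ) {Θ : Context} where

    π≈⇒ : {f g : Morphism Θ (Φ ⨟ D)} → π D ∙ f ≈ π D ∙ g →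
          ctx Θ ⊢ tail (terms f) ≐ tail (terms g) ∶ˢ ctx Φ
    π≈⇒ {f} {g} e = subst₂ (λ u v → ctx Θ ⊢ u ≐ v ∶ˢ ctx Φ)
      (wks-⟨⟩ (terms f)) (wks-⟨⟩ (terms g)) (equal e)

    π▹-paths : {f g : Morphism Θ (Φ ⨟ D)} (α : f ⇒ g) →
               ctx Θ ⊢ paths (π D ▹ α) ≐ tail (paths α)
                 ∶Id ctx Φ ⦅ terms (π D ∙ f) , terms (π D ∙ g) ⦆
    π▹-paths {f} {g} α = subst₂
      (λ u v → ctx Θ ⊢ paths (π D ▹ α) ≐ tail (paths α) ∶Id ctx Φ ⦅ u , v ⦆)
      (sym (wks-⟨⟩ (terms f))) (sym (wks-⟨⟩ (terms g)))
      (bullet-wks (typed f) (typed g) (paths-∶ α))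

    vertical : (f g : Morphism Θ (Φ ⨟ D)) → π D ∙ f ≈ π D ∙ g → ∀ {q} →
               ctx Θ ⊢ q ∶ Id (expr D [ tail (terms f) ]ᵀ) (head (terms f)) (head (terms g)) →
               f ⇒ g
    vertical f g e {q} Q = cell (q ∷ rfls (tail (terms f)))
      (fromId (vertical-∶′ (is-type D) (typed f) (typed g) (π≈⇒ e) Q))

    module _ {f g : Morphism Θ (Φ ⨟ D)} (γ : f ⇒ g) (v : IsVertical (π D) γ) where
      base≈ : π D ∙ f ≈ π D ∙ g
      base≈ = Hom.≈.sym (cod≈ v)

      private
        -- By `bullet-wks` these are the paths of `π D ▹ γ`, which `v` makes reflexivities.
        tail-paths : ctx Θ ⊢ tail (paths γ) ≐ rfls (tail (terms f))
                       ∶Id ctx Φ ⦅ tail (terms f) , tail (terms g) ⦆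
        tail-paths = Id≐-trans (≐ˢ-left (π≈⇒ base≈)) (≐ˢ-right (π≈⇒ base≈))
          (Id≐-sym (≐ˢ-left (π≈⇒ base≈)) (≐ˢ-right (π≈⇒ base≈))
            (bullet-wks (typed f) (typed g) (paths-∶ γ)))
          (subst (λ u → ctx Θ ⊢ bullet wks (terms f) (terms g) (paths γ) ≐ rfls u
                          ∶Id ctx Φ ⦅ tail (terms f) , tail (terms g) ⦆) (wks-⟨⟩ (terms f))
            (subst₂ (λ u v → ctx Θ ⊢ bullet wks (terms f) (terms g) (paths γ) ≐ rfls (wks ⟨ terms f ⟩)
                               ∶Id ctx Φ ⦅ u , v ⦆) (wks-⟨⟩ (terms f)) (wks-⟨⟩ (terms g))
              (toId≐ (paths≐ v))))

      head-∶ : ctx Θ ⊢ head (paths γ) ∶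
               Id (expr D [ tail (terms f) ]ᵀ) (head (terms f)) (head (terms g))
      head-∶ = vertical-head (is-type D) (typed f) (typed g) (π≈⇒ base≈) (paths-∶ γ) tail-paths

      ≋-vertical : γ ≋ vertical f g base≈ head-∶
      ≋-vertical = parallel (vertical-η (is-type D) (paths-∶ γ) tail-paths)

    module _ {f g : Morphism Θ (Φ ⨟ D)} (e : π D ∙ f ≈ π D ∙ g) {q}
             (Q : ctx Θ ⊢ q ∶ Id (expr D [ tail (terms f) ]ᵀ) (head (terms f)) (head (terms g))) where

      vertical-isVertical : IsVertical (π D) (vertical f g e Q)
      vertical-isVertical = cell≋ Hom.≈.refl (Hom.≈.sym e) (fromId≐
        (subst (λ u → ctx Θ ⊢ paths (π D ▹ vertical f g e Q) ≐ rfls u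
                        ∶Id ctx Φ ⦅ wks ⟨ terms f ⟩ , wks ⟨ terms g ⟩ ⦆)
          (sym (wks-⟨⟩ (terms f))) (π▹-paths (vertical f g e Q))))

      vertical-cong : ∀ {q′ Q′} (e′ : π D ∙ f ≈ π D ∙ g) →
        ctx Θ ⊢ q ≐ q′ ∶ Id (expr D [ tail (terms f) ]ᵀ) (head (terms f)) (head (terms g)) →
        vertical f g e Q ≋ vertical f g e′ {q′} Q′
      vertical-cong e′ p = parallel (vertical-≐ (is-type D) (typed f) (typed g) (π≈⇒ e) p)

      vertical-inj : ∀ {f′ g′ q′ Q′} (e′ : π D ∙ f′ ≈ π D ∙ g′) →
        vertical f g e Q ≋ vertical f′ g′ e′ {q′} Q′ →
        ctx Θ ⊢ q ≐ q′ ∶ Id (expr D [ tail (terms f) ]ᵀ) (head (terms f)) (head (terms g))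
      vertical-inj e′ p = vertical-injective (is-type D) (typed f) (typed g) (π≈⇒ e)
        (toId≐ (paths≐ p))

    π-lifting : {m : Morphism Θ Φ} (k : Morphism Θ (Φ ⨟ D)) (β : m ⇒ π D ∙ k) → Lifting (π D) k β
    π-lifting {m} k@(morphism (z ∷ n) (N ∷ (_ , Z))) β = record
      { source = source
      ; source≈ = source≈
      ; lifted = lifted
      ; lifted≋ = cell≋ source≈ Hom.≈.refl (fromId≐ (π▹-paths lifted))
      }
      where
      B : ctx Θ ⊢ paths β ∶Id ctx Φ ⦅ terms m , n ⦆
      B = subst (λ u → ctx Θ ⊢ paths β ∶Id ctx Φ ⦅ terms m , u ⦆) (wks-⟨∷⟩ z n) (paths-∶ β)
      T = Transport.tr-type (elim (ctx-ok Φ)) (is-type D) (typed m) N B Z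
      source : Morphism Θ (Φ ⨟ D)
      source = morphism (tr (terms m) n (paths β) z ∷ terms m) (typed m ∷ (is-type D , T))
      source≈ : π D ∙ source ≈ m
      source≈ = ≡⇒≈ (wks-⟨∷⟩ _ (terms m))
      lifted : source ⇒ k
      -- The identity context asks for a path ending at the transport of `z`, and the source was
      -- chosen to be that very element.
      lifted = cell (rfl (tr (terms m) n (paths β) z) ∷ paths β) (fromId (B ∷ Id-intro T))

  -- Pulled-back types as pullbacks on 2-cells.

  module _ {Φ Ψ : Context} (σ : Morphism Φ Ψ) (D : Type Ψ)
           (σ̂-typed : ctx (Φ ⨟ pullback D σ) ⊢ lift (terms σ) ∶ˢ ctx (Ψ ⨟ D)) {Θ : Context} where
    private
      Dσ : Type Φ
      Dσ = pullback D σ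

      -- The typing derivation is a parameter so that for `σ = π A` this is `π₂ A` itself.
      σ̂ : Morphism (Φ ⨟ Dσ) (Ψ ⨟ D)
      σ̂ = morphism (lift (terms σ)) σ̂-typed

      πσ̂ : π D ∙ σ̂ ≈ σ ∙ π Dσ
      πσ̂ = ≡⇒≈ (wks-⟨∷⟩ (var zero) (terms σ ⟨ wks ⟩))

      σ̂-base : {f g : Morphism Θ (Φ ⨟ Dσ)} → π Dσ ∙ f ≈ π Dσ ∙ g → π D ∙ (σ̂ ∙ f) ≈ π D ∙ (σ̂ ∙ g)
      σ̂-base {f} {g} = ∙-square {p = π Dσ} {π D} {σ} {σ̂} πσ̂ (π-lifting Dσ) {f} {g}

      Id-lift : ∀ {m} (f g : Sub m _) →
        Id (expr Dσ [ tail f ]ᵀ) (head f) (head g) ≡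
        Id (expr D [ tail (lift (terms σ) ⟨ f ⟩) ]ᵀ)
           (head (lift (terms σ) ⟨ f ⟩)) (head (lift (terms σ) ⟨ g ⟩))
      Id-lift (y ∷ x) (z ∷ x′) = cong₃ Id
        (trans ([]-[]ᵀ (expr D) (terms σ) x)
          (cong (λ u → expr D [ tail u ]ᵀ) (sym (lift-⟨∷⟩ (terms σ) y x))))
        (cong head (sym (lift-⟨∷⟩ (terms σ) y x))) (cong head (sym (lift-⟨∷⟩ (terms σ) z x′)))

      ▹-vertical : {f g : Morphism Θ (Φ ⨟ Dσ)} (e : π Dσ ∙ f ≈ π Dσ ∙ g) → ∀ {q}
        (Q : ctx Θ ⊢ q ∶ Id (expr Dσ [ tail (terms f) ]ᵀ) (head (terms f)) (head (terms g))) →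
        σ̂ ▹ vertical Dσ f g e Q ≋
        vertical D (σ̂ ∙ f) (σ̂ ∙ g) (σ̂-base {f} {g} e) (Q ∶≡ Id-lift (terms f) (terms g))
      ▹-vertical {f} {g} e Q = parallel
        (bullet-vertical (typed σ) (is-type D) (typed f) (typed g) (π≈⇒ Dσ {f = f} {g} e) Q)

      -- A vertical 2-cell is determined by its head, and whiskering with `σ̂` keeps the head.
      vertical-faithful : {f g : Morphism Θ (Φ ⨟ Dσ)} {γ δ : f ⇒ g} →
        IsVertical (π Dσ) γ → IsVertical (π Dσ) δ → σ̂ ▹ γ ≋ σ̂ ▹ δ → γ ≋ δ
      vertical-faithful {f} {g} {γ} {δ} v w p = Hom.≋-trans (≋-vertical Dσ γ v) (Hom.≋-trans
        (vertical-cong Dσ {f = f} {g} (base≈ Dσ γ v) (head-∶ Dσ γ v) (base≈ Dσ δ w) heads)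
        (Hom.≋-sym (≋-vertical Dσ δ w)))
        where
        lifted : (ε : f ⇒ g) (u : IsVertical (π Dσ) ε) → σ̂ ▹ ε ≋ vertical D (σ̂ ∙ f) (σ̂ ∙ g)
                   (σ̂-base {f} {g} (base≈ Dσ ε u)) (head-∶ Dσ ε u ∶≡ Id-lift (terms f) (terms g))
        lifted ε u = Hom.≋-trans (▹-cong {h = σ̂} Hom.≈.refl (≋-vertical Dσ ε u))
          (▹-vertical {f} {g} (base≈ Dσ ε u) (head-∶ Dσ ε u))
        heads : ctx Θ ⊢ head (paths γ) ≐ head (paths δ) ∶
                Id (expr Dσ [ tail (terms f) ]ᵀ) (head (terms f)) (head (terms g))
        heads = vertical-inj D _ _ _
          (Hom.≋-trans (Hom.≋-sym (lifted γ v)) (Hom.≋-trans p (lifted δ w)))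
          ≐≡ sym (Id-lift (terms f) (terms g))

      -- The head of `γ′` already has the type required of a vertical 2-cell from `f` to `g`, since
      -- `Dσ` at a point is `D` at its image.
      vertical-full : {f g : Morphism Θ (Φ ⨟ Dσ)} → π Dσ ∙ f ≈ π Dσ ∙ g →
        (γ′ : σ̂ ∙ f ⇒ σ̂ ∙ g) → IsVertical (π D) γ′ → Σ (f ⇒ g) λ γ → IsVertical (π Dσ) γ × σ̂ ▹ γ ≋ γ′
      vertical-full {f} {g} e γ′ v =
        vertical Dσ f g e Q , vertical-isVertical Dσ {f = f} {g} e Q ,
        Hom.≋-trans (▹-vertical {f} {g} e Q) (Hom.≋-trans
          (vertical-cong D {f = σ̂ ∙ f} {σ̂ ∙ g} (σ̂-base {f} {g} e) _ (base≈ D γ′ v)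
            (≐-refl (head-∶ D γ′ v)))
          (Hom.≋-sym (≋-vertical D γ′ v)))
        where
        Q = head-∶ D γ′ v ∶≡ sym (Id-lift (terms f) (terms g))

    lift-faithful : {f g : Morphism Θ (Φ ⨟ Dσ)} {μ ν : f ⇒ g} →
                    π Dσ ▹ μ ≋ π Dσ ▹ ν → σ̂ ▹ μ ≋ σ̂ ▹ ν → μ ≋ ν
    lift-faithful = faithful-from-vertical {p = π Dσ} {π D} {σ} {σ̂} πσ̂ (π-lifting Dσ)
      vertical-faithful

    lift-full : {f g : Morphism Θ (Φ ⨟ Dσ)} (β : π Dσ ∙ f ⇒ π Dσ ∙ g) (α : σ̂ ∙ f ⇒ σ̂ ∙ g) →
                π D ▹ α ≋ σ ▹ β → Σ (f ⇒ g) λ μ → π Dσ ▹ μ ≋ β × σ̂ ▹ μ ≋ α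
    lift-full = full-from-vertical {p = π Dσ} {π D} {σ} {σ̂} πσ̂ (π-lifting Dσ) vertical-full

  module _ {Φ Θ : Context} {B b c} (ok : ctx Φ ⊢ Id B b c type) where
    private
      D : Type Φ
      D = type (Id B b c) ok

    discrete-faithful : {h k : Morphism Θ (Φ ⨟ D)} {μ ν : h ⇒ k} → π D ▹ μ ≋ π D ▹ ν → μ ≋ ν
    discrete-faithful {h} {k} {μ} {ν} e = parallel
      (discrete-≐ (typed h) (typed k) (paths-∶ μ) (paths-∶ ν)
        (subst₂ (λ u v → ctx Θ ⊢ tail (paths μ) ≐ tail (paths ν) ∶Id ctx Φ ⦅ u , v ⦆)
          (wks-⟨⟩ (terms h)) (wks-⟨⟩ (terms k))
          (Id≐-trans H K (Id≐-sym H K (π▹-paths D {f = h} {k} μ))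
            (Id≐-trans H K (toId≐ (paths≐ e)) (π▹-paths D {f = h} {k} ν)))))
      where
      H = typed (π D ∙ h)
      K = typed (π D ∙ k)

  -- The generic path and its universal property.

  module _ {Γ : Context} (A : Type Γ) where
    private
      s t : Morphism (ΓAAId A) (ΓA A)
      s = π₁ A ∙ π-Id A
      t = π₂ A ∙ π-Id A

      s-triangle : π A ∙ s ≈ (π A ∙ π₁ A) ∙ π-Id A
      s-triangle = Over₁.triangle (π₁π-Id A)

      t-triangle : π A ∙ t ≈ (π A ∙ π₁ A) ∙ π-Id A
      t-triangle = Over₁.triangle (π₂π-Id A)

      s≈t : π A ∙ s ≈ π A ∙ t
      s≈t = Hom.≈.trans s-triangle (Hom.≈.sym t-triangle)

      var-zero-∶ : ctx (ΓAAId A) ⊢ var zero ∶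
                   Id (expr A [ tail (terms s) ]ᵀ) (head (terms s)) (head (terms t))
      var-zero-∶ = var-zero (is-type (Id-type A)) ∶≡ trans (Id-[] _ _ _ _) (cong₃ Id
        (trans (cong (_[ wks ]ᵀ) ([]-[]ᵀ (expr A) wks wks))
          (trans ([]-[]ᵀ (expr A) _ wks) (cong (λ u → expr A [ u ⟨ wks ⟩ ]ᵀ) (wks-suc suc))))
        refl refl)

    κ : s ⇒ t
    κ = vertical A s t s≈t var-zero-∶

    κ-vertical : IsVertical (π A) κ
    κ-vertical = vertical-isVertical A {f = s} {t} s≈t var-zero-∶

    module _ {Θ : Context} where
      private
        s-inst : ∀ q z y (x : Sub (size Θ) (size Γ)) → terms s ⟨ q ∷ z ∷ y ∷ x ⟩ ≡ y ∷ x
        s-inst q z y x = trans (wk-⟨∷⟩ wks q (z ∷ y ∷ x)) (wks-⟨∷⟩ z (y ∷ x))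

        t-inst : ∀ q z y (x : Sub (size Θ) (size Γ)) → terms t ⟨ q ∷ z ∷ y ∷ x ⟩ ≡ z ∷ x
        t-inst q z y x = trans (wk-⟨∷⟩ (terms (π₂ A)) q (z ∷ y ∷ x))
          (cong₂ _∷_ (var-[] zero _) (trans (wk-⟨∷⟩ wks z (y ∷ x)) (wks-⟨∷⟩ y x)))

        Id-inst : ∀ z y (x : Sub (size Θ) (size Γ)) →
                  expr (Id-type A) [ z ∷ y ∷ x ]ᵀ ≡ Id (expr A [ x ]ᵀ) y z
        Id-inst z y x = trans (Id-[] _ _ _ _) (cong₃ Id
          (trans (wk-[∷]ᵀ (expr A [ wks ]ᵀ) z (y ∷ x)) (wk-[∷]ᵀ (expr A) y x))
          (var-[] _ _) (var-[] _ _))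

        κ-paths : (h : Sub (size Θ) _) →
                  paths κ ⟨ h ⟩ ≡ var zero [ h ] ∷ rfls (tail (terms s ⟨ h ⟩))
        κ-paths h = cong (var zero [ h ] ∷_) (rfls-⟨⟩ (tail (terms s)) h)

      -- All components of `h` can be read off `κ ◃ h`: `x` and `y` from its domain, `z` from its
      -- codomain, and `q` from its head.
      κ-injective : {h k : Morphism Θ (ΓAAId A)} → κ ◃ h ≋ κ ◃ k → h ≈ k
      κ-injective {h@(morphism (q ∷ z ∷ y ∷ x) _)} {k@(morphism (q′ ∷ z′ ∷ y′ ∷ x′) _)} e
        with subst₂ (λ u v → ctx Θ ⊢ u ≐ v ∶ˢ ctx (ΓA A)) (s-inst q z y x) (s-inst q′ z′ y′ x′)
               (equal (dom≈ e))
           | subst₂ (λ u v → ctx Θ ⊢ u ≐ v ∶ˢ ctx (ΓA A)) (t-inst q z y x) (t-inst q′ z′ y′ x′)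
               (equal (cod≈ e))
      ... | X ∷ (a , Y) | _ ∷ (_ , Z) = morphism≈
        (((X ∷ (a , Y)) ∷ (is-type (pullback A (π A)) , (Z ≐≡ sym (wk-[∷]ᵀ (expr A) y x)))) ∷
          (is-type (Id-type A) , (Q ≐≡ sym (Id-inst z y x))))
        where
        Q : ctx Θ ⊢ q ≐ q′ ∶ Id (expr A [ x ]ᵀ) y z
        Q = subst₂ (λ u v → ctx Θ ⊢ u ≐ v ∶ Id (expr A [ x ]ᵀ) y z) (var-[] zero _) (var-[] zero _)
          (subst₂ (λ f g → ctx Θ ⊢ var zero [ terms h ] ≐ var zero [ terms k ] ∶
                             Id (expr A [ tail f ]ᵀ) (head f) (head g))
            (s-inst q z y x) (t-inst q z y x)
            (vertical-injective (is-type A) (typed (s ∙ h)) (typed (t ∙ h))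
              (π≈⇒ A {f = s ∙ h} {t ∙ h} (Hom.≈.trans
                (Hom.≈.sym (∙-assoc {h = π A} {s} {h}))
                (Hom.≈.trans (∙-cong s≈t Hom.≈.refl) (∙-assoc {h = π A} {t} {h}))))
              (subst₂ (λ u v → ctx Θ ⊢ u ≐ v ∶Id ctx (ΓA A) ⦅ terms (s ∙ h) , terms (t ∙ h) ⦆)
                (κ-paths (terms h)) (κ-paths (terms k)) (toId≐ (paths≐ e)))))

      -- The same reading backwards: `f` supplies `x` and `y`, `g` supplies `z`, and the head of the
      -- vertical `α` supplies the path.
      κ-surjective : {f g : Morphism Θ (ΓA A)} (α : f ⇒ g) → IsVertical (π A) α →
                     Σ (Morphism Θ (ΓAAId A)) λ h → κ ◃ h ≋ α
      κ-surjective {f@(morphism (y ∷ x) (X ∷ (_ , Y)))} {g@(morphism (z ∷ x′) (X′ ∷ (_ , Z)))} α v =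
        h , Hom.≋-trans (cell≋ (≡⇒≈ (s-inst q z y x)) t∙h≈g (fromId≐ κ-h))
              (Hom.≋-sym (≋-vertical A α v))
        where
        q = head (paths α)
        x≐x′ : ctx Θ ⊢ x ≐ x′ ∶ˢ ctx Γ
        x≐x′ = π≈⇒ A {f = f} {g} (base≈ A α v)
        h : Morphism Θ (ΓAAId A)
        -- `z` comes typed over `x′` and must be converted to the base point `x` of `f`; hence
        -- `t ∙ h` is only definitionally equal to `g`.
        h = morphism (q ∷ z ∷ y ∷ x) (((X ∷ (is-type A , Y)) ∷ (is-type (pullback A (π A)) ,
            (conv (≐type-sym (type-subst-≐ x≐x′ (is-type A))) Z ∶≡ sym (wk-[∷]ᵀ (expr A) y x)))) ∷
          (is-type (Id-type A) , (head-∶ A α v ∶≡ sym (Id-inst z y x))))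
        t∙h≈g : t ∙ h ≈ g
        t∙h≈g = morphism≈ (subst (λ u → ctx Θ ⊢ u ≐ z ∷ x′ ∶ˢ ctx (ΓA A)) (sym (t-inst q z y x))
          (≐ˢ-sym (≐ˢ-sym x≐x′ ∷ (is-type A , ≐-refl Z))))
        κ-h : ctx Θ ⊢ paths (κ ◃ h) ≐ q ∷ rfls x ∶Id ctx (ΓA A) ⦅ terms (s ∙ h) , terms (t ∙ h) ⦆
        κ-h = subst (λ u → ctx Θ ⊢ paths (κ ◃ h) ≐ u
                             ∶Id ctx (ΓA A) ⦅ terms (s ∙ h) , terms (t ∙ h) ⦆)
          (trans (κ-paths (terms h)) (cong₂ _∷_ (var-[] zero (terms h))
            (cong (λ u → rfls (tail u)) (s-inst q z y x))))
          (Id≐-refl (paths-∶ (κ ◃ h)))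

    ΓAAId-canBeMadeArrowObject :
      CanBeMadeArrowObject (Slice ℭ Γ) (ΓAAId/Γ A) (π₁π-Id A) (π₂π-Id A)
    ΓAAId-canBeMadeArrowObject = canBeMadeArrowObject
      {π = π A} {π₁ A} {π₂ A} {π-Id A} κ κ-vertical s-triangle t-triangle κ-injective κ-surjective
      -- Γ.A.A is the pullback of `A` along its own projection, so the conditions on pairs are the
      -- case `σ = π A`.
      (lift-faithful (π A) A (typed (π₂ A))) (lift-full (π A) A (typed (π₂ A)))
      (discrete-faithful (is-type (Id-type A))) (π-lifting (Id-type A))

proposition4p1p1 : ∀ {r j : Level} (S : TypeTheory r j) (M : ML₂ S) →
    let open Contexts M in
    (Γ : Context) (A : Type Γ) →
    CanBeMadeArrowObject (Slice ℭ Γ) (ΓAAId/Γ A) (π₁π-Id A) (π₂π-Id A)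
proposition4p1p1 S M Γ A = Cells.ΓAAId-canBeMadeArrowObject M A
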